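{- $\mathrm{MFD}_{\mathbb Z}$ can be approximated within a factor $\lceil\log\Vert X\Vert\rceil+1$ in time $O(m(n+\mathrm{width}(G)\lceil\log\Vert X\Vert\rceil))$. That is, there is an algorithm which, given an $s$-$t$ DAG $G=(V,E)$ with $n$ nodes and $m$ edges and a non-zero flow $X\colon E\to\mathbb Z$, outputs within this running time a flow decomposition of $(G,X)$ with weights in $\mathbb Z$ of size at most $(\lceil\log\Vert X\Vert\rceil+1)\cdot\mathrm{mfd}_{\mathbb Z}(G,X)$.
   Context: An $s$-$t$ DAG is a directed acyclic graph $G=(V,E)$ with a unique source $s$ (no in-edges) and a unique sink $t$ (no out-edges). A flow is a function $X$ on $E$ such that at every node of $V\setminus\{s,t\}$ incoming flow equals outgoing flow. $\Vert X\Vert=\max_{e\in E}|X(e)|$. $\mathrm{width}(G)$ is the minimum number of $s$-$t$ paths needed to cover all edges of $G$. An $s$-$t$ path $P$ is identified with the flow that is $1$ on the edges of $P$ and $0$ elsewhere. A flow decomposition of $(G,X)$ of size $k$ with weights in $\mathbb Z$ is a family of $s$-$t$ paths $P_1,\dots,P_k$ with weights $w_1,\dots,w_k\in\mathbb Z$ such that $X=w_1P_1+\dots+w_kP_k$; $\mathrm{mfd}_{\mathbb Z}(G,X)$ is the smallest size of such a decomposition, and $\mathrm{MFD}_{\mathbb Z}$ is the problem of finding one of smallest size. Logarithms are base $2$. Running times count arithmetic operations on numbers as unit-cost. -}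

module Defs where

open import Data.Bool using (if_then_else_)
open import Data.Fin as Fin using (Fin; toℕ)
open import Data.Integer as ℤ using (ℤ; +_; 0ℤ; 1ℤ; ∣_∣)
import Data.Integer.Properties as ℤ
open import Data.List using (List; []; _∷_; [_]; map; concatMap; filter; foldr; length; allFin)
open import Data.List.Extrema.Nat using (max)
open import Data.List.Membership.Propositional using (_∈_)
import Data.List.Membership.DecPropositional as DecMembership
open import Data.List.Relation.Unary.Any using (Any)
open import Data.Nat as ℕ using (ℕ; zero; suc; _+_; _≤_; _<_)
open import Data.Product using (_×_; _,_; ∃-syntax)
open import Relation.Binary.PropositionalEquality using (_≡_; _≢_)
open import Relation.Nullary using (¬_; yes; no; does)

------------------------------------------------------------------------
-- Graphs

record Digraph : Set where
  field
    n m       : ℕ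
    tail head : Fin m → Fin n
    simple    : ∀ {e f} → tail e ≡ tail f → head e ≡ head f → e ≡ f

  Node = Fin n
  Edge = Fin m

  data Walk : Node → Node → Set where
    []  : ∀ {v} → Walk v v
    _∷_ : ∀ {v} (e : Edge) → Walk (head e) v → Walk (tail e) v

  edges : ∀ {u v} → Walk u v → List Edge
  edges []      = []
  edges (e ∷ p) = e ∷ edges p

  IsSource IsSink : Node → Set
  IsSource v = ∀ e → head e ≢ v
  IsSink   v = ∀ e → tail e ≢ v

record STDAG : Set where
  field
    digraph : Digraph

  open Digraph digraph public

  field
    acyclic       : ∀ e → ¬ Walk (head e) (tail e)
    s t           : Node
    s-source      : IsSource s
    source-unique : ∀ v → IsSource v → v ≡ s
    t-sink        : IsSink t
    sink-unique   : ∀ v → IsSink v → v ≡ t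

  -- Walks in an acyclic graph never repeat a node.
  STPath : Set
  STPath = Walk s t

Least : (ℕ → Set) → ℕ → Set
Least P k = P k × (∀ j → P j → k ≤ j)

sumℤ : List ℤ → ℤ
sumℤ = foldr ℤ._+_ 0ℤ

‖_‖ : ∀ {m} → (Fin m → ℤ) → ℕ
‖_‖ {m} X = max 0 (map (λ e → ∣ X e ∣) (allFin m))

------------------------------------------------------------------------
-- Flows, width and decompositions

module _ (G : STDAG) where
  open STDAG G

  inflow outflow : (Edge → ℤ) → Node → ℤ
  inflow  X v = sumℤ (map X (filter (λ e → head e Fin.≟ v) (allFin m)))
  outflow X v = sumℤ (map X (filter (λ e → tail e Fin.≟ v) (allFin m)))

  IsFlow : (Edge → ℤ) → Set
  IsFlow X = ∀ v → v ≢ s → v ≢ t → inflow X v ≡ outflow X v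

  Covers : List STPath → Set
  Covers Ps = ∀ e → Any (λ P → e ∈ edges P) Ps

  IsWidth : ℕ → Set
  IsWidth = Least λ k → ∃[ Ps ] Covers Ps × length Ps ≡ k

  open DecMembership (Fin._≟_ {m}) using (_∈?_)

  pathFlow : STPath → Edge → ℤ
  pathFlow P e = if does (e ∈? edges P) then 1ℤ else 0ℤ

  WeightedPaths : Set
  WeightedPaths = List (ℤ × STPath)

  superposition : WeightedPaths → Edge → ℤ
  superposition D e = sumℤ (map (λ (w , P) → w ℤ.* pathFlow P e) D)

  IsDecomposition : (Edge → ℤ) → WeightedPaths → Set
  IsDecomposition X D = ∀ e → X e ≡ superposition D e

  IsMfdℤ : (Edge → ℤ) → ℕ → Set
  IsMfdℤ X = Least λ k → ∃[ D ] IsDecomposition X D × length D ≡ k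

------------------------------------------------------------------------
-- A unit-cost random access machine over ℤ, programmed in a structured
-- language.  A program mentions finitely many variables and arrays, so they
-- can be interleaved in a single memory with constant overhead.

data Op : Set where
  add sub mul div leq eq : Op

data Expr : Set where
  const : ℤ → Expr
  var   : ℕ → Expr
  arr   : ℕ → Expr → Expr
  op    : Op → Expr → Expr → Expr

infixr 4 _⨾_

data Program : Set where
  skip   : Program
  assign : ℕ → Expr → Program
  store  : ℕ → Expr → Expr → Program
  _⨾_    : Program → Program → Program
  ifte   : Expr → Program → Program → Program
  while  : Expr → Program → Program

record State : Set where
  field
    vars   : ℕ → ℤ
    arrays : ℕ → ℤ → ℤ

open State public

setVar : ℕ → ℤ → State → State
setVar x v σ .vars y  = if does (x ℕ.≟ y) then v else σ .vars y
setVar x v σ .arrays  = σ .arrays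

setArr : ℕ → ℤ → ℤ → State → State
setArr a i v σ .vars       = σ .vars
setArr a i v σ .arrays b j =
  if does (a ℕ.≟ b) then (if does (i ℤ.≟ j) then v else σ .arrays b j)
  else σ .arrays b j

-- Division rounds so that the remainder is non-negative; division by zero
-- yields zero.
divℤ : ℤ → ℤ → ℤ
divℤ x y with y ℤ.≟ 0ℤ
... | yes _  = 0ℤ
... | no y≢0 = ℤ._/_ x y {{ℤ.≢-nonZero y≢0}}

⟦_⟧ᵒ : Op → ℤ → ℤ → ℤ
⟦ add ⟧ᵒ x y = x ℤ.+ y
⟦ sub ⟧ᵒ x y = x ℤ.- y
⟦ mul ⟧ᵒ x y = x ℤ.* y
⟦ div ⟧ᵒ x y = divℤ x y
⟦ leq ⟧ᵒ x y = if does (x ℤ.≤? y) then 1ℤ else 0ℤ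
⟦ eq  ⟧ᵒ x y = if does (x ℤ.≟ y) then 1ℤ else 0ℤ

⟦_⟧ : Expr → State → ℤ
⟦ const z   ⟧ σ = z
⟦ var x     ⟧ σ = σ .vars x
⟦ arr a i   ⟧ σ = σ .arrays a (⟦ i ⟧ σ)
⟦ op o d e  ⟧ σ = ⟦ o ⟧ᵒ (⟦ d ⟧ σ) (⟦ e ⟧ σ)

cost : Expr → ℕ
cost (const z)  = 1
cost (var x)    = 1
cost (arr a i)  = 1 + cost i
cost (op o d e) = 1 + cost d + cost e

-- ⟨ p , σ ⟩⇓⟨ τ , T ⟩: started in σ, the program p halts in τ after T steps.
-- The relation is deterministic in τ and T.  Non-zero conditions are true.
data ⟨_,_⟩⇓⟨_,_⟩ : Program → State → State → ℕ → Set where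
  skip : ∀ {σ} →
    ⟨ skip , σ ⟩⇓⟨ σ , 1 ⟩
  assign : ∀ {σ x e} →
    ⟨ assign x e , σ ⟩⇓⟨ setVar x (⟦ e ⟧ σ) σ , 1 + cost e ⟩
  store : ∀ {σ a i e} →
    ⟨ store a i e , σ ⟩⇓⟨ setArr a (⟦ i ⟧ σ) (⟦ e ⟧ σ) σ , 1 + cost i + cost e ⟩
  seq : ∀ {p q σ τ υ S T} →
    ⟨ p , σ ⟩⇓⟨ τ , S ⟩ → ⟨ q , τ ⟩⇓⟨ υ , T ⟩ →
    ⟨ p ⨾ q , σ ⟩⇓⟨ υ , S + T ⟩
  if-true : ∀ {b p q σ τ T} → ⟦ b ⟧ σ ≢ 0ℤ →
    ⟨ p , σ ⟩⇓⟨ τ , T ⟩ →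
    ⟨ ifte b p q , σ ⟩⇓⟨ τ , 1 + cost b + T ⟩
  if-false : ∀ {b p q σ τ T} → ⟦ b ⟧ σ ≡ 0ℤ →
    ⟨ q , σ ⟩⇓⟨ τ , T ⟩ →
    ⟨ ifte b p q , σ ⟩⇓⟨ τ , 1 + cost b + T ⟩
  while-true : ∀ {b p σ τ υ S T} → ⟦ b ⟧ σ ≢ 0ℤ →
    ⟨ p , σ ⟩⇓⟨ τ , S ⟩ → ⟨ while b p , τ ⟩⇓⟨ υ , T ⟩ →
    ⟨ while b p , σ ⟩⇓⟨ υ , 1 + cost b + S + T ⟩
  while-false : ∀ {b p σ} → ⟦ b ⟧ σ ≡ 0ℤ →
    ⟨ while b p , σ ⟩⇓⟨ σ , 1 + cost b ⟩

------------------------------------------------------------------------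
-- Input and output

-- The i-th entry, or zero beyond the end of the list.
entry : List ℤ → ℕ → ℤ
entry []       i       = 0ℤ
entry (z ∷ zs) zero    = z
entry (z ∷ zs) (suc i) = entry zs i

initial : List ℤ → State
initial zs .vars x             = 0ℤ
initial zs .arrays zero (+ i)  = entry zs i
initial zs .arrays _    _      = 0ℤ

Outputs : State → List ℤ → Set
Outputs σ zs = ∀ i → i < length zs → σ .arrays 1 (+ i) ≡ entry zs i

module _ (G : STDAG) where
  open STDAG G

  index : ∀ {k} → Fin k → ℤ
  index i = + toℕ i

  encodeInput : (Edge → ℤ) → List ℤ
  encodeInput X =
    + n ∷ + m ∷ index s ∷ index t ∷
    concatMap (λ e → index (tail e) ∷ index (head e) ∷ [ X e ]) (allFin m)

  encodeOutput : WeightedPaths G → List ℤ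
  encodeOutput D =
    + length D ∷
    concatMap (λ (w , P) → w ∷ + length (edges P) ∷ map index (edges P)) D

-- Let Z be a minimum integral flow that is at least 1 on the support of X.  It is found in time O(mn) by
-- moving at most m single units with push-relabel, and a cut shows that its value k is at most the number of
-- paths in any cover of the support, hence at most mfd and at most width.  Orienting trails through the odd
-- edges rounds half-integral flows, which gives X = A − B + 2K with |2K − X| ≤ 1 and non-negative integral
-- flows A and B whose values add up to at most k: A and B together decompose into k paths, and the norm of
-- K is at most ⌈‖X‖/2⌉.  Continue with K in place of X; once the norm is at most 1, take K = 0.

module Submission where

open import Defs
open import Data.Bool using (Bool; true; false; T; not; _∧_; _∨_; if_then_else_)
open import Data.Empty using (⊥; ⊥-elim)
open import Data.Unit using (⊤; tt)
open import Data.Fin as Fin using (Fin; toℕ; fromℕ<)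
open import Data.Fin.Properties using (toℕ-injective; toℕ<n; toℕ-fromℕ<; any?; ¬∀⟶∃¬; injective⇒≤; pigeonhole; suc-injective)
open import Data.Integer as ℤ using (ℤ; +_; -[1+_]; 0ℤ; 1ℤ; ∣_∣; +≤+)
import Data.Integer.Properties as ℤ
open import Data.Integer.DivMod using (n%d<d; a≡a%n+[a/n]*n)
import Data.Integer.Tactic.RingSolver as ℤRing
import Data.List as List
open import Data.List using (List; []; _∷_; [_]; map; concatMap; filter; length; allFin; _++_; tabulate)
open import Data.List.Properties using (length-++; map-++; concatMap-++; length-map; ++-identityʳ; ++-assoc)
open import Data.Nat as ℕ using (ℕ; zero; suc; _+_; _*_; _∸_; _⊔_; _≤_; _<_; z≤n; s≤s; _≡ᵇ_; _≤ᵇ_)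
import Data.Nat.Properties as ℕ
open import Data.Nat.Induction using (<-wellFounded)
open import Data.Nat.Logarithm using (⌈log₂_⌉)
import Data.Nat.Tactic.RingSolver as ℕRing
open import Data.Product using (_×_; _,_; proj₁; proj₂; ∃-syntax)
open import Data.Sum using (_⊎_; inj₁; inj₂)
open import Function using (_∘_; id)
open import Induction.WellFounded using (Acc; acc)
open import Relation.Binary.PropositionalEquality using (_≡_; _≢_; refl; sym; trans; cong; cong₂; subst; subst₂; module ≡-Reasoning)
open import Relation.Nullary using (¬_; Dec; yes; no; does; _×-dec_)
open import Algebra.Bundles using (CommutativeMonoid)
open import Algebra.Structures using (IsCommutativeMonoid)
import Algebra.Properties.CommutativeMonoid.Sum as MonoidSum
import Algebra.Properties.Semiring.Sum ℤ.+-*-semiring as Σℤ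
import Algebra.Properties.Semiring.Sum ℕ.+-*-semiring as Σℕ
open import Data.List.Membership.Propositional using (_∈_; _∉_)
open import Data.List.Relation.Unary.Any using (Any; here; there)
open import Data.List.Relation.Unary.All using (All; []; _∷_)
import Data.List.Relation.Unary.All as All
import Data.List.Membership.DecPropositional as DecMembership
open import Relation.Unary using (Decidable)
open import Data.List.Extrema.Nat using (xs≤max)
open import Data.List.Membership.Propositional.Properties using (∈-map⁺; ∈-allFin)
open import Data.Nat.DivMod using (m≡m%n+[m/n]*n; m%n<n)
open import Data.Nat.Logarithm using (⌈log₂⌉-mono-≤; ⌈log₂⌈n/2⌉⌉≡⌈log₂n⌉∸1; ⌈log₂2^n⌉≡n)

-- Amortised running times: one credit pays for unit machine steps, and credits left over are passed on.

-- The running time shapes the construction. Splitting into at most `k` paths takes `n * k` steps.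
-- As `n` is at most `2 * m` and `k` at most the width, each of the logarithmically many rounds can
-- afford this, but there is one round more, and if the logarithm is 0 only `m * n` is available for
-- it: hence the separate bound `k ≤ m`. For the cover, a single unit, the token, is pushed at a
-- time, so that every push lowers the label under the token by exactly one, and pushes are paid for
-- by relabellings and by the label at which a unit starts. The terminals exchange their usual
-- roles: `s` has label 0 and `t` label `n`, so a unit tries to cancel flow back to `s` and is let
-- out at `t` only when that is impossible. For the values of `A` and `B` to fit below `k`, rounding
-- `(Z + X) / 2` must not increase the value. A trail from `s` to `t` decreases it, one from `t` to
-- `s` would increase it; exhausting `s` before all other nodes excludes the latter. Loop invariants
-- carry credits, whose number also makes the loops terminate.

opaque
  unit : ℕ
  unit = 100

  within-unit : ∀ {k} → T (k ≤ᵇ 100) → k ≤ unit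
  within-unit = ℕ.≤ᵇ⇒≤ _ _

  unit-nonZero : ℕ.NonZero unit
  unit-nonZero = _

-- `post` sees the credits left over, so that a postcondition can trade a quantity of the state,
-- such as the length of a list, for running time.
record Run (p : Program) (σ : State) (φ : ℕ) (Q : State → ℕ → Set) : Set where
  constructor run
  field
    {final}  : State
    {time}   : ℕ
    left     : ℕ
    exec     : ⟨ p , σ ⟩⇓⟨ final , time ⟩
    within   : time + unit * left ≤ unit * φ
    post     : Q final left

-- Frame conditions.

writesVar writesArr : ℕ → Program → Bool
writesVar x skip          = false
writesVar x (assign y e)  = y ≡ᵇ x
writesVar x (store a i e) = false
writesVar x (p ⨾ q)       = writesVar x p ∨ writesVar x q
writesVar x (ifte b p q)  = writesVar x p ∨ writesVar x q
writesVar x (while b p)   = writesVar x p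
writesArr a skip          = false
writesArr a (assign y e)  = false
writesArr a (store b i e) = b ≡ᵇ a
writesArr a (p ⨾ q)       = writesArr a p ∨ writesArr a q
writesArr a (ifte b p q)  = writesArr a p ∨ writesArr a q
writesArr a (while b p)   = writesArr a p

-- The side conditions are booleans computed from the program text. For a concrete program they
-- reduce to the unit type, and a frame fact is obtained by naming the variable or array.
record Same (p : Program) (σ τ : State) : Set where
  field
    sameVar : ∀ x → {T (not (writesVar x p))} → τ .vars x ≡ σ .vars x
    sameArr : ∀ a → {T (not (writesArr a p))} → ∀ j → τ .arrays a j ≡ σ .arrays a j

open Same public

∨-falseˡ : ∀ a {b} → T (not (a ∨ b)) → T (not a)
∨-falseˡ false _ = tt

∨-falseʳ : ∀ a {b} → T (not (a ∨ b)) → T (not b)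
∨-falseʳ false n = n

same-refl : ∀ {p σ} → Same p σ σ
same-refl .sameVar x   = refl
same-refl .sameArr a j = refl

same-trans : ∀ {p σ τ υ} → Same p σ τ → Same p τ υ → Same p σ υ
same-trans f g .sameVar x {w}   = trans (g .sameVar x {w}) (f .sameVar x {w})
same-trans f g .sameArr a {w} j = trans (g .sameArr a {w} j) (f .sameArr a {w} j)

same-seq : ∀ {p q σ τ υ} → Same p σ τ → Same q τ υ → Same (p ⨾ q) σ υ
same-seq {p} f g .sameVar x {w} =
  trans (g .sameVar x {∨-falseʳ (writesVar x p) w}) (f .sameVar x {∨-falseˡ (writesVar x p) w})
same-seq {p} f g .sameArr a {w} j =
  trans (g .sameArr a {∨-falseʳ (writesArr a p) w} j) (f .sameArr a {∨-falseˡ (writesArr a p) w} j)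

same-while : ∀ {b p σ τ} → Same p σ τ → Same (while b p) σ τ
same-while f .sameVar x {w} = f .sameVar x {w}
same-while f .sameArr a {w} = f .sameArr a {w}

exec-same : ∀ {p σ τ T} → ⟨ p , σ ⟩⇓⟨ τ , T ⟩ → Same p σ τ
exec-same skip = same-refl
exec-same (assign {x = y}) .sameVar x {w} with y ≡ᵇ x
... | false = refl
exec-same assign .sameArr a j = refl
exec-same store .sameVar x = refl
exec-same (store {a = b}) .sameArr a {w} j with b ≡ᵇ a
... | false = refl
exec-same (seq d e) = same-seq (exec-same d) (exec-same e)
exec-same (if-true {p = p} _ d) .sameVar x {w} =
  exec-same d .sameVar x {∨-falseˡ (writesVar x p) w}
exec-same (if-true {p = p} _ d) .sameArr a {w} =
  exec-same d .sameArr a {∨-falseˡ (writesArr a p) w}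
exec-same (if-false {p = p} _ d) .sameVar x {w} =
  exec-same d .sameVar x {∨-falseʳ (writesVar x p) w}
exec-same (if-false {p = p} _ d) .sameArr a {w} =
  exec-same d .sameArr a {∨-falseʳ (writesArr a p) w}
exec-same (while-true {b = b} {p = p} _ d e) = same-trans (same-while {b} {p} (exec-same d)) (exec-same e)
exec-same (while-false _) = same-refl

-- Preconditions and running time of loop-free programs.

wp : Program → (State → Set) → State → Set
wp skip          Q σ = Q σ
wp (assign x e)  Q σ = Q (setVar x (⟦ e ⟧ σ) σ)
wp (store a i e) Q σ = Q (setArr a (⟦ i ⟧ σ) (⟦ e ⟧ σ) σ)
wp (p ⨾ q)       Q σ = wp p (wp q Q) σ
wp (ifte b p q)  Q σ = (⟦ b ⟧ σ ≢ 0ℤ → wp p Q σ) × (⟦ b ⟧ σ ≡ 0ℤ → wp q Q σ)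
-- Loops are left to `run-while`; the empty precondition confines `wp` to straight-line code with
-- branches.
wp (while b p)   Q σ = ⊥

wp-mono : ∀ p {Q R : State → Set} {σ} → (∀ {τ} → Q τ → R τ) → wp p Q σ → wp p R σ
wp-mono skip          f = f
wp-mono (assign x e)  f = f
wp-mono (store a i e) f = f
wp-mono (p ⨾ q)       f = wp-mono p (wp-mono q f)
wp-mono (ifte b p q)  f (g , h) = wp-mono p f ∘ g , wp-mono q f ∘ h

maxTime : Program → ℕ
maxTime skip          = 1
maxTime (assign x e)  = 1 + cost e
maxTime (store a i e) = 1 + cost i + cost e
maxTime (p ⨾ q)       = maxTime p + maxTime q
maxTime (ifte b p q)  = 1 + cost b + (maxTime p ⊔ maxTime q)
-- An arbitrary value, harmless because `wp-sound` never meets a loop.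
maxTime (while b p)   = 0

wp-sound : ∀ p {Q σ} → wp p Q σ →
  ∃[ τ ] ∃[ T ] ⟨ p , σ ⟩⇓⟨ τ , T ⟩ × T ≤ maxTime p × Q τ
wp-sound skip h          = _ , _ , skip , ℕ.≤-refl , h
wp-sound (assign x e) h  = _ , _ , assign , ℕ.≤-refl , h
wp-sound (store a i e) h = _ , _ , store , ℕ.≤-refl , h
wp-sound (p ⨾ q) h =
  let _ , _ , d , S≤ , h′ = wp-sound p h
      _ , _ , e , T≤ , r  = wp-sound q h′
  in _ , _ , seq d e , ℕ.+-mono-≤ S≤ T≤ , r
wp-sound (ifte b p q) {σ = σ} (hp , hq) with ⟦ b ⟧ σ ℤ.≟ 0ℤ
... | no  ≢0 = let _ , _ , d , T≤ , r = wp-sound p (hp ≢0) in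
  _ , _ , if-true ≢0 d , ℕ.+-monoʳ-≤ (1 + cost b) (ℕ.≤-trans T≤ (ℕ.m≤m⊔n _ _)) , r
... | yes ≡0 = let _ , _ , d , T≤ , r = wp-sound q (hq ≡0) in
  _ , _ , if-false ≡0 d , ℕ.+-monoʳ-≤ (1 + cost b) (ℕ.≤-trans T≤ (ℕ.m≤n⊔m _ _)) , r

run-straight : ∀ p {σ φ Q} {fits : T (maxTime p ≤ᵇ 100)} → wp p (λ τ → Q τ φ) σ → Run p σ (suc φ) Q
run-straight p {σ} {φ} {_} {w} h with wp-sound p h
... | τ , T , d , T≤ , r = run φ d
  (ℕ.≤-trans (ℕ.+-monoˡ-≤ (unit * φ) (ℕ.≤-trans T≤ (within-unit w))) (ℕ.≤-reflexive (sym (ℕ.*-suc unit φ)))) r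

run-mono : ∀ {p σ φ Q R} → Run p σ φ Q → (∀ τ ψ → Same p σ τ → Q τ ψ → R τ ψ) → Run p σ φ R
run-mono (run ψ d w q) f = run ψ d w (f _ ψ (exec-same d) q)

run-more : ∀ {p σ φ φ′ Q} → φ ≤ φ′ → Run p σ φ Q → Run p σ φ′ Q
run-more φ≤φ′ (run ψ d w h) = run ψ d (ℕ.≤-trans w (ℕ.*-monoʳ-≤ unit φ≤φ′)) h

run-seq : ∀ {p q σ φ P Q} → Run p σ φ P →
  (∀ τ ψ → Same p σ τ → P τ ψ → Run q τ ψ Q) → Run (p ⨾ q) σ φ Q
run-seq {p} {q} {σ} {φ} (run {time = S} ψ d w h) f with f _ ψ (exec-same d) h
... | run {time = T} χ e w′ h′ = run χ (seq d e) (begin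
  (S + T) + unit * χ ≡⟨ ℕ.+-assoc S T _ ⟩
  S + (T + unit * χ) ≤⟨ ℕ.+-monoʳ-≤ S w′ ⟩
  S + unit * ψ       ≤⟨ w ⟩
  unit * φ           ∎) h′
  where open ℕ.≤-Reasoning

run-if : ∀ {b p q σ φ Q} {_ : T (1 + cost b ≤ᵇ 100)} →
  (⟦ b ⟧ σ ≢ 0ℤ → Run p σ φ Q) → (⟦ b ⟧ σ ≡ 0ℤ → Run q σ φ Q) → Run (ifte b p q) σ (suc φ) Q
run-if {b} {σ = σ} {φ} {_} {c} f g = go (⟦ b ⟧ σ ℤ.≟ 0ℤ)
  where
  pay : ∀ {T ψ} → T + unit * ψ ≤ unit * φ → 1 + cost b + T + unit * ψ ≤ unit * suc φ
  pay {T} {ψ} w = begin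
    1 + cost b + T + unit * ψ   ≡⟨ ℕ.+-assoc (1 + cost b) T _ ⟩
    1 + cost b + (T + unit * ψ) ≤⟨ ℕ.+-mono-≤ (within-unit {1 + cost b} c) w ⟩
    unit + unit * φ             ≡⟨ ℕ.*-suc unit φ ⟨
    unit * suc φ                ∎
    where open ℕ.≤-Reasoning
  go : Dec (⟦ b ⟧ σ ≡ 0ℤ) → Run _ σ (suc φ) _
  go (yes ≡0) with g ≡0
  ... | run ψ d w h = run ψ (if-false ≡0 d) (pay w) h
  go (no ≢0) with f ≢0
  ... | run ψ d w h = run ψ (if-true ≢0 d) (pay w) h

-- Each iteration gives up one credit for its test, so the number of credits strictly decreases and
-- serves as the termination measure. The credit beyond `φ` pays for the last, failing test.
run-while : ∀ {b p σ φ} {_ : T (1 + cost b ≤ᵇ 100)} (I : State → ℕ → Set) → I σ φ →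
  (∀ {τ ψ} → Same p σ τ → I τ ψ → ⟦ b ⟧ τ ≢ 0ℤ → ∃[ χ ] ψ ≡ suc χ × Run p τ χ I) →
  Run (while b p) σ (suc φ) (λ τ ψ → Same p σ τ × I τ ψ × ⟦ b ⟧ τ ≡ 0ℤ)
run-while {b} {p} {σ} {φ} {c} I init step = go φ (<-wellFounded φ) σ same-refl init
  where
  open ℕ.≤-Reasoning
  c′ : 1 + cost b ≤ unit
  c′ = within-unit {1 + cost b} c
  regroup : ∀ u s o → u + s + (u + o) ≡ u + (u + (s + o))
  regroup = ℕRing.solve-∀
  R = λ (τ : State) (ψ : ℕ) → Same p σ τ × I τ ψ × ⟦ b ⟧ τ ≡ 0ℤ
  go : ∀ ψ → Acc _<_ ψ → ∀ τ → Same p σ τ → I τ ψ → Run (while b p) τ (suc ψ) R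
  go ψ (acc rec) τ sm i with ⟦ b ⟧ τ ℤ.≟ 0ℤ
  ... | yes ≡0 = run ψ (while-false ≡0) (begin
    1 + cost b + unit * ψ ≤⟨ ℕ.+-monoˡ-≤ (unit * ψ) c′ ⟩
    unit + unit * ψ       ≡⟨ ℕ.*-suc unit ψ ⟨
    unit * suc ψ          ∎) (sm , i , ≡0)
  ... | no ≢0 with step sm i ≢0
  ... | χ , refl , run {τ′} {S} ω d w h
    with go ω (rec (s≤s (ℕ.*-cancelˡ-≤ unit {{unit-nonZero}} (ℕ.m+n≤o⇒n≤o S w)))) τ′
            (same-trans sm (exec-same d)) h
  ... | run {υ} {T} θ d′ w′ h′ = run θ (while-true ≢0 d d′) (begin
    1 + cost b + S + T + unit * θ   ≡⟨ ℕ.+-assoc (1 + cost b + S) T _ ⟩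
    1 + cost b + S + (T + unit * θ) ≤⟨ ℕ.+-mono-≤ (ℕ.+-monoˡ-≤ S c′) w′ ⟩
    unit + S + unit * suc ω         ≡⟨ cong (unit ℕ.+ S ℕ.+_) (ℕ.*-suc unit ω) ⟩
    unit + S + (unit + unit * ω)    ≡⟨ regroup unit S (unit * ω) ⟩
    unit + (unit + (S + unit * ω))  ≤⟨ ℕ.+-monoʳ-≤ unit (ℕ.+-monoʳ-≤ unit w) ⟩
    unit + (unit + unit * χ)        ≡⟨ cong (unit ℕ.+_) (ℕ.*-suc unit χ) ⟨
    unit + unit * suc χ             ≡⟨ ℕ.*-suc unit (suc χ) ⟨
    unit * suc (suc χ)              ∎) h′

-- Counting loops.

lt : Expr → Expr → Expr
lt a b = op leq (op add (const 1ℤ) a) b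

for : ℕ → ℕ → Program → Program
for x b p = assign x (const 0ℤ) ⨾ while (lt (var x) (var b)) (p ⨾ assign x (op add (const 1ℤ) (var x)))

boolℤ≢0 : ∀ {P : Set} (d : Dec P) → (if does d then 1ℤ else 0ℤ) ≢ 0ℤ → P
boolℤ≢0 (yes p) _  = p
boolℤ≢0 (no _)  ≢0 = ⊥-elim (≢0 refl)

boolℤ≡0 : ∀ {P : Set} (d : Dec P) → (if does d then 1ℤ else 0ℤ) ≡ 0ℤ → ¬ P
boolℤ≡0 (no ¬p) _ = ¬p

boolℤ-yes : ∀ {P : Set} (d : Dec P) → P → (if does d then 1ℤ else 0ℤ) ≡ 1ℤ
boolℤ-yes (yes _) _ = refl
boolℤ-yes (no ¬p) p = ⊥-elim (¬p p)

boolℤ-no : ∀ {P : Set} (d : Dec P) → ¬ P → (if does d then 1ℤ else 0ℤ) ≡ 0ℤ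
boolℤ-no (yes p) ¬p = ⊥-elim (¬p p)
boolℤ-no (no _)  _  = refl

setVar-hit : ∀ x v σ → setVar x v σ .vars x ≡ v
setVar-hit x v σ with x ≡ᵇ x | ℕ.≡⇒≡ᵇ x x refl
... | true | _ = refl

setArr-hit : ∀ a i v σ j → setArr a i v σ .arrays a j ≡ (if does (i ℤ.≟ j) then v else σ .arrays a j)
setArr-hit a i v σ j with a ≡ᵇ a | ℕ.≡⇒≡ᵇ a a refl
... | true | _ = refl

-- The two credits beyond `φ` pay for initialising the counter and for the last test; each iteration
-- takes one for its test and one for the increment. The invariant is demanded for every value `z`
-- of the counter variable: it depends on the iteration through its index alone.
run-for : ∀ {x b p σ φ N} {x-free : T (not (writesVar x p))} {b-free : T (not (writesVar b p))}
    {x≢b : T (not (x ≡ᵇ b))}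
  (I : ℕ → State → ℕ → Set) → σ .vars b ≡ + N →
  (∀ z → I 0 (setVar x z σ) φ) →
  (∀ (i : Fin N) {τ ψ} → Same (for x b p) σ τ → τ .vars x ≡ + toℕ i → I (toℕ i) τ ψ →
    ∃[ χ ] ψ ≡ 2 + χ × Run p τ (suc χ) (λ υ ω → ∃[ ω′ ] ω ≡ suc ω′ × ∀ z → I (suc (toℕ i)) (setVar x z υ) ω′)) →
  Run (for x b p) σ (2 + φ) (λ τ ψ → I N τ ψ)
run-for {x} {b} {p} {σ} {φ} {N} {xp} {bp} {xb} I bN init step =
  run-seq (run-straight (assign x (const 0ℤ)) {φ = suc φ} {Q = λ τ ψ → τ ≡ setVar x 0ℤ σ × ψ ≡ suc φ} (refl , refl))
      λ where
    τ ψ sm (refl , refl) → run-mono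
      (run-while J (0 , z≤n , setVar-hit x 0ℤ σ , init 0ℤ) λ {τ′} sm′ → body (same-seq sm (same-while sm′)))
      λ where
        υ ω sm″ (sm′ , (k , k≤N , x≡ , i) , ≡0) →
          subst (λ k → I k υ ω) (ℕ.≤-antisym k≤N (ℕ.≮⇒≥ λ k<N → boolℤ≡0 (_ ℤ.≤? _) ≡0
            (subst₂ ℤ._≤_ (cong (λ z → 1ℤ ℤ.+ z) (sym x≡)) (sym (bound (same-seq sm sm″))) (+≤+ k<N)))) i
  where
  J : State → ℕ → Set
  J τ ψ = ∃[ k ] k ≤ N × τ .vars x ≡ + k × I k τ ψ
  bound : ∀ {τ} → Same (for x b p) σ τ → τ .vars b ≡ + N
  bound sm = trans (sm .sameVar b {w}) bN
    where
    w : T (not (writesVar b (for x b p)))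
    w with x ≡ᵇ b | writesVar b p
    ... | false | false = tt
  body : ∀ {τ ψ} → Same (for x b p) σ τ → J τ ψ → ⟦ lt (var x) (var b) ⟧ τ ≢ 0ℤ →
    ∃[ χ ] ψ ≡ suc χ × Run (p ⨾ assign x (op add (const 1ℤ) (var x))) τ χ J
  body {τ} sm (k , k≤N , x≡ , i) ≢0
    with ℤ.drop‿+≤+ (subst₂ ℤ._≤_ (cong (λ z → 1ℤ ℤ.+ z) x≡) (bound sm) (boolℤ≢0 (_ ℤ.≤? _) ≢0))
  ... | k<N
    with step (fromℕ< k<N) sm (trans x≡ (cong +_ (sym (toℕ-fromℕ< k<N))))
        (subst (λ k → I k τ _) (sym (toℕ-fromℕ< k<N)) i)
  ... | χ , refl , r = suc χ , refl , run-seq r λ where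
    υ ω sm′ (ω′ , refl , h) → run-straight (assign x _) (suc k , k<N ,
      trans (setVar-hit x _ υ) (cong (λ z → 1ℤ ℤ.+ z) (trans (sm′ .sameVar x {xp}) x≡)) ,
      subst (λ k → I k (setVar x (1ℤ ℤ.+ υ .vars x) υ) ω′) (cong suc (toℕ-fromℕ< k<N)) (h _))

-- Three credits per iteration: the test, the body as a single block, and the increment.
run-for-straight : ∀ {x b p σ φ N} {x-free : T (not (writesVar x p))} {b-free : T (not (writesVar b p))}
    {x≢b : T (not (x ≡ᵇ b))}
  {fits : T (maxTime p ≤ᵇ 100)} (I : ℕ → State → Set) → σ .vars b ≡ + N →
  (∀ z → I 0 (setVar x z σ)) →
  (∀ (i : Fin N) {τ} → Same (for x b p) σ τ → τ .vars x ≡ + toℕ i → I (toℕ i) τ → wp p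
      (λ υ → ∀ z → I (suc (toℕ i)) (setVar x z υ)) τ) →
  Run (for x b p) σ (2 + (N * 3 + φ)) (λ τ ψ → I N τ × ψ ≡ φ)
run-for-straight {x} {b} {p} {σ} {φ} {N} {xp} {bp} {x≢b} {fits} I bN init step = run-mono
  (run-for {x} {b} {x-free = xp} {bp} {x≢b} Counted bN (λ z → init z , N , refl , refl) body)
  λ where τ ψ sm (i , k , k≡ , ψ≡) → i , trans ψ≡ (cong (λ k → k * 3 + φ) (ℕ.+-cancelˡ-≡ N k 0 (trans k≡ (sym (ℕ.+-identityʳ N)))))
  where
  Counted : ℕ → State → ℕ → Set
  Counted j τ ψ = I j τ × ∃[ k ] j + k ≡ N × ψ ≡ k * 3 + φ
  body : ∀ (i : Fin N) {τ ψ} → Same (for x b p) σ τ → τ .vars x ≡ + toℕ i → Counted (toℕ i) τ ψ → _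
  body i sm x≡ (f , zero , ik , refl) = ⊥-elim (ℕ.<⇒≢ (toℕ<n i) (trans (sym (ℕ.+-identityʳ _)) ik))
  body i sm x≡ (f , suc k , ik , refl) = suc (k * 3 + φ) , refl ,
    run-mono (run-straight p {Q = λ υ ω → (∀ z → I (suc (toℕ i)) (setVar x z υ)) × ω ≡ suc (k * 3 + φ)} {fits = fits}
        (wp-mono p (λ h → h , refl) (step i sm x≡ f)))
    λ { υ ω _ (h , refl) → k * 3 + φ , refl , λ z → h z , k , trans (sym (ℕ.+-suc _ k)) ik , refl }

-- Arrays as finite functions.

infix 4 _≈_
_≈_ : ∀ {N} → (ℤ → ℤ) → (Fin N → ℤ) → Set
f ≈ g = ∀ i → f (+ toℕ i) ≡ g i

infixl 9 _[_↦_]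
_[_↦_] : ∀ {A : Set} {N} → (Fin N → A) → Fin N → A → Fin N → A
(f [ i ↦ a ]) j = if does (i Fin.≟ j) then a else f j

↦-hit : ∀ {A : Set} {N} (f : Fin N → A) i a → (f [ i ↦ a ]) i ≡ a
↦-hit f i a with i Fin.≟ i
... | yes _ = refl
... | no ≢  = ⊥-elim (≢ refl)

↦-miss : ∀ {A : Set} {N} (f : Fin N → A) {i j} a → i ≢ j → (f [ i ↦ a ]) j ≡ f j
↦-miss f {i} {j} a i≢j with i Fin.≟ j
... | yes i≡j = ⊥-elim (i≢j i≡j)
... | no _    = refl

write : ℤ → ℤ → (ℤ → ℤ) → ℤ → ℤ
write i v f j = if does (i ℤ.≟ j) then v else f j

write-hit : ∀ {i j v} f → i ≡ j → write i v f j ≡ v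
write-hit {i} f refl with i ℤ.≟ i
... | yes _ = refl
... | no ≢  = ⊥-elim (≢ refl)

write-miss : ∀ {i j v} f → i ≢ j → write i v f j ≡ f j
write-miss {i} {j} f i≢j with i ℤ.≟ j
... | yes i≡j = ⊥-elim (i≢j i≡j)
... | no _    = refl

+toℕ-injective : ∀ {N} {i j : Fin N} → + toℕ i ≡ + toℕ j → i ≡ j
+toℕ-injective q = toℕ-injective (ℤ.+-injective q)

write-≈ : ∀ {N} {f} {g : Fin N → ℤ} {j v a} (i : Fin N) → f ≈ g → j ≡ + toℕ i → v ≡ a → write j v f ≈ g [ i ↦ a ]
write-≈ {f = f} {g} {j} {v} i h refl refl k with i Fin.≟ k
... | yes refl = write-hit f refl
... | no i≢k   = trans (write-miss f (λ q → i≢k (+toℕ-injective q))) (h k)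

Fills : ∀ {N} → ℕ → (ℤ → ℤ) → (Fin N → ℤ) → Set
Fills k f g = ∀ i → toℕ i < k → f (+ toℕ i) ≡ g i

fill : ℕ → ℕ → Expr → Program
fill b a e = for 5 b (store a (var 5) e)

run-fill : ∀ {b a e σ φ N} {_ : T (not (5 ≡ᵇ b))} {_ : T (cost e ≤ᵇ 98)} (g : Fin N → ℤ) → σ .vars b ≡ + N →
  (∀ {τ} → Same (fill b a e) σ τ → ∀ i → τ .vars 5 ≡ + toℕ i → ⟦ e ⟧ τ ≡ g i) →
  Run (fill b a e) σ (2 + (N * 3 + φ)) (λ τ ψ → τ .arrays a ≈ g × ψ ≡ φ)
run-fill {b} {a} {e} {σ} {φ} {N} {5b} {ce} g bN h = run-mono
  (run-for-straight {5} {b} {x≢b = 5b} {fits = w} (λ k τ → Fills k (τ .arrays a) g) bN (λ z _ ()) step)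
  λ where τ ψ sm (f , ψ≡) → (λ i → f i (toℕ<n i)) , ψ≡
  where
  w : T (maxTime (store a (var 5) e) ≤ᵇ 100)
  w = ℕ.≤⇒≤ᵇ (ℕ.+-monoʳ-≤ 2 (ℕ.≤ᵇ⇒≤ (cost e) 98 ce))
  step : ∀ (i : Fin N) {τ} → Same (fill b a e) σ τ → τ .vars 5 ≡ + toℕ i → Fills (toℕ i) (τ .arrays a) g →
    ∀ z → Fills (suc (toℕ i)) (setArr a (τ .vars 5) (⟦ e ⟧ τ) τ .arrays a) g
  step i {τ} sm 5≡ f z j j≤i with i Fin.≟ j
  ... | yes refl = trans (setArr-hit a (τ .vars 5) (⟦ e ⟧ τ) τ _)
      (trans (write-hit {v = ⟦ e ⟧ τ} (τ .arrays a) 5≡) (h sm i 5≡))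
  ... | no i≢j   = trans (setArr-hit a (τ .vars 5) (⟦ e ⟧ τ) τ _)
      (trans (write-miss {v = ⟦ e ⟧ τ} (τ .arrays a) (λ q → i≢j (+toℕ-injective (trans (sym 5≡) q))))
                    (f j (ℕ.≤∧≢⇒< (ℕ.≤-pred j≤i) λ q → i≢j (sym (toℕ-injective q)))))

-- Finite sums.

module SumUpdate {A : Set} {_∙_ : A → A → A} {ε : A} (isCM : IsCommutativeMonoid _≡_ _∙_ ε) where
  open IsCommutativeMonoid isCM using (assoc; comm)

  commutativeMonoid : CommutativeMonoid _ _
  commutativeMonoid = record { isCommutativeMonoid = isCM }

  open MonoidSum commutativeMonoid using (sum)
  open ≡-Reasoning

  -- The old value is added on the left instead of being subtracted on the right, so that one proof
  -- serves integers and natural numbers.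
  sum-[↦] : ∀ {N} (f : Fin N → A) i x → sum (f [ i ↦ x ]) ∙ f i ≡ sum f ∙ x
  sum-[↦] f Fin.zero x = begin
    (x ∙ r) ∙ f Fin.zero ≡⟨ assoc x r _ ⟩
    x ∙ (r ∙ f Fin.zero) ≡⟨ comm x _ ⟩
    (r ∙ f Fin.zero) ∙ x ≡⟨ cong (_∙ x) (comm r _) ⟩
    (f Fin.zero ∙ r) ∙ x ∎
    where r = sum (f ∘ Fin.suc)
  sum-[↦] f (Fin.suc i) x = begin
    (f Fin.zero ∙ sum ((f ∘ Fin.suc) [ i ↦ x ])) ∙ f (Fin.suc i) ≡⟨ assoc _ _ _ ⟩
    f Fin.zero ∙ (sum ((f ∘ Fin.suc) [ i ↦ x ]) ∙ f (Fin.suc i)) ≡⟨ cong (f Fin.zero ∙_) (sum-[↦] (f ∘ Fin.suc) i x) ⟩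
    f Fin.zero ∙ (sum (f ∘ Fin.suc) ∙ x)                         ≡⟨ assoc _ _ _ ⟨
    (f Fin.zero ∙ sum (f ∘ Fin.suc)) ∙ x                         ∎

open SumUpdate ℤ.+-0-isCommutativeMonoid using () renaming (sum-[↦] to sumℤ-[↦])
open SumUpdate ℕ.+-0-isCommutativeMonoid using () renaming (sum-[↦] to sumℕ-[↦])

opaque
  ∑ : ∀ {N} → (Fin N → ℤ) → ℤ
  ∑ = Σℤ.sum

  ∑-cong : ∀ {N} {f g : Fin N → ℤ} → (∀ i → f i ≡ g i) → ∑ f ≡ ∑ g
  ∑-cong = Σℤ.sum-cong-≗

  ∑-+ : ∀ {N} (f g : Fin N → ℤ) → ∑ (λ i → f i ℤ.+ g i) ≡ ∑ f ℤ.+ ∑ g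
  ∑-+ = Σℤ.∑-distrib-+

  ∑-* : ∀ {N} c (f : Fin N → ℤ) → ∑ (λ i → c ℤ.* f i) ≡ c ℤ.* ∑ f
  ∑-* c f = sym (Σℤ.*-distribˡ-sum c f)

  ∑-swap : ∀ {N M} (f : Fin N → Fin M → ℤ) → ∑ (λ i → ∑ (f i)) ≡ ∑ (λ j → ∑ (λ i → f i j))
  ∑-swap = Σℤ.∑-comm

  ∑-[↦] : ∀ {N} (f : Fin N → ℤ) i x → ∑ (f [ i ↦ x ]) ℤ.+ f i ≡ ∑ f ℤ.+ x
  ∑-[↦] = sumℤ-[↦]

  ∑-mono : ∀ {N} {f g : Fin N → ℤ} → (∀ i → f i ℤ.≤ g i) → ∑ f ℤ.≤ ∑ g
  ∑-mono {zero}  h = ℤ.≤-refl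
  ∑-mono {suc N} h = ℤ.+-mono-≤ (h Fin.zero) (∑-mono (h ∘ Fin.suc))

  ∑-const : ∀ N c → ∑ {N} (λ _ → c) ≡ + N ℤ.* c
  ∑-const zero    c = sym (ℤ.*-zeroˡ c)
  ∑-const (suc N) c = trans (cong (λ z → c ℤ.+ z) (∑-const N c)) (sym (ℤ.suc-* (+ N) c))

  ∑-zero : ∀ (f : Fin 0 → ℤ) → ∑ f ≡ 0ℤ
  ∑-zero f = refl

  ∑-suc : ∀ {N} (f : Fin (suc N) → ℤ) → ∑ f ≡ f Fin.zero ℤ.+ ∑ (f ∘ Fin.suc)
  ∑-suc f = refl

-- Trades the filtered lists in the definition of a flow for sums against an indicator, to which
-- linearity applies.
∑-filter : ∀ {N M} (X : Fin N → ℤ) {P : Fin N → Set} (P? : Decidable P) (g : Fin M → Fin N) →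
  sumℤ (map X (filter P? (tabulate g))) ≡ ∑ (λ i → X (g i) ℤ.* (if does (P? (g i)) then 1ℤ else 0ℤ))
∑-filter {M = zero}  X P? g = sym (∑-zero _)
∑-filter {M = suc M} X P? g = trans split (sym (∑-suc (λ i → X (g i) ℤ.* (if does (P? (g i)) then 1ℤ else 0ℤ))))
  where
  rest = ∑ (λ i → X (g (Fin.suc i)) ℤ.* (if does (P? (g (Fin.suc i))) then 1ℤ else 0ℤ))
  split : sumℤ (map X (filter P? (tabulate g))) ≡ X (g Fin.zero) ℤ.* (if does (P? (g Fin.zero)) then 1ℤ else 0ℤ) ℤ.+
      rest
  split with P? (g Fin.zero)
  ... | yes _ = cong₂ ℤ._+_ (sym (ℤ.*-identityʳ (X (g Fin.zero)))) (∑-filter X P? (g ∘ Fin.suc))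
  ... | no _  = begin
    sumℤ (map X (filter P? (tabulate (g ∘ Fin.suc)))) ≡⟨ ∑-filter X P? (g ∘ Fin.suc) ⟩
    rest                                              ≡⟨ ℤ.+-identityˡ rest ⟨
    0ℤ ℤ.+ rest                                       ≡⟨ cong (ℤ._+ rest) (ℤ.*-zeroʳ (X (g Fin.zero))) ⟨
    X (g Fin.zero) ℤ.* 0ℤ ℤ.+ rest                    ∎
    where open ≡-Reasoning

opaque
  ∑ℕ : ∀ {N} → (Fin N → ℕ) → ℕ
  ∑ℕ = Σℕ.sum

  ∑ℕ-[↦] : ∀ {N} (f : Fin N → ℕ) i x → ∑ℕ (f [ i ↦ x ]) + f i ≡ ∑ℕ f + x
  ∑ℕ-[↦] = sumℕ-[↦]

  ∑ℕ-cong : ∀ {N} {f g : Fin N → ℕ} → (∀ i → f i ≡ g i) → ∑ℕ f ≡ ∑ℕ g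
  ∑ℕ-cong = Σℕ.sum-cong-≗

  ∑ℕ-+ : ∀ {N} (f g : Fin N → ℕ) → ∑ℕ (λ i → f i + g i) ≡ ∑ℕ f + ∑ℕ g
  ∑ℕ-+ = Σℕ.∑-distrib-+

  ∑ℕ-* : ∀ {N} c (f : Fin N → ℕ) → ∑ℕ (λ i → c * f i) ≡ c * ∑ℕ f
  ∑ℕ-* c f = sym (Σℕ.*-distribˡ-sum c f)

  ∑ℕ-mono : ∀ {N} {f g : Fin N → ℕ} → (∀ i → f i ≤ g i) → ∑ℕ f ≤ ∑ℕ g
  ∑ℕ-mono {zero}  h = z≤n
  ∑ℕ-mono {suc N} h = ℕ.+-mono-≤ (h Fin.zero) (∑ℕ-mono (h ∘ Fin.suc))

  ∑ℕ-const : ∀ N c → ∑ℕ {N} (λ _ → c) ≡ N * c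
  ∑ℕ-const zero    c = refl
  ∑ℕ-const (suc N) c = cong (c ℕ.+_) (∑ℕ-const N c)

∑-0 : ∀ {N} {f : Fin N → ℤ} → (∀ i → f i ≡ 0ℤ) → ∑ f ≡ 0ℤ
∑-0 {N} h = trans (∑-cong h) (trans (∑-const N 0ℤ) (ℤ.*-zeroʳ (+ N)))

∑-≥0 : ∀ {N} {f : Fin N → ℤ} → (∀ i → 0ℤ ℤ.≤ f i) → 0ℤ ℤ.≤ ∑ f
∑-≥0 {N} {f} h = subst (ℤ._≤ ∑ f) (∑-0 {N} {λ _ → 0ℤ} λ _ → refl) (∑-mono h)

opaque
  δ : ∀ {N} → Fin N → Fin N → ℤ
  δ i j = if does (i Fin.≟ j) then 1ℤ else 0ℤ

  δ-≟ : ∀ {N} (i j : Fin N) → δ i j ≡ (if does (i Fin.≟ j) then 1ℤ else 0ℤ)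
  δ-≟ i j = refl

δ-refl : ∀ {N} (i : Fin N) → δ i i ≡ 1ℤ
δ-refl i = trans (δ-≟ i i) (↦-hit (λ _ → 0ℤ) i 1ℤ)

δ-≢ : ∀ {N} {i j : Fin N} → i ≢ j → δ i j ≡ 0ℤ
δ-≢ {i = i} {j} i≢j = trans (δ-≟ i j) (↦-miss (λ _ → 0ℤ) 1ℤ i≢j)

δ≥0 : ∀ {N} (i j : Fin N) → 0ℤ ℤ.≤ δ i j
δ≥0 i j with i Fin.≟ j
... | yes refl = subst (0ℤ ℤ.≤_) (sym (δ-refl i)) (+≤+ z≤n)
... | no i≢j   = subst (0ℤ ℤ.≤_) (sym (δ-≢ i≢j)) (+≤+ z≤n)

δ≤1 : ∀ {N} (i j : Fin N) → δ i j ℤ.≤ 1ℤ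
δ≤1 i j with i Fin.≟ j
... | yes refl = subst (ℤ._≤ 1ℤ) (sym (δ-refl i)) (+≤+ (s≤s z≤n))
... | no i≢j   = subst (ℤ._≤ 1ℤ) (sym (δ-≢ i≢j)) (+≤+ z≤n)

∑-δ : ∀ {N} (f : Fin N → ℤ) i → ∑ (λ j → f j ℤ.* δ i j) ≡ f i
∑-δ f i = begin
  ∑ (λ j → f j ℤ.* δ i j)            ≡⟨ ∑-cong pointwise ⟩
  ∑ ((λ _ → 0ℤ) [ i ↦ f i ])         ≡⟨ ℤ.+-identityʳ _ ⟨
  ∑ ((λ _ → 0ℤ) [ i ↦ f i ]) ℤ.+ 0ℤ  ≡⟨ ∑-[↦] (λ _ → 0ℤ) i (f i) ⟩
  ∑ (λ _ → 0ℤ) ℤ.+ f i               ≡⟨ cong (ℤ._+ f i) (∑-0 {f = λ _ → 0ℤ} λ _ → refl) ⟩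
  0ℤ ℤ.+ f i                         ≡⟨ ℤ.+-identityˡ _ ⟩
  f i                                ∎
  where
  open ≡-Reasoning
  pointwise : ∀ j → f j ℤ.* δ i j ≡ ((λ _ → 0ℤ) [ i ↦ f i ]) j
  pointwise j with i Fin.≟ j
  ... | yes refl = trans (cong (f i ℤ.*_) (δ-refl i)) (ℤ.*-identityʳ (f i))
  ... | no i≢j   = trans (cong (f j ℤ.*_) (δ-≢ i≢j)) (ℤ.*-zeroʳ (f j))

≥0-+ : ∀ {a b} → 0ℤ ℤ.≤ a → 0ℤ ℤ.≤ b → 0ℤ ℤ.≤ a ℤ.+ b
≥0-+ {a} {b} = ℤ.+-mono-≤ {0ℤ} {a} {0ℤ} {b}

-- Net inflow and conservation.

module Network (G : STDAG) where
  open STDAG G public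

  incidence : Edge → Node → ℤ
  incidence e v = δ (head e) v ℤ.- δ (tail e) v

  opaque
    -- Net inflow at a node. The value of a flow is therefore `- ∂ X s`, and a bound on values
    -- appears below as the reversed inequality between `∂` at `s`.
    ∂ : (Edge → ℤ) → Node → ℤ
    ∂ X v = ∑ λ e → X e ℤ.* incidence e v

    ∂-∑ : ∀ X v → ∂ X v ≡ ∑ λ e → X e ℤ.* incidence e v
    ∂-∑ X v = refl

  Interior : Node → Set
  Interior v = v ≢ s × v ≢ t

  Conserved : (Edge → ℤ) → Set
  Conserved X = ∀ {v} → Interior v → ∂ X v ≡ 0ℤ

  ∂-cong : ∀ {X Y} → (∀ e → X e ≡ Y e) → ∀ v → ∂ X v ≡ ∂ Y v
  ∂-cong {X} {Y} h v = trans (∂-∑ X v) (trans (∑-cong λ e → cong (ℤ._* incidence e v) (h e)) (sym (∂-∑ Y v)))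

  ∂-+ : ∀ X Y v → ∂ (λ e → X e ℤ.+ Y e) v ≡ ∂ X v ℤ.+ ∂ Y v
  ∂-+ X Y v = begin
    ∂ (λ e → X e ℤ.+ Y e) v                ≡⟨ ∂-∑ (λ e → X e ℤ.+ Y e) v ⟩
    ∑ (λ e → (X e ℤ.+ Y e) ℤ.* incidence e v)
      ≡⟨ ∑-cong (λ e → ℤ.*-distribʳ-+ (incidence e v) (X e) (Y e)) ⟩
    ∑ (λ e → X e ℤ.* incidence e v ℤ.+ Y e ℤ.* incidence e v)
      ≡⟨ ∑-+ (λ e → X e ℤ.* incidence e v) (λ e → Y e ℤ.* incidence e v) ⟩
    ∑ (λ e → X e ℤ.* incidence e v) ℤ.+ ∑ (λ e → Y e ℤ.* incidence e v)
      ≡⟨ cong₂ ℤ._+_ (∂-∑ X v) (∂-∑ Y v) ⟨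
    ∂ X v ℤ.+ ∂ Y v                        ∎
    where open ≡-Reasoning

  ∂-* : ∀ c X v → ∂ (λ e → c ℤ.* X e) v ≡ c ℤ.* ∂ X v
  ∂-* c X v = begin
    ∂ (λ e → c ℤ.* X e) v                       ≡⟨ ∂-∑ (λ e → c ℤ.* X e) v ⟩
    ∑ (λ e → c ℤ.* X e ℤ.* incidence e v)       ≡⟨ ∑-cong (λ e → ℤ.*-assoc c (X e) (incidence e v)) ⟩
    ∑ (λ e → c ℤ.* (X e ℤ.* incidence e v))     ≡⟨ ∑-* c (λ e → X e ℤ.* incidence e v) ⟩
    c ℤ.* ∑ (λ e → X e ℤ.* incidence e v)       ≡⟨ cong (c ℤ.*_) (∂-∑ X v) ⟨
    c ℤ.* ∂ X v                                 ∎
    where open ≡-Reasoning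

  ∂-neg : ∀ X v → ∂ (λ e → ℤ.- X e) v ≡ ℤ.- ∂ X v
  ∂-neg X v = trans (∂-cong (λ e → sym (ℤ.-1*i≡-i (X e))) v) (trans (∂-* ℤ.-1ℤ X v) (ℤ.-1*i≡-i _))

  ∂-minus : ∀ X Y v → ∂ (λ e → X e ℤ.- Y e) v ≡ ∂ X v ℤ.- ∂ Y v
  ∂-minus X Y v = trans (∂-+ X (λ e → ℤ.- Y e) v) (cong (λ z → ∂ X v ℤ.+ z) (∂-neg Y v))

  ∂-0 : ∀ v → ∂ (λ _ → 0ℤ) v ≡ 0ℤ
  ∂-0 v = trans (∂-∑ (λ _ → 0ℤ) v) (∑-0 λ e → ℤ.*-zeroˡ (incidence e v))

  ∂-δ : ∀ e v → ∂ (δ e) v ≡ incidence e v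
  ∂-δ e v = trans (∂-∑ (δ e) v) (trans (∑-cong λ f → ℤ.*-comm (δ e f) (incidence f v)) (∑-δ (λ f → incidence f v) e))

  [↦]-δ : ∀ (X : Edge → ℤ) e x f → (X [ e ↦ x ]) f ≡ X f ℤ.+ (x ℤ.- X e) ℤ.* δ e f
  [↦]-δ X e x f with e Fin.≟ f
  ... | yes refl = trans (lemma x (X e)) (cong (λ d → X e ℤ.+ (x ℤ.- X e) ℤ.* d) (sym (δ-refl e)))
    where
    lemma : ∀ a b → a ≡ b ℤ.+ (a ℤ.- b) ℤ.* 1ℤ
    lemma = ℤRing.solve-∀
  ... | no e≢f = trans (lemma (X f) (x ℤ.- X e)) (cong (λ d → X f ℤ.+ (x ℤ.- X e) ℤ.* d) (sym (δ-≢ e≢f)))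
    where
    lemma : ∀ a b → a ≡ a ℤ.+ b ℤ.* 0ℤ
    lemma = ℤRing.solve-∀

  ∂-[↦] : ∀ X e x v → ∂ (X [ e ↦ x ]) v ≡ ∂ X v ℤ.+ (x ℤ.- X e) ℤ.* incidence e v
  ∂-[↦] X e x v = begin
    ∂ (X [ e ↦ x ]) v                                   ≡⟨ ∂-cong ([↦]-δ X e x) v ⟩
    ∂ (λ f → X f ℤ.+ (x ℤ.- X e) ℤ.* δ e f) v           ≡⟨ ∂-+ X (λ f → (x ℤ.- X e) ℤ.* δ e f) v ⟩
    ∂ X v ℤ.+ ∂ (λ f → (x ℤ.- X e) ℤ.* δ e f) v         ≡⟨ cong (λ z → ∂ X v ℤ.+ z)
        (trans (∂-* (x ℤ.- X e) (δ e) v) (cong ((x ℤ.- X e) ℤ.*_) (∂-δ e v))) ⟩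
    ∂ X v ℤ.+ (x ℤ.- X e) ℤ.* incidence e v             ∎
    where open ≡-Reasoning

  flow-conserved : ∀ {X} → IsFlow G X → Conserved X
  flow-conserved {X} flow {v} (v≢s , v≢t) = begin
    ∂ X v                                                     ≡⟨ ∂-∑ X v ⟩
    ∑ (λ e → X e ℤ.* incidence e v)                           ≡⟨ ∑-cong
        (λ e → lemma (X e) (δ (head e) v) (δ (tail e) v)) ⟩
    ∑ (λ e → X e ℤ.* δ (head e) v ℤ.+ ℤ.-1ℤ ℤ.* (X e ℤ.* δ (tail e) v))
      ≡⟨ ∑-+ (λ e → X e ℤ.* δ (head e) v) (λ e → ℤ.-1ℤ ℤ.* (X e ℤ.* δ (tail e) v)) ⟩
    ∑ (λ e → X e ℤ.* δ (head e) v) ℤ.+ ∑ (λ e → ℤ.-1ℤ ℤ.* (X e ℤ.* δ (tail e) v))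
      ≡⟨ cong₂ ℤ._+_ (filtered head) (∑-* ℤ.-1ℤ (λ e → X e ℤ.* δ (tail e) v)) ⟩
    inflow G X v ℤ.+ ℤ.-1ℤ ℤ.* ∑ (λ e → X e ℤ.* δ (tail e) v)
      ≡⟨ cong₂ (λ a b → a ℤ.+ ℤ.-1ℤ ℤ.* b) (flow v v≢s v≢t) (filtered tail) ⟩
    outflow G X v ℤ.+ ℤ.-1ℤ ℤ.* outflow G X v ≡⟨ cancel (outflow G X v) ⟩
    0ℤ ∎
    where
    open ≡-Reasoning
    filtered : ∀ (end : Edge → Node) → ∑ (λ e → X e ℤ.* δ (end e) v) ≡ sumℤ
        (map X (filter (λ e → end e Fin.≟ v) (allFin m)))
    filtered end = trans (∑-cong λ e → cong (X e ℤ.*_) (δ-≟ (end e) v)) (sym (∑-filter X (λ e → end e Fin.≟ v) id))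
    lemma : ∀ x a b → x ℤ.* (a ℤ.- b) ≡ x ℤ.* a ℤ.+ ℤ.-1ℤ ℤ.* (x ℤ.* b)
    lemma = ℤRing.solve-∀
    cancel : ∀ a → a ℤ.+ ℤ.-1ℤ ℤ.* a ≡ 0ℤ
    cancel = ℤRing.solve-∀

  Conserved-+ : ∀ {X Y} → Conserved X → Conserved Y → Conserved (λ e → X e ℤ.+ Y e)
  Conserved-+ {X} {Y} cX cY v = trans (∂-+ X Y _) (cong₂ ℤ._+_ (cX v) (cY v))

  Conserved-minus : ∀ {X Y} → Conserved X → Conserved Y → Conserved (λ e → X e ℤ.- Y e)
  Conserved-minus {X} {Y} cX cY v = trans (∂-minus X Y _) (cong₂ ℤ._-_ (cX v) (cY v))

  -- Walks

  loopless : ∀ e → tail e ≢ head e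
  loopless e q = acyclic e (subst (Walk (head e)) (sym q) [])

  infixr 5 _⁀_
  _⁀_ : ∀ {u v w} → Walk u v → Walk v w → Walk u w
  []      ⁀ q = q
  (e ∷ p) ⁀ q = e ∷ (p ⁀ q)

  snoc : ∀ {u} e → Walk u (tail e) → Walk u (head e)
  snoc e p = p ⁀ (e ∷ [])

  edges-⁀ : ∀ {u v w} (p : Walk u v) (q : Walk v w) → edges (p ⁀ q) ≡ edges p ++ edges q
  edges-⁀ []      q = refl
  edges-⁀ (e ∷ p) q = cong (e ∷_) (edges-⁀ p q)

  visit : ∀ {u v} (p : Walk u v) → Fin (suc (length (edges p))) → Node
  visit {u} p       Fin.zero    = u
  visit     (e ∷ p) (Fin.suc i) = visit p i

  visit-walk : ∀ {u v} (p : Walk u v) i → Walk u (visit p i)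
  visit-walk p       Fin.zero    = []
  visit-walk (e ∷ p) (Fin.suc i) = e ∷ visit-walk p i

  visit-distinct : ∀ {u v} (p : Walk u v) {i j} → i Fin.< j → visit p i ≢ visit p j
  visit-distinct (e ∷ p) {Fin.zero}  {Fin.suc j} _ q = acyclic e (subst (Walk (head e)) (sym q) (visit-walk p j))
  visit-distinct (e ∷ p) {Fin.suc i} {Fin.suc j} (s≤s i<j) q = visit-distinct p i<j q

  -- By acyclicity the visited nodes are distinct. This bound replaces every other termination
  -- argument about following edges.
  walk-short : ∀ {u v} (p : Walk u v) → length (edges p) < n
  walk-short p = ℕ.≮⇒≥ λ n<1+l → let i , j , i<j , q = pigeonhole n<1+l (visit p) in visit-distinct p i<j q

  in-edge : ∀ {v} → v ≢ s → ∃[ e ] head e ≡ v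
  in-edge {v} v≢s with any? (λ e → head e Fin.≟ v)
  ... | yes found = found
  ... | no none   = ⊥-elim (v≢s (source-unique v λ e q → none (e , q)))

  out-edge : ∀ {v} → v ≢ t → ∃[ e ] tail e ≡ v
  out-edge {v} v≢t with any? (λ e → tail e Fin.≟ v)
  ... | yes found = found
  ... | no none   = ⊥-elim (v≢t (sink-unique v λ e q → none (e , q)))

  -- Going backwards from `v` can stop only at `s`, the single node without in-edges. The walk
  -- collected on the way stays shorter than `n`, so `n` is enough fuel.
  from-s : ∀ v → Walk s v
  from-s v = go n [] (ℕ.≤-reflexive (sym (ℕ.+-identityʳ n)))
    where
    go : ∀ k {u w} (p : Walk u w) → n ≤ k + length (edges p) → Walk s u
    go zero p n≤ = ⊥-elim (ℕ.<⇒≱ (walk-short p) n≤)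
    go (suc k) {u} p n≤ with u Fin.≟ s
    ... | yes refl = []
    ... | no u≢s with in-edge u≢s
    ... | e , refl = snoc e (go k (e ∷ p) (ℕ.≤-trans n≤ (ℕ.≤-reflexive (sym (ℕ.+-suc k _)))))

  to-t : ∀ v → Walk v t
  to-t v = go n {v} [] (ℕ.≤-reflexive (sym (ℕ.+-identityʳ n)))
    where
    go : ∀ k {u w} (p : Walk u w) → n ≤ k + length (edges p) → Walk w t
    go zero p n≤ = ⊥-elim (ℕ.<⇒≱ (walk-short p) n≤)
    go (suc k) {u} {w} p n≤ with w Fin.≟ t
    ... | yes refl = []
    ... | no w≢t with out-edge w≢t
    ... | e , refl = e ∷ go k (snoc e p) (ℕ.≤-trans n≤ (ℕ.≤-reflexive (trans (sym (ℕ.+-suc k _))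
                      (cong (k ℕ.+_) (trans (ℕ.+-comm 1 _)
                          (sym (trans (cong length (edges-⁀ p (e ∷ []))) (length-++ (edges p)))))))))

  -- A walk from `s` that ends with the given edge has to leave `s`, which `t` forbids. Without an
  -- edge a single node may be both source and sink.
  s≢t : Edge → s ≢ t
  s≢t e s≡t with snoc e (from-s (tail e)) in q
  ... | []    = s-source e (sym refl)
  ... | f ∷ _ = t-sink f s≡t

  -- Counting multiplicities makes this additive under concatenation, unlike the indicator
  -- `pathFlow`; acyclicity makes the two agree on paths.
  walkFlow : ∀ {u v} → Walk u v → Edge → ℤ
  walkFlow []      e = 0ℤ
  walkFlow (f ∷ p) e = δ f e ℤ.+ walkFlow p e

  walkFlow-⁀ : ∀ {u v w} (p : Walk u v) (q : Walk v w) e → walkFlow (p ⁀ q) e ≡ walkFlow p e ℤ.+ walkFlow q e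
  walkFlow-⁀ []      q e = sym (ℤ.+-identityˡ (walkFlow q e))
  walkFlow-⁀ (f ∷ p) q e = trans (cong (λ z → δ f e ℤ.+ z) (walkFlow-⁀ p q e))
      (sym (ℤ.+-assoc (δ f e) (walkFlow p e) (walkFlow q e)))

  ∂-walkFlow : ∀ {u v} (p : Walk u v) x → ∂ (walkFlow p) x ≡ δ v x ℤ.- δ u x
  ∂-walkFlow {u} [] x = trans (∂-0 x) (sym (ℤ.+-inverseʳ (δ u x)))
  ∂-walkFlow {v = v} (e ∷ p) x = begin
    ∂ (λ f → δ e f ℤ.+ walkFlow p f) x ≡⟨ ∂-+ (δ e) (walkFlow p) x ⟩
    ∂ (δ e) x ℤ.+ ∂ (walkFlow p) x     ≡⟨ cong₂ ℤ._+_ (∂-δ e x) (∂-walkFlow p x) ⟩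
    (δ (head e) x ℤ.- δ (tail e) x) ℤ.+ (δ v x ℤ.- δ (head e) x) ≡⟨ telescope (δ (head e) x) (δ (tail e) x) (δ v x) ⟩
    δ v x ℤ.- δ (tail e) x             ∎
    where
    open ≡-Reasoning
    telescope : ∀ a b c → (a ℤ.- b) ℤ.+ (c ℤ.- a) ≡ c ℤ.- b
    telescope = ℤRing.solve-∀

  ∈⇒walk : ∀ {u v e} (p : Walk u v) → e ∈ edges p → Walk u (tail e)
  ∈⇒walk (f ∷ p) (here refl) = []
  ∈⇒walk (f ∷ p) (there e∈)  = f ∷ ∈⇒walk p e∈

  walkFlow-∉ : ∀ {u v e} (p : Walk u v) → e ∉ edges p → walkFlow p e ≡ 0ℤ
  walkFlow-∉ []      e∉ = refl
  walkFlow-∉ {e = e} (f ∷ p) e∉ = cong₂ ℤ._+_ (δ-≢ {i = f} {e} (λ q → e∉ (here (sym q)))) (walkFlow-∉ p (e∉ ∘ there))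

  walkFlow-∈ : ∀ {u v e} (p : Walk u v) → e ∈ edges p → walkFlow p e ≡ 1ℤ
  walkFlow-∈ {e = e} (f ∷ p) (here refl) = cong₂ ℤ._+_ (δ-refl e)
      (walkFlow-∉ {e = e} p λ e∈ → acyclic e (∈⇒walk p e∈))
  walkFlow-∈ {e = e} (f ∷ p) (there e∈) = cong₂ ℤ._+_ (δ-≢ {i = f} {e} λ { refl → acyclic f (∈⇒walk p e∈) })
      (walkFlow-∈ p e∈)

  pathFlow-walkFlow : ∀ P e → pathFlow G P e ≡ walkFlow P e
  pathFlow-walkFlow P e with DecMembership._∈?_ Fin._≟_ e (edges P)
  ... | yes e∈ = sym (walkFlow-∈ P e∈)
  ... | no  e∉ = sym (walkFlow-∉ P e∉)

  walkFlow≥0 : ∀ {u v} (p : Walk u v) e → 0ℤ ℤ.≤ walkFlow p e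
  walkFlow≥0 []      e = ℤ.≤-refl
  walkFlow≥0 (f ∷ p) e = ≥0-+ (δ≥0 f e) (walkFlow≥0 p e)

*-≥0 : ∀ {a b} → 0ℤ ℤ.≤ a → 0ℤ ℤ.≤ b → 0ℤ ℤ.≤ a ℤ.* b
*-≥0 {+ a} {+ b} _ _ = subst (0ℤ ℤ.≤_) (ℤ.pos-* a b) (+≤+ z≤n)

-- Cuts, path covers and the support of positive flows.

module Cuts (G : STDAG) where
  open Network G

  -- With n + 1 possible labels some value k is unused, and the edges between the labels below k and those
  -- above it form a cut certifying minimality.
  module Labelling (D : Node → ℕ) (Ds : D s ≡ 0) (Dt : D t ≡ n)
      (forward : ∀ e → D (tail e) ≤ suc (D (head e))) where

    gap : ∃[ k ] ∀ v → D v ≢ k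
    gap = let i , none = ¬∀⟶∃¬ (suc n) (λ i → ∃[ v ] D v ≡ toℕ i) (λ i → any? λ v → D v ℕ.≟ toℕ i) all-used
          in toℕ i , λ v q → none (v , q)
      where
      all-used : ¬ (∀ i → ∃[ v ] D v ≡ toℕ i)
      all-used hit = ℕ.1+n≰n (injective⇒≤ {f = proj₁ ∘ hit} λ {i} {j} q →
        toℕ-injective (trans (sym (proj₂ (hit i))) (trans (cong D q) (proj₂ (hit j)))))

    k = proj₁ gap

    χ : Node → ℤ
    χ v with D v ℕ.<? k
    ... | yes _ = 1ℤ
    ... | no _  = 0ℤ

    χs : χ s ≡ 1ℤ
    χs with D s ℕ.<? k
    ... | yes _  = refl
    ... | no D≮k = ⊥-elim (D≮k (ℕ.≤∧≢⇒< (subst (_≤ k) (sym Ds) z≤n) (proj₂ gap s)))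

    k≤n : k ≤ n
    k≤n = ℕ.≤-pred (toℕ<n (proj₁ (¬∀⟶∃¬ (suc n) (λ i → ∃[ v ] D v ≡ toℕ i) (λ i → any? λ v → D v ℕ.≟ toℕ i) _)))

    χt : χ t ≡ 0ℤ
    χt with D t ℕ.<? k
    ... | yes D<k = ⊥-elim (ℕ.<⇒≱ (subst (_< k) Dt D<k) k≤n)
    ... | no _    = refl

    crossing : Edge → ℤ
    crossing e = χ (head e) ℤ.- χ (tail e)

    -- Sum `χ v * ∂ Y v` over all nodes: conservation and `χ t = 0` leave only the term of `s`, and
    -- exchanging the two sums collects the same quantity edge by edge.
    cut-value : ∀ {Y} → Conserved Y → ∂ Y s ≡ ∑ λ e → Y e ℤ.* crossing e
    cut-value {Y} cY = begin
      ∂ Y s                                                 ≡⟨ ∑-δ (λ _ → ∂ Y s) s ⟨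
      ∑ (λ v → ∂ Y s ℤ.* δ s v)                             ≡⟨ ∑-cong only-s ⟨
      ∑ (λ v → χ v ℤ.* ∂ Y v)                               ≡⟨ ∑-cong
          (λ v → trans (cong (χ v ℤ.*_) (∂-∑ Y v)) (sym (∑-* (χ v) λ e → Y e ℤ.* incidence e v))) ⟩
      ∑ (λ v → ∑ λ e → χ v ℤ.* (Y e ℤ.* incidence e v))     ≡⟨ ∑-swap (λ v e → χ v ℤ.* (Y e ℤ.* incidence e v)) ⟩
      ∑ (λ e → ∑ λ v → χ v ℤ.* (Y e ℤ.* incidence e v))     ≡⟨ ∑-cong per-edge ⟩
      ∑ (λ e → Y e ℤ.* crossing e)                          ∎
      where
      open ≡-Reasoning
      only-s : ∀ v → χ v ℤ.* ∂ Y v ≡ ∂ Y s ℤ.* δ s v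
      only-s v with s Fin.≟ v | t Fin.≟ v
      ... | yes refl | _ = trans (cong₂ ℤ._*_ χs refl)
          (trans (ℤ.*-comm 1ℤ (∂ Y s)) (cong (∂ Y s ℤ.*_) (sym (δ-refl s))))
      ... | no s≢v | yes refl = trans (cong₂ ℤ._*_ χt refl)
          (trans (ℤ.*-zeroˡ (∂ Y t)) (sym (trans (cong (∂ Y s ℤ.*_) (δ-≢ s≢v)) (ℤ.*-zeroʳ (∂ Y s)))))
      ... | no s≢v | no t≢v = trans (cong (χ v ℤ.*_) (cY (s≢v ∘ sym , t≢v ∘ sym)))
          (trans (ℤ.*-zeroʳ (χ v)) (sym (trans (cong (∂ Y s ℤ.*_) (δ-≢ s≢v)) (ℤ.*-zeroʳ (∂ Y s)))))
      expand : ∀ x y a b → x ℤ.* (y ℤ.* (a ℤ.- b)) ≡ y ℤ.* (x ℤ.* a ℤ.+ ℤ.-1ℤ ℤ.* (x ℤ.* b))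
      expand = ℤRing.solve-∀
      collect : ∀ a b → a ℤ.+ ℤ.-1ℤ ℤ.* b ≡ a ℤ.- b
      collect = ℤRing.solve-∀
      per-edge : ∀ e → ∑ (λ v → χ v ℤ.* (Y e ℤ.* incidence e v)) ≡ Y e ℤ.* crossing e
      per-edge e = begin
        ∑ (λ v → χ v ℤ.* (Y e ℤ.* incidence e v)) ≡⟨ ∑-cong (λ v → expand (χ v) (Y e) (δ (head e) v) (δ (tail e) v)) ⟩
        ∑ (λ v → Y e ℤ.* (χ v ℤ.* δ (head e) v ℤ.+ ℤ.-1ℤ ℤ.* (χ v ℤ.* δ (tail e) v)))
          ≡⟨ ∑-* (Y e) (λ v → χ v ℤ.* δ (head e) v ℤ.+ ℤ.-1ℤ ℤ.* (χ v ℤ.* δ (tail e) v)) ⟩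
        Y e ℤ.* ∑ (λ v → χ v ℤ.* δ (head e) v ℤ.+ ℤ.-1ℤ ℤ.* (χ v ℤ.* δ (tail e) v))
          ≡⟨ cong (Y e ℤ.*_) (trans (∑-+ (λ v → χ v ℤ.* δ (head e) v) (λ v → ℤ.-1ℤ ℤ.* (χ v ℤ.* δ (tail e) v)))
              (cong₂ ℤ._+_ (∑-δ χ (head e)) (trans (∑-* ℤ.-1ℤ (λ v → χ v ℤ.* δ (tail e) v))
                  (cong (ℤ.-1ℤ ℤ.*_) (∑-δ χ (tail e)))))) ⟩
        Y e ℤ.* (χ (head e) ℤ.+ ℤ.-1ℤ ℤ.* χ (tail e)) ≡⟨ cong (Y e ℤ.*_) (collect (χ (head e)) (χ (tail e))) ⟩
        Y e ℤ.* crossing e ∎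

    data Crossing (e : Edge) : Set where
      inside   : crossing e ≡ 0ℤ → Crossing e
      outwards : crossing e ≡ ℤ.-1ℤ → suc (D (tail e)) < D (head e) → Crossing e

    crossing-view : ∀ e → Crossing e
    crossing-view e with D (tail e) ℕ.<? k in qt | D (head e) ℕ.<? k in qh
    ... | yes t<k | yes h<k = inside (cong₂ ℤ._-_ (val-yes qh) (val-yes qt))
      where
      val-yes : ∀ {v} {p : D v < k} → (D v ℕ.<? k) ≡ yes p → χ v ≡ 1ℤ
      val-yes {v} q with D v ℕ.<? k
      ... | yes _ = refl
    ... | no t≮k | no h≮k = inside (cong₂ ℤ._-_ (val-no h≮k) (val-no t≮k))
      where
      val-no : ∀ {v} → ¬ (D v < k) → χ v ≡ 0ℤ
      val-no {v} ≮ with D v ℕ.<? k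
      ... | yes < = ⊥-elim (≮ <)
      ... | no _  = refl
    -- By `forward` such an edge would start exactly at label `k`, which no node has.
    ... | no t≮k | yes h<k = ⊥-elim (proj₂ gap (tail e) (ℕ.≤-antisym (ℕ.≤-trans (forward e) h<k) (ℕ.≮⇒≥ t≮k)))
    ... | yes t<k | no h≮k = outwards (cong₂ ℤ._-_ (val-no h≮k) (val-yes t<k))
        (ℕ.≤-<-trans t<k (ℕ.≤∧≢⇒< (ℕ.≮⇒≥ h≮k) (proj₂ gap (head e) ∘ sym)))
      where
      val-no : ∀ {v} → ¬ (D v < k) → χ v ≡ 0ℤ
      val-no {v} ≮ with D v ℕ.<? k
      ... | yes < = ⊥-elim (≮ <)
      ... | no _  = refl
      val-yes : ∀ {v} → D v < k → χ v ≡ 1ℤ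
      val-yes {v} < with D v ℕ.<? k
      ... | yes _ = refl
      ... | no ≮  = ⊥-elim (≮ <)

    module _ {Z ℓ : Edge → ℤ} (cZ : Conserved Z)
        (backward : ∀ e → suc (D (tail e)) < D (head e) → Z e ≡ ℓ e) where

      -- Edges cross the cut only away from the side of `s`, and there `Z` carries no more than the
      -- lower bound, which every competitor has to carry as well.
      minimal : ∀ {Y} → Conserved Y → (∀ e → ℓ e ℤ.≤ Y e) → ∂ Y s ℤ.≤ ∂ Z s
      minimal {Y} cY ℓ≤Y = subst₂ ℤ._≤_ (sym (cut-value cY)) (sym (cut-value cZ)) (∑-mono term)
        where
        term : ∀ e → Y e ℤ.* crossing e ℤ.≤ Z e ℤ.* crossing e
        term e with crossing-view e
        ... | inside q = ℤ.≤-reflexive (trans (cong (Y e ℤ.*_) q)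
            (trans (ℤ.*-zeroʳ (Y e)) (sym (trans (cong (Z e ℤ.*_) q) (ℤ.*-zeroʳ (Z e))))))
        ... | outwards q far = subst₂ ℤ._≤_ (flip (Y e) q) (trans (cong ℤ.-_ (sym (backward e far))) (flip (Z e) q))
            (ℤ.neg-mono-≤ (ℓ≤Y e))
          where
          neg : ∀ a → ℤ.- a ≡ a ℤ.* ℤ.-1ℤ
          neg = ℤRing.solve-∀
          flip : ∀ a → crossing e ≡ ℤ.-1ℤ → ℤ.- a ≡ a ℤ.* crossing e
          flip a q = trans (neg a) (cong (a ℤ.*_) (sym q))

      -- The cut consists of at most `m` edges, each carrying at most one unit of `Z`.
      value≤m : (∀ e → ℓ e ℤ.≤ 1ℤ) → ℤ.- (+ m) ℤ.≤ ∂ Z s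
      value≤m ℓ≤1 = subst₂ ℤ._≤_ (trans (∑-const m ℤ.-1ℤ) (trans (ℤ.*-comm (+ m) ℤ.-1ℤ) (ℤ.-1*i≡-i (+ m))))
          (sym (cut-value cZ)) (∑-mono term)
        where
        term : ∀ e → ℤ.-1ℤ ℤ.≤ Z e ℤ.* crossing e
        term e with crossing-view e
        ... | inside q = subst (ℤ.-1ℤ ℤ.≤_) (sym (trans (cong (Z e ℤ.*_) q) (ℤ.*-zeroʳ (Z e)))) ℤ.-≤+
        ... | outwards q far = subst (ℤ.-1ℤ ℤ.≤_) (sym
            (trans (cong₂ ℤ._*_ (backward e far) q) (trans (ℤ.*-comm (ℓ e) ℤ.-1ℤ) (ℤ.-1*i≡-i (ℓ e)))))
                                (ℤ.neg-mono-≤ (ℓ≤1 e))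

  -- Path covers

  pathSum : List STPath → Edge → ℤ
  pathSum []       e = 0ℤ
  pathSum (P ∷ Ps) e = walkFlow P e ℤ.+ pathSum Ps e

  pathSum-++ : ∀ Ps Qs e → pathSum (Ps ++ Qs) e ≡ pathSum Ps e ℤ.+ pathSum Qs e
  pathSum-++ []       Qs e = sym (ℤ.+-identityˡ (pathSum Qs e))
  pathSum-++ (P ∷ Ps) Qs e = trans (cong (λ z → walkFlow P e ℤ.+ z) (pathSum-++ Ps Qs e))
      (sym (ℤ.+-assoc (walkFlow P e) (pathSum Ps e) (pathSum Qs e)))

  pathSum≥0 : ∀ Ps e → 0ℤ ℤ.≤ pathSum Ps e
  pathSum≥0 []       e = ℤ.≤-refl
  pathSum≥0 (P ∷ Ps) e = ≥0-+ (walkFlow≥0 P e) (pathSum≥0 Ps e)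

  ∂-pathSum : ∀ Ps v → ∂ (pathSum Ps) v ≡ + length Ps ℤ.* (δ t v ℤ.- δ s v)
  ∂-pathSum []       v = trans (∂-0 v) (sym (ℤ.*-zeroˡ (δ t v ℤ.- δ s v)))
  ∂-pathSum (P ∷ Ps) v = trans (∂-+ (walkFlow P) (pathSum Ps) v)
    (trans (cong₂ ℤ._+_ (∂-walkFlow P v) (∂-pathSum Ps v)) (sym (ℤ.suc-* (+ length Ps) (δ t v ℤ.- δ s v))))

  pathSum-conserved : ∀ Ps → Conserved (pathSum Ps)
  pathSum-conserved Ps {v} (v≢s , v≢t) = trans (∂-pathSum Ps v)
    (trans (cong (+ length Ps ℤ.*_) (cong₂ ℤ._-_ (δ-≢ (v≢t ∘ sym)) (δ-≢ (v≢s ∘ sym)))) (ℤ.*-zeroʳ (+ length Ps)))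

  ∂-pathSum-s : Edge → ∀ Ps → ∂ (pathSum Ps) s ≡ ℤ.- (+ length Ps)
  ∂-pathSum-s e Ps = trans (∂-pathSum Ps s)
    (trans (cong (+ length Ps ℤ.*_) (cong₂ ℤ._-_ (δ-≢ (s≢t e ∘ sym)) (δ-refl s)))
      (trans (ℤ.*-comm (+ length Ps) ℤ.-1ℤ) (ℤ.-1*i≡-i (+ length Ps))))

  pathSum-covers : ∀ {e} Ps → Any (λ P → e ∈ edges P) Ps → 1ℤ ℤ.≤ pathSum Ps e
  pathSum-covers {e} (P ∷ Ps) (here e∈) =
    subst₂ ℤ._≤_ (ℤ.+-identityʳ 1ℤ) (cong (ℤ._+ pathSum Ps e) (sym (walkFlow-∈ P e∈)))
        (ℤ.+-monoʳ-≤ 1ℤ (pathSum≥0 Ps e))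
  pathSum-covers {e} (P ∷ Ps) (there c) =
    subst (ℤ._≤ walkFlow P e ℤ.+ pathSum Ps e) (ℤ.+-identityˡ 1ℤ) (ℤ.+-mono-≤ (walkFlow≥0 P e) (pathSum-covers Ps c))

  -- On an edge that lies on no path the superposition vanishes, whatever the weights. Hence the
  -- paths of any decomposition cover the support, which bounds the value of a minimum cover by the
  -- size of the decomposition.
  decomposition-covers : ∀ {e} D → superposition G D e ≢ 0ℤ → Any (λ P → e ∈ edges P) (map proj₂ D)
  decomposition-covers []            ≢0 = ⊥-elim (≢0 refl)
  decomposition-covers {e} ((w , P) ∷ D) ≢0 with DecMembership._∈?_ Fin._≟_ e (edges P)
  ... | yes e∈ = here e∈
  ... | no  e∉ = there (decomposition-covers D λ q → ≢0 (cong₂ ℤ._+_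
          (ℤ.*-zeroʳ w) q))

  -- Non-negative flows

  no-outflow : ∀ {A v} → (∀ e → 0ℤ ℤ.≤ A e) → (∀ e → tail e ≡ v → A e ≡ 0ℤ) → 0ℤ ℤ.≤ ∂ A v
  no-outflow {A} {v} A≥0 none = subst (0ℤ ℤ.≤_) (sym (∂-∑ A v)) (∑-≥0 term)
    where
    simplify : ∀ a d → a ℤ.* (d ℤ.- 0ℤ) ≡ a ℤ.* d
    simplify = ℤRing.solve-∀
    term : ∀ e → 0ℤ ℤ.≤ A e ℤ.* incidence e v
    term e with tail e Fin.≟ v
    ... | yes q = ℤ.≤-reflexive (sym (trans (cong (ℤ._* incidence e v) (none e q)) (ℤ.*-zeroˡ (incidence e v))))
    ... | no q = subst (0ℤ ℤ.≤_) (trans (sym (simplify (A e) (δ (head e) v)))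
        (cong (λ d → A e ℤ.* (δ (head e) v ℤ.- d)) (sym (δ-≢ q))))
                  (*-≥0 (A≥0 e) (δ≥0 (head e) v))

  -- If no positive edge entered `tail e`, the net inflow there would be at most `- A e`, which is
  -- negative.
  inflow-positive : ∀ {A e} → (∀ f → 0ℤ ℤ.≤ A f) → 0ℤ ℤ.< A e → 0ℤ ℤ.≤ ∂ A (tail e) →
    ∃[ f ] head f ≡ tail e × 0ℤ ℤ.< A f
  inflow-positive {A} {e} A≥0 Ae>0 ∂≥0 with any? (λ f → head f Fin.≟ tail e ×-dec 0ℤ ℤ.<? A f)
  ... | yes found = found
  ... | no none = ⊥-elim (ℤ.<⇒≱ (ℤ.neg-mono-< Ae>0) (ℤ.≤-trans ∂≥0 ∂≤))
    where
    zero-in : ∀ f → head f ≡ tail e → A f ≡ 0ℤ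
    zero-in f q = ℤ.≤-antisym (ℤ.≮⇒≥ λ > → none (f , q , >)) (A≥0 f)
    out : ∀ a h d → h ≡ 0ℤ → a ℤ.* (h ℤ.- d) ≡ ℤ.- (a ℤ.* d)
    out a h d refl = identity a d
      where
      identity : ∀ a d → a ℤ.* (0ℤ ℤ.- d) ≡ ℤ.- (a ℤ.* d)
      identity = ℤRing.solve-∀
    term : ∀ f → A f ℤ.* incidence f (tail e) ℤ.≤ ℤ.- A e ℤ.* δ e f
    term f with e Fin.≟ f
    ... | yes refl = ℤ.≤-reflexive (trans (out (A e) _ (δ (tail e) (tail e)) (δ-≢ (loopless e ∘ sym)))
                       (trans (cong (λ d → ℤ.- (A e ℤ.* d)) (δ-refl (tail e)))
                         (trans (identity (A e)) (cong (ℤ.- A e ℤ.*_) (sym (δ-refl e))))))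
      where
      identity : ∀ a → ℤ.- (a ℤ.* 1ℤ) ≡ ℤ.- a ℤ.* 1ℤ
      identity = ℤRing.solve-∀
    ... | no e≢f with head f Fin.≟ tail e
    ...   | yes q = ℤ.≤-reflexive (trans (cong (ℤ._* incidence f (tail e)) (zero-in f q))
                      (trans (ℤ.*-zeroˡ (incidence f (tail e)))
                          (sym (trans (cong (ℤ.- A e ℤ.*_) (δ-≢ e≢f)) (ℤ.*-zeroʳ (ℤ.- A e))))))
    ...   | no q = subst₂ ℤ._≤_ (sym (out (A f) _ (δ (tail f) (tail e)) (δ-≢ q)))
        (sym (trans (cong (ℤ.- A e ℤ.*_) (δ-≢ e≢f)) (ℤ.*-zeroʳ (ℤ.- A e))))
                     (ℤ.neg-mono-≤ (*-≥0 (A≥0 f) (δ≥0 (tail f) (tail e))))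
    ∂≤ : ∂ A (tail e) ℤ.≤ ℤ.- A e
    ∂≤ = subst₂ ℤ._≤_ (sym (∂-∑ A (tail e))) (∑-δ (λ _ → ℤ.- A e) e) (∑-mono term)

  -- A positive edge could be continued backwards by positive edges for ever.
  no-value⇒zero : ∀ {A} → (∀ e → 0ℤ ℤ.≤ A e) → Conserved A → 0ℤ ℤ.≤ ∂ A s → ∀ e → A e ≡ 0ℤ
  no-value⇒zero {A} A≥0 cA ∂s≥0 e = ℤ.≤-antisym (ℤ.≮⇒≥ λ Ae>0 → go n e [] (ℕ.≤-reflexive (sym (ℕ.+-identityʳ n)))
      Ae>0) (A≥0 e)
    where
    ∂≥0 : ∀ e → 0ℤ ℤ.≤ ∂ A (tail e)
    ∂≥0 e with tail e Fin.≟ s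
    ... | yes q = subst (λ v → 0ℤ ℤ.≤ ∂ A v) (sym q) ∂s≥0
    ... | no q  = ℤ.≤-reflexive (sym (cA (q , t-sink e)))
    go : ∀ k e {w} (p : Walk (tail e) w) → n ≤ k + length (edges p) → 0ℤ ℤ.< A e → ⊥
    go zero    e p n≤ Ae>0 = ℕ.<⇒≱ (walk-short p) n≤
    go (suc k) e p n≤ Ae>0 with inflow-positive A≥0 Ae>0 (∂≥0 e)
    ... | f , q , Af>0 = extend q
      where
      extend : head f ≡ tail e → ⊥
      extend q = go k f (f ∷ subst (λ v → Walk v _) (sym q) p)
          (ℕ.≤-trans n≤ (ℕ.≤-reflexive (trans (sym (ℕ.+-suc k _)) (cong (λ l → k + suc l) (len q p))))) Af>0
        where
        len : ∀ {u v w} (q : u ≡ v) (p : Walk v w) → length (edges p) ≡ length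
            (edges (subst (λ v → Walk v w) (sym q) p))
        len refl p = refl

  -- Every node other than `s` owns one of its in-edges. This is what allows `n * k` to be charged
  -- as `m * k`.
  n≤1+m : n ≤ suc m
  n≤1+m = injective⇒≤ {f = enter} λ {u} {v} → enter-injective u v
    where
    enter : Node → Fin (suc m)
    enter v with v Fin.≟ s
    ... | yes _  = Fin.zero
    ... | no v≢s = Fin.suc (proj₁ (in-edge v≢s))
    enter-injective : ∀ u v → enter u ≡ enter v → u ≡ v
    enter-injective u v q with u Fin.≟ s | v Fin.≟ s
    ... | yes refl | yes refl = refl
    ... | no u≢s | no v≢s = trans (sym (proj₂ (in-edge u≢s)))
        (trans (cong head (suc-injective q)) (proj₂ (in-edge v≢s)))

∧-T : ∀ a {b} → T (a ∧ b) → T a × T b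
∧-T true q = tt , q

-- Variables:  0 n, 1 m, 2 s, 3 t, 4 bound on |x|, 5 15 16 counters, 6 current node, 7 half-edge, 8 its sign, 9 its edge,
-- 17 its other end, 10 start of a trail, 11 output position, 12 path length, 13 number of paths, 14 weight.
-- Arrays:  0 input, 1 output, 2 heads, 3 next half-edge, 4 first half-edge, 5 flow x, 6 support, 7 tails,
-- 9 an in-edge of each node, 10 cover Z, 11 list pointers, 12 labels, 13 uncrossed odd edges, 14 K₁,
-- 15 result of a rounding, 16 flow being split into paths, 18 flow being rounded.

sgnE toE idxE : Expr
-- The sign of the code in variable 7 is `2 * [1 ≤ code] - 1`; the sign times the code is the edge
-- number plus one.
sgnE = op sub (op mul (const (+ 2)) (op leq (const 1ℤ) (var 7))) (const 1ℤ)
idxE = op sub (op mul (var 8) (var 7)) (const 1ℤ)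
toE  = op add (op mul (op leq (const 1ℤ) (var 7)) (arr 2 (var 9)))
              (op mul (op leq (var 7) (const 0ℤ)) (arr 7 (var 9)))

load advance reset : Program
load    = assign 7 (arr 11 (var 6)) ⨾ assign 8 sgnE ⨾ assign 9 idxE ⨾ assign 17 toE
advance = store 11 (var 6) (arr 3 (var 7))
reset   = fill 0 11 (arr 4 (var 5))

-- A stuck trail is resumed at its starting node, so `roundFrom` ends only when that node has
-- nothing left to scan. The starting nodes `s`, `t` and then all others come in an order on which
-- the comparison of values rests.
turn roundStep roundFrom round : Program
turn      = ifte (arr 13 (var 9))
              (store 13 (var 9) (const 0ℤ) ⨾ store 15 (var 9) (op add (arr 15 (var 9)) (op leq (var 8) (const 0ℤ))) ⨾
                  assign 6 (var 17))
              skip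
roundStep = load ⨾ advance ⨾ turn ⨾ ifte (arr 11 (var 6)) skip (assign 6 (var 10))
roundFrom = assign 6 (var 10) ⨾ while (arr 11 (var 6)) roundStep
round     = reset ⨾ fill 1 15 (op div (arr 18 (var 5)) (const (+ 2))) ⨾
            -- The remainder modulo 2 marks the odd edges, all of them uncrossed so far.
            fill 1 13 (op sub (arr 18 (var 5)) (op mul (const (+ 2)) (arr 15 (var 5)))) ⨾
            assign 10 (var 2) ⨾ roundFrom ⨾ assign 10 (var 3) ⨾ roundFrom ⨾
            for 16 0 (assign 10 (var 16) ⨾ roundFrom)

-- The edges of the current path are written two cells ahead of the output position; weight and
-- length are put into these two cells when the path reaches `t`.
finishPath decCross decStep dec : Program
finishPath = store 1 (var 11) (var 14) ⨾ store 1 (op add (const 1ℤ) (var 11)) (var 12) ⨾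
             assign 11 (op add (op add (const (+ 2)) (var 11)) (var 12)) ⨾
             assign 13 (op add (var 13) (const 1ℤ)) ⨾ assign 12 (const 0ℤ) ⨾ assign 6 (var 2)
decCross   = store 16 (var 9) (op sub (arr 16 (var 9)) (const 1ℤ)) ⨾
             store 1 (op add (op add (const (+ 2)) (var 11)) (var 12)) (var 9) ⨾
             assign 12 (op add (var 12) (const 1ℤ)) ⨾ assign 6 (var 17) ⨾
             ifte (op eq (var 6) (var 3)) finishPath skip
decStep    = load ⨾ ifte (op leq (const 1ℤ) (op mul (var 8) (arr 16 (var 9)))) decCross advance
dec        = reset ⨾ assign 6 (var 2) ⨾ assign 12 (const 0ℤ) ⨾ while (arr 11 (var 6)) decStep

-- Every support edge receives one unit, brought along a route from `s` that is found backwards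
-- through the stored in-edges. The unit remains as excess at the head of the edge, for `push` to
-- dispose of.
pullStep pull : Program
pullStep = assign 9 (arr 9 (var 6)) ⨾ store 10 (var 9) (op add (arr 10 (var 9)) (const 1ℤ)) ⨾ assign 6 (arr 7 (var 9))
pull     = for 15 1 (ifte (arr 6 (var 15))
             ((store 10 (var 15) (op add (arr 10 (var 15)) (const 1ℤ)) ⨾ assign 6 (arr 7 (var 15))) ⨾
               while (op sub (var 6) (var 2)) pullStep)
             skip)

outside : Expr
outside = op mul (op sub (var 6) (var 2)) (op sub (var 6) (var 3))

pushStep send push : Program
pushStep = ifte (arr 11 (var 6))
  (load ⨾
    ifte (op leq (arr 6 (var 9)) (op add (arr 10 (var 9)) (var 8)))
      (ifte (op eq (arr 12 (var 6)) (op add (const 1ℤ) (arr 12 (var 17))))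
        (store 10 (var 9) (op add (arr 10 (var 9)) (var 8)) ⨾ assign 6 (var 17))
        advance)
      advance)
  (store 12 (var 6) (op add (const 1ℤ) (arr 12 (var 6))) ⨾ store 11 (var 6) (arr 4 (var 6)))
send = assign 15 (op sub (var 15) (const 1ℤ)) ⨾
  ifte (arr 6 (var 15)) (assign 6 (arr 2 (var 15)) ⨾ while outside pushStep) skip
push     = reset ⨾ fill 0 12 (op mul (var 0) (op eq (var 5) (var 3))) ⨾ assign 15 (var 1) ⨾
  while (var 15) send

inputE : ℕ → Expr
inputE j = arr 0 (op add (const (+ j)) (op mul (var 5) (const (+ 3))))

constants linking parenting norming setup : Program
constants = assign 0 (arr 0 (const 0ℤ)) ⨾ assign 1 (arr 0 (const 1ℤ)) ⨾ assign 2 (arr 0 (const (+ 2))) ⨾ assign 3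
    (arr 0 (const (+ 3)))
linking   = for 15 1
  (store 3 (op add (const 1ℤ) (var 15)) (arr 4 (arr 7 (var 15))) ⨾ store 4 (arr 7 (var 15))
      (op add (const 1ℤ) (var 15)) ⨾
   store 3 (op sub (const ℤ.-1ℤ) (var 15)) (arr 4 (arr 2 (var 15))) ⨾ store 4 (arr 2 (var 15))
       (op sub (const ℤ.-1ℤ) (var 15)))
parenting = for 15 1 (store 9 (arr 2 (var 15)) (var 15))
norming   = for 15 1
  (assign 9 (op mul (arr 5 (var 15)) (op sub (op mul (const (+ 2)) (op leq (const 0ℤ) (arr 5 (var 15)))) (const 1ℤ)))
      ⨾
   ifte (op leq (var 4) (var 9)) (assign 4 (var 9)) skip)
setup     = constants ⨾ fill 1 7 (inputE 4) ⨾ fill 1 2 (inputE 5) ⨾ fill 1 5 (inputE 6) ⨾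
  fill 1 6 (op sub (const 1ℤ) (op eq (arr 5 (var 5)) (const 0ℤ))) ⨾ linking ⨾ parenting ⨾ norming

-- The second splitting of a stage uses the opposite weight, and the stage leaves the sign flipped.
-- Multiplying by `-2` thus doubles the weight with which the stage was entered.
stage scale : Program
stage = fill 1 18 (op add (arr 10 (var 5)) (arr 5 (var 5))) ⨾ round ⨾
  fill 1 16 (op sub (arr 15 (var 5)) (arr 14 (var 5))) ⨾ dec ⨾ assign 14 (op sub (const 0ℤ) (var 14)) ⨾
  fill 1 16 (op sub (op add (arr 15 (var 5)) (arr 14 (var 5))) (arr 5 (var 5))) ⨾ dec
scale = fill 1 18 (arr 5 (var 5)) ⨾ round ⨾ fill 1 14 (arr 15 (var 5)) ⨾ stage ⨾ fill 1 5 (arr 14 (var 5)) ⨾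
  assign 14 (op mul (const (ℤ.- + 2)) (var 14)) ⨾ assign 4 (op div (op add (const 1ℤ) (var 4)) (const (+ 2)))

preparation mainLoop main : Program
preparation = setup ⨾ pull ⨾ push ⨾ (assign 11 (const 1ℤ) ⨾ assign 13 (const 0ℤ) ⨾ assign 14 (const 1ℤ))
-- The number of paths is known only at the end, hence cell 0 of the output is written last.
mainLoop    = while (op leq (const (+ 2)) (var 4)) scale ⨾ fill 1 14 (const 0ℤ) ⨾ stage ⨾ store 1 (const 0ℤ) (var 13)
main        = preparation ⨾ mainLoop

-- Half-edges and adjacency lists.

module Layout (G : STDAG) where
  open Network G

  data Half : Set where
    out inn : Edge → Half

  at to : Half → Node
  at (out e) = tail e
  at (inn e) = head e
  to (out e) = head e
  to (inn e) = tail e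

  edge : Half → Edge
  edge (out e) = e
  edge (inn e) = e

  sgn : Half → ℤ
  sgn (out e) = 1ℤ
  sgn (inn e) = ℤ.-1ℤ

  -- Zero is left free to mark the end of a list.
  code : Half → ℤ
  code (out e) = + suc (toℕ e)
  code (inn e) = -[1+ toℕ e ]

  code≢0 : ∀ h → code h ≢ 0ℤ
  code≢0 (out e) ()
  code≢0 (inn e) ()

  code-injective : ∀ {g h} → code g ≡ code h → g ≡ h
  code-injective {out e} {out f} q = cong out (toℕ-injective (ℕ.suc-injective (ℤ.+-injective q)))
  code-injective {inn e} {inn f} q = cong inn (toℕ-injective (ℤ.-[1+-injective q))

  -- Sending a unit along `h` moves it from `at h` to `to h`; for an `inn` half-edge this means
  -- lowering the flow on the edge by one.
  sgn-incidence : ∀ h v → sgn h ℤ.* incidence (edge h) v ≡ δ (to h) v ℤ.- δ (at h) v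
  sgn-incidence (out e) v = ℤ.*-identityˡ (incidence e v)
  sgn-incidence (inn e) v = negate (δ (head e) v) (δ (tail e) v)
    where
    negate : ∀ a b → ℤ.-1ℤ ℤ.* (a ℤ.- b) ≡ b ℤ.- a
    negate = ℤRing.solve-∀

  -- The correction to the value rounded down: an edge crossed backwards is rounded up instead.
  carry : Half → ℤ
  carry (out _) = 0ℤ
  carry (inn _) = 1ℤ

  reverse : ∀ h → ∃[ g ] edge g ≡ edge h × at g ≡ to h
  reverse (out e) = inn e , refl , refl
  reverse (inn e) = out e , refl , refl

  sizeOf : (Node → List Half) → ℕ
  sizeOf rem = ∑ℕ (length ∘ rem)

  sizeOf-[↦] : ∀ rem v l → sizeOf (rem [ v ↦ l ]) + length (rem v) ≡ sizeOf rem + length l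
  sizeOf-[↦] rem v l = trans (cong (_+ length (rem v)) (∑ℕ-cong pointwise)) (∑ℕ-[↦] (length ∘ rem) v (length l))
    where
    pointwise : ∀ w → length ((rem [ v ↦ l ]) w) ≡ ((length ∘ rem) [ v ↦ length l ]) w
    pointwise w with v Fin.≟ w
    ... | yes _ = refl
    ... | no _  = refl

  sizeOf-tail : ∀ rem v {h l} → rem v ≡ h ∷ l → sizeOf rem ≡ suc (sizeOf (rem [ v ↦ l ]))
  sizeOf-tail rem v {h} {l} q = ℕ.+-cancelʳ-≡ (length l) _ _ (begin
    sizeOf rem + length l                     ≡⟨ sizeOf-[↦] rem v l ⟨
    sizeOf (rem [ v ↦ l ]) + length (rem v)   ≡⟨ cong (λ k → sizeOf (rem [ v ↦ l ]) + length k) q ⟩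
    sizeOf (rem [ v ↦ l ]) + suc (length l)   ≡⟨ ℕ.+-suc _ (length l) ⟩
    suc (sizeOf (rem [ v ↦ l ])) + length l   ∎)
    where open ≡-Reasoning

  hd : List Half → ℤ
  hd []      = 0ℤ
  hd (h ∷ _) = code h

  Linked : (Half → ℤ) → List Half → Set
  Linked next []      = ⊤
  Linked next (h ∷ l) = next h ≡ hd l × Linked next l

  -- Each half-edge belongs to the list of just one node, so a single `next` cell per half-edge
  -- serves all lists at once.
  record Adjacency : Set where
    field
      inc      : Node → List Half
      next     : Half → ℤ
      linked   : ∀ v → Linked next (inc v)
      inc-at   : ∀ v → All (λ h → at h ≡ v) (inc v)
      complete : ∀ h → h ∈ inc (at h)
      size     : ∑ℕ (length ∘ inc) ≡ m * 2

  record Loaded (h : Half) (σ : State) : Set where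
    field
      ptr≡ : σ .vars 7 ≡ code h
      sgn≡ : σ .vars 8 ≡ sgn h
      idx≡ : σ .vars 9 ≡ + toℕ (edge h)
      to≡  : σ .vars 17 ≡ + toℕ (to h)

  module Represented (adj : Adjacency) where
    open Adjacency adj public

    record Static (σ : State) : Set where
      field
        n≡     : σ .vars 0 ≡ + n
        m≡     : σ .vars 1 ≡ + m
        s≡     : σ .vars 2 ≡ + toℕ s
        t≡     : σ .vars 3 ≡ + toℕ t
        head≈  : σ .arrays 2 ≈ λ e → + toℕ (head e)
        tail≈  : σ .arrays 7 ≈ λ e → + toℕ (tail e)
        next≡  : ∀ h → σ .arrays 3 (code h) ≡ next h
        first≈ : σ .arrays 4 ≈ λ v → hd (inc v)

    open Static public

    clean : Program → Bool
    clean p = not (writesVar 0 p) ∧ not (writesVar 1 p) ∧ not (writesVar 2 p) ∧ not (writesVar 3 p)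
            ∧ not (writesArr 2 p) ∧ not (writesArr 3 p) ∧ not (writesArr 4 p) ∧ not (writesArr 7 p)

    static-same : ∀ {p σ τ} {_ : T (clean p)} → Same p σ τ → Static σ → Static τ
    static-same {p} {_} {_} {c} sm st
      with v0 , c ← ∧-T (not (writesVar 0 p)) c
      with v1 , c ← ∧-T (not (writesVar 1 p)) c
      with v2 , c ← ∧-T (not (writesVar 2 p)) c
      with v3 , c ← ∧-T (not (writesVar 3 p)) c
      with a2 , c ← ∧-T (not (writesArr 2 p)) c
      with a3 , c ← ∧-T (not (writesArr 3 p)) c
      with a4 , a7 ← ∧-T (not (writesArr 4 p)) c
      = record
      { n≡     = trans (sm .sameVar 0 {v0}) (st .n≡)
      ; m≡     = trans (sm .sameVar 1 {v1}) (st .m≡)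
      ; s≡     = trans (sm .sameVar 2 {v2}) (st .s≡)
      ; t≡     = trans (sm .sameVar 3 {v3}) (st .t≡)
      ; head≈  = λ e → trans (sm .sameArr 2 {a2} _) (st .head≈ e)
      ; tail≈  = λ e → trans (sm .sameArr 7 {a7} _) (st .tail≈ e)
      ; next≡  = λ h → trans (sm .sameArr 3 {a3} _) (st .next≡ h)
      ; first≈ = λ v → trans (sm .sameArr 4 {a4} _) (st .first≈ v)
      }

    -- `rem v` is what remains to be scanned at `v`. Memory holds only its first element; the list
    -- itself exists for the proof, where its length is a supply of credits.
    record Pointers (f : ℤ → ℤ) (rem : Node → List Half) : Set where
      field
        ptr≈       : f ≈ λ v → hd (rem v)
        rem-linked : ∀ v → Linked next (rem v)
        rem-at     : ∀ v → All (λ h → at h ≡ v) (rem v)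

    open Pointers public

    pointers-cong : ∀ {f g rem} → (∀ j → g j ≡ f j) → Pointers f rem → Pointers g rem
    pointers-cong h P = record { ptr≈ = λ v → trans (h _) (P .ptr≈ v) ; rem-linked = P .rem-linked ; rem-at = P
        .rem-at }

    pointers-inc : ∀ {f} → f ≈ (λ v → hd (inc v)) → Pointers f inc
    pointers-inc h = record { ptr≈ = h ; rem-linked = linked ; rem-at = inc-at }

    pointers-write : ∀ {f rem i z l} v → Pointers f rem → i ≡ + toℕ v → z ≡ hd l → Linked next l → All
        (λ h → at h ≡ v) l →
      Pointers (write i z f) (rem [ v ↦ l ])
    pointers-write {f} {rem} {i} {z} {l} v P i≡ z≡ lk al .ptr≈ w with v Fin.≟ w
    ... | yes refl = trans (write-hit {v = z} f i≡) z≡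
    ... | no v≢w   = trans (write-miss {v = z} f (λ q → v≢w (+toℕ-injective (trans (sym i≡) q)))) (P .ptr≈ w)
    pointers-write v P i≡ z≡ lk al .rem-linked w with v Fin.≟ w
    ... | yes refl = lk
    ... | no _     = P .rem-linked w
    pointers-write v P i≡ z≡ lk al .rem-at w with v Fin.≟ w
    ... | yes refl = al
    ... | no _     = P .rem-at w

    pointers-advance : ∀ {σ rem h l} v → Static σ → Pointers (σ .arrays 11) rem → σ .vars 6 ≡ + toℕ v → rem v ≡ h ∷ l
        → σ .vars 7 ≡ code h →
      Pointers (write (σ .vars 6) (σ .arrays 3 (σ .vars 7)) (σ .arrays 11)) (rem [ v ↦ l ])
    pointers-advance {σ} {rem} {h} {l} v st P v≡ r≡ p≡ with subst (Linked next) r≡ (P .rem-linked v) | subst (All _)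
        r≡ (P .rem-at v)
    ... | n≡ , lk | _ ∷ al = pointers-write v P v≡ (trans (cong (σ .arrays 3) p≡) (trans (st .next≡ h) n≡)) lk al

    pending : ∀ {σ rem} v → Pointers (σ .arrays 11) rem → σ .vars 6 ≡ + toℕ v → σ .arrays 11 (σ .vars 6) ≢ 0ℤ →
      ∃[ h ] ∃[ l ] rem v ≡ h ∷ l × at h ≡ v
    pending {σ} {rem} v P v≡ ≢0 with rem v | P .ptr≈ v | P .rem-at v
    ... | []    | q | _ = ⊥-elim (≢0 (trans (cong (σ .arrays 11) v≡) q))
    ... | h ∷ l | _ | a ∷ _ = h , l , refl , a

    exhausted : ∀ {σ rem} v → Pointers (σ .arrays 11) rem → σ .vars 6 ≡ + toℕ v → σ .arrays 11 (σ .vars 6) ≡ 0ℤ → rem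
        v ≡ []
    exhausted {σ} {rem} v P v≡ ≡0 with rem v | P .ptr≈ v
    ... | []    | _ = refl
    ... | h ∷ l | q = ⊥-elim (code≢0 h (trans (sym q) (trans (cong (σ .arrays 11) (sym v≡)) ≡0)))

    loaded : ∀ {σ} → Static σ → ∀ h → σ .arrays 11 (σ .vars 6) ≡ code h → wp load (Loaded h) σ
    loaded {σ} st h p≡ = record { ptr≡ = p≡ ; sgn≡ = sgn-ok h p≡ ; idx≡ = idx-ok h p≡ ; to≡ = to-ok h p≡ }
      where
      sgnOf idxOf : ℤ → ℤ
      sgnOf p = + 2 ℤ.* (if does (1ℤ ℤ.≤? p) then 1ℤ else 0ℤ) ℤ.- 1ℤ
      idxOf p = sgnOf p ℤ.* p ℤ.- 1ℤ
      sgn-ok : ∀ {p} h → p ≡ code h → sgnOf p ≡ sgn h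
      sgn-ok (out e) refl = refl
      sgn-ok (inn e) refl = refl
      idx-ok : ∀ {p} h → p ≡ code h → idxOf p ≡ + toℕ (edge h)
      idx-ok (out e) refl = cong +_ (ℕ.+-identityʳ (toℕ e))
      idx-ok (inn e) refl = cong +_ (ℕ.+-identityʳ (toℕ e))
      to-ok : ∀ {p} h → p ≡ code h →
        (if does (1ℤ ℤ.≤? p) then 1ℤ else 0ℤ) ℤ.* σ .arrays 2 (idxOf p) ℤ.+
        (if does (p ℤ.≤? 0ℤ) then 1ℤ else 0ℤ) ℤ.* σ .arrays 7 (idxOf p) ≡ + toℕ (to h)
      to-ok (out e) refl = trans (ℤ.+-identityʳ _) (trans (ℤ.*-identityˡ _)
        (trans (cong (σ .arrays 2) (idx-ok (out e) refl)) (st .head≈ e)))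
      to-ok (inn e) refl = trans (ℤ.+-identityˡ _) (trans (ℤ.*-identityˡ _)
        (trans (cong (σ .arrays 7) (idx-ok (inn e) refl)) (st .tail≈ e)))

    run-load : ∀ {σ rem h l φ} v → Static σ → Pointers (σ .arrays 11) rem → σ .vars 6 ≡ + toℕ v → rem v ≡ h ∷ l →
      Run load σ (suc φ) (λ τ ψ → Loaded h τ × ψ ≡ φ)
    run-load {σ} {rem} {h} v st P v≡ r≡ = run-straight load
      (loaded st h (trans (cong (σ .arrays 11) v≡) (trans (P .ptr≈ v) (cong hd r≡))) , refl)

    run-reset : ∀ {σ φ} → Static σ → Run reset σ (2 + (n * 3 + φ)) (λ τ ψ → Pointers (τ .arrays 11) inc × ψ ≡ φ)
    run-reset {σ} st = run-mono (run-fill {N = n} (hd ∘ inc) (st .n≡) λ {τ} sm v 5≡ →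
        trans (cong (τ .arrays 4) 5≡) (trans (sm .sameArr 4 _) (st .first≈ v)))
      λ { τ ψ _ (h , q) → pointers-inc h , q }

-- Rounding half-integral flows along trails.

module Rounding (G : STDAG) where
  open Network G
  open Layout G

  record Rounds (W K : Edge → ℤ) : Set where
    field
      lower     : ∀ e → ℤ.-1ℤ ℤ.≤ + 2 ℤ.* K e ℤ.- W e
      upper     : ∀ e → + 2 ℤ.* K e ℤ.- W e ℤ.≤ 1ℤ
      conserved : Conserved K

  -- Undirected trails through the odd edges: U marks the edges still to be crossed, and crossing one
  -- forwards (backwards) rounds it down (up).
  module Trails {W : Edge → ℤ} (cW : Conserved W) where

    -- The superposition of the trails walked so far: 1 on an odd edge crossed forwards, -1 on one
    -- crossed backwards, and 0 on even and on uncrossed edges.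
    Q : (U K : Edge → ℤ) → Edge → ℤ
    Q U K e = W e ℤ.- U e ℤ.- + 2 ℤ.* K e

    data Parity (U K : Edge → ℤ) (e : Edge) : Set where
      settled : U e ≡ 0ℤ → ℤ.-1ℤ ℤ.≤ + 2 ℤ.* K e ℤ.- W e → + 2 ℤ.* K e ℤ.- W e ℤ.≤ 1ℤ → Parity U K e
      odd     : U e ≡ 1ℤ → W e ≡ 1ℤ ℤ.+ + 2 ℤ.* K e → Parity U K e

    -- At interior nodes `Q` looks like one open trail from `start` to `cur`. At `s` only an
    -- inequality holds, since finished trails from `s` to `t` lower the value. The modes record the
    -- order of the starting nodes: a trail begun after those from `s` (or from `t`) finds that
    -- terminal exhausted and can no longer enter it.
    record Trail (start cur : Node) (U K : Edge → ℤ) (rem : Node → List Half) : Set where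
      field
        parity  : ∀ e → Parity U K e
        live    : ∀ h → U (edge h) ≢ 0ℤ → h ∈ rem (at h)
        balance : ∀ {v} → Interior v → ∂ (Q U K) v ≡ δ cur v ℤ.- δ start v
        value   : ∂ (Q U K) s ℤ.≤ δ cur s ℤ.- δ start s
        mode-s  : start ≡ s ⊎ (rem s ≡ [] × cur ≢ s)
        mode-t  : start ≡ s ⊎ start ≡ t ⊎ (rem t ≡ [] × cur ≢ t)

    open Trail public

    live-tail : ∀ {cur h l} (U : Edge → ℤ) (rem : Node → List Half) → (∀ h → U (edge h) ≢ 0ℤ → h ∈ rem (at h)) → rem
        cur ≡ h ∷ l →
      U (edge h) ≡ 0ℤ → ∀ g → U (edge g) ≢ 0ℤ → g ∈ (rem [ cur ↦ l ]) (at g)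
    live-tail {cur} U rem lv r≡ U≡0 g U≢0 with cur Fin.≟ at g
    ... | no _ = lv g U≢0
    ... | yes refl with subst (g ∈_) r≡ (lv g U≢0)
    ...   | here refl = ⊥-elim (U≢0 U≡0)
    ...   | there g∈l = g∈l

    trail-skip : ∀ {start cur U K rem h l} → Trail start cur U K rem → rem cur ≡ h ∷ l → U (edge h) ≡ 0ℤ →
      Trail start cur U K (rem [ cur ↦ l ])
    trail-skip {start} {cur} {U} {K} {rem} {h} {l} tr r≡ U≡0 = record
      { parity = tr .parity
      ; live = live-tail U rem (tr .live) r≡ U≡0
      ; balance = tr .balance
      ; value = tr .value
      ; mode-s = mode-s′ (tr .mode-s)
      ; mode-t = mode-t′ (tr .mode-t)
      }
      where
      mode-s′ : start ≡ s ⊎ (rem s ≡ [] × cur ≢ s) → start ≡ s ⊎ ((rem [ cur ↦ l ]) s ≡ [] × cur ≢ s)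
      mode-s′ (inj₁ q) = inj₁ q
      mode-s′ (inj₂ (q , ≢)) = inj₂ (trans (↦-miss rem l ≢) q , ≢)
      mode-t′ : start ≡ s ⊎ start ≡ t ⊎ (rem t ≡ [] × cur ≢ t) → start ≡ s ⊎ start ≡ t ⊎
          ((rem [ cur ↦ l ]) t ≡ [] × cur ≢ t)
      mode-t′ (inj₁ q) = inj₁ q
      mode-t′ (inj₂ (inj₁ q)) = inj₂ (inj₁ q)
      mode-t′ (inj₂ (inj₂ (q , ≢))) = inj₂ (inj₂ (trans (↦-miss rem l ≢) q , ≢))

    trail-cross : ∀ {start cur U K rem h l} → Trail start cur U K rem → rem cur ≡ h ∷ l → at h ≡ cur → U (edge h) ≢
        0ℤ →
      Trail start (to h) (U [ edge h ↦ 0ℤ ]) (K [ edge h ↦ K (edge h) ℤ.+ carry h ]) (rem [ cur ↦ l ])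
    trail-cross {start} {_} {U} {K} {rem} {h} {l} tr r≡ refl U≢0 = record
      { parity = parity′
      ; live = live-tail U′ rem (λ g U′≢0 → tr .live g (λ q → U′≢0 (U′-zero g q))) r≡ (↦-hit U e 0ℤ)
      ; balance = λ {v} iv → trans (∂Q′ v) (trans (cong (ℤ._+ (δ (to h) v ℤ.- δ (at h) v)) (tr .balance iv))
          (shift (δ (at h) v) (δ start v) (δ (to h) v)))
      ; value = subst₂ ℤ._≤_ (sym (∂Q′ s)) (shift (δ (at h) s) (δ start s) (δ (to h) s))
          (ℤ.+-monoˡ-≤ (δ (to h) s ℤ.- δ (at h) s) (tr .value))
      ; mode-s = mode-s′ (tr .mode-s)
      ; mode-t = mode-t′ (tr .mode-t)
      }
      where
      e = edge h
      U′ = U [ e ↦ 0ℤ ]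
      K′ = K [ e ↦ K e ℤ.+ carry h ]
      U′-zero : ∀ g → U (edge g) ≡ 0ℤ → U′ (edge g) ≡ 0ℤ
      U′-zero g q with e Fin.≟ edge g
      ... | yes _ = refl
      ... | no _  = q
      shift : ∀ a b c → a ℤ.- b ℤ.+ (c ℤ.- a) ≡ c ℤ.- b
      shift = ℤRing.solve-∀
      is-odd : U e ≡ 1ℤ × W e ≡ 1ℤ ℤ.+ + 2 ℤ.* K e
      is-odd with tr .parity e
      ... | settled q _ _ = ⊥-elim (U≢0 q)
      ... | odd q w       = q , w
      carried : ∀ h k w → w ≡ 1ℤ ℤ.+ + 2 ℤ.* k → w ℤ.- 0ℤ ℤ.- + 2 ℤ.* (k ℤ.+ carry h) ≡ sgn h
      carried (out _) k w refl = lemma k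
        where
        lemma : ∀ k → 1ℤ ℤ.+ + 2 ℤ.* k ℤ.- 0ℤ ℤ.- + 2 ℤ.* (k ℤ.+ 0ℤ) ≡ 1ℤ
        lemma = ℤRing.solve-∀
      carried (inn _) k w refl = lemma k
        where
        lemma : ∀ k → 1ℤ ℤ.+ + 2 ℤ.* k ℤ.- 0ℤ ℤ.- + 2 ℤ.* (k ℤ.+ 1ℤ) ≡ ℤ.-1ℤ
        lemma = ℤRing.solve-∀
      error : ∀ h k w → w ≡ 1ℤ ℤ.+ + 2 ℤ.* k → + 2 ℤ.* (k ℤ.+ carry h) ℤ.- w ≡ ℤ.- sgn h
      error (out _) k w refl = lemma k
        where
        lemma : ∀ k → + 2 ℤ.* (k ℤ.+ 0ℤ) ℤ.- (1ℤ ℤ.+ + 2 ℤ.* k) ≡ ℤ.- 1ℤ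
        lemma = ℤRing.solve-∀
      error (inn _) k w refl = lemma k
        where
        lemma : ∀ k → + 2 ℤ.* (k ℤ.+ 1ℤ) ℤ.- (1ℤ ℤ.+ + 2 ℤ.* k) ≡ ℤ.- ℤ.-1ℤ
        lemma = ℤRing.solve-∀
      -1≤ : ∀ h → ℤ.-1ℤ ℤ.≤ ℤ.- sgn h
      -1≤ (out _) = ℤ.≤-refl
      -1≤ (inn _) = ℤ.-≤+
      ≤1 : ∀ h → ℤ.- sgn h ℤ.≤ 1ℤ
      ≤1 (out _) = ℤ.-≤+
      ≤1 (inn _) = ℤ.≤-refl
      parity′ : ∀ f → Parity U′ K′ f
      parity′ f with e Fin.≟ f in q
      ... | yes refl = settled (↦-hit U e 0ℤ)
              (subst (ℤ.-1ℤ ℤ.≤_) (sym err) (-1≤ h)) (subst (ℤ._≤ 1ℤ) (sym err) (≤1 h))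
        where
        err : + 2 ℤ.* K′ e ℤ.- W e ≡ ℤ.- sgn h
        err = trans (cong (λ k → + 2 ℤ.* k ℤ.- W e) (↦-hit K e (K e ℤ.+ carry h)))
            (error h (K e) (W e) (proj₂ is-odd))
      ... | no e≢f with tr .parity f
      ...   | settled z lo up = settled (trans (↦-miss U 0ℤ e≢f) z)
                (subst (λ k → ℤ.-1ℤ ℤ.≤ + 2 ℤ.* k ℤ.- W f) (sym (↦-miss K (K e ℤ.+ carry h) e≢f)) lo)
                (subst (λ k → + 2 ℤ.* k ℤ.- W f ℤ.≤ 1ℤ) (sym (↦-miss K (K e ℤ.+ carry h) e≢f)) up)
      ...   | odd o w = odd (trans (↦-miss U 0ℤ e≢f) o)
          (trans w (cong (λ k → 1ℤ ℤ.+ + 2 ℤ.* k) (sym (↦-miss K (K e ℤ.+ carry h) e≢f))))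
      Q′ : ∀ f → Q U′ K′ f ≡ (Q U K [ e ↦ sgn h ]) f
      Q′ f with e Fin.≟ f
      ... | yes refl = carried h (K e) (W e) (proj₂ is-odd)
      ... | no _     = refl
      Qe≡0 : Q U K e ≡ 0ℤ
      Qe≡0 = trans (cong₂ (λ w u → w ℤ.- u ℤ.- + 2 ℤ.* K e) (proj₂ is-odd) (proj₁ is-odd)) (lemma (K e))
        where
        lemma : ∀ k → 1ℤ ℤ.+ + 2 ℤ.* k ℤ.- 1ℤ ℤ.- + 2 ℤ.* k ≡ 0ℤ
        lemma = ℤRing.solve-∀
      ∂Q′ : ∀ v → ∂ (Q U′ K′) v ≡ ∂ (Q U K) v ℤ.+ (δ (to h) v ℤ.- δ (at h) v)
      ∂Q′ v = begin
        ∂ (Q U′ K′) v                                        ≡⟨ ∂-cong Q′ v ⟩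
        ∂ (Q U K [ e ↦ sgn h ]) v                            ≡⟨ ∂-[↦] (Q U K) e (sgn h) v ⟩
        ∂ (Q U K) v ℤ.+ (sgn h ℤ.- Q U K e) ℤ.* incidence e v ≡⟨ cong
            (λ q → ∂ (Q U K) v ℤ.+ (sgn h ℤ.- q) ℤ.* incidence e v) Qe≡0 ⟩
        ∂ (Q U K) v ℤ.+ (sgn h ℤ.- 0ℤ) ℤ.* incidence e v     ≡⟨ cong (λ q → ∂ (Q U K) v ℤ.+ q ℤ.* incidence e v)
            (ℤ.+-identityʳ (sgn h)) ⟩
        ∂ (Q U K) v ℤ.+ sgn h ℤ.* incidence e v              ≡⟨ cong (λ q → ∂ (Q U K) v ℤ.+ q) (sgn-incidence h v) ⟩
        ∂ (Q U K) v ℤ.+ (δ (to h) v ℤ.- δ (at h) v)          ∎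
        where open ≡-Reasoning
      -- Since `h` is uncrossed, its reverse is still listed at `to h`: a trail never enters an
      -- exhausted node.
      not-into : ∀ {v} → rem v ≡ [] → to h ≢ v
      not-into q refl with reverse h
      ... | g , eg , ag with subst (g ∈_) (trans (cong rem ag) q) (tr .live g (λ z → U≢0 (trans (cong U (sym eg)) z)))
      ...   | ()
      mode-s′ : start ≡ s ⊎ (rem s ≡ [] × at h ≢ s) → start ≡ s ⊎ ((rem [ at h ↦ l ]) s ≡ [] × to h ≢ s)
      mode-s′ (inj₁ q) = inj₁ q
      mode-s′ (inj₂ (q , ≢)) = inj₂ (trans (↦-miss rem l ≢) q , not-into q)
      mode-t′ : start ≡ s ⊎ start ≡ t ⊎ (rem t ≡ [] × at h ≢ t) → start ≡ s ⊎ start ≡ t ⊎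
          ((rem [ at h ↦ l ]) t ≡ [] × to h ≢ t)
      mode-t′ (inj₁ q) = inj₁ q
      mode-t′ (inj₂ (inj₁ q)) = inj₂ (inj₁ q)
      mode-t′ (inj₂ (inj₂ (q , ≢))) = inj₂ (inj₂ (trans (↦-miss rem l ≢) q , not-into q))

    uncrossed-zero : ∀ {start cur U K rem v} → Trail start cur U K rem → rem v ≡ [] → ∀ h → at h ≡ v → U (edge h) ≡ 0ℤ
    uncrossed-zero {U = U} tr q h refl with U (edge h) ℤ.≟ 0ℤ
    ... | yes z = z
    ... | no ≢0 with subst (h ∈_) q (tr .live h ≢0)
    ...   | ()

    ∂Q-split : ∀ U K v → ∂ (Q U K) v ≡ ∂ W v ℤ.- ∂ U v ℤ.- + 2 ℤ.* ∂ K v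
    ∂Q-split U K v = trans (∂-minus (λ e → W e ℤ.- U e) (λ e → + 2 ℤ.* K e) v)
        (cong₂ ℤ._-_ (∂-minus W U v) (∂-* (+ 2) K v))

    odd≢even : ∀ k → 1ℤ ≢ 0ℤ ℤ.- 0ℤ ℤ.- + 2 ℤ.* k
    odd≢even k q with trans (cong ∣_∣ q) (trans (cong ∣_∣ (ℤ.+-identityˡ (ℤ.- (+ 2 ℤ.* k))))
        (trans (ℤ.∣-i∣≡∣i∣ (+ 2 ℤ.* k)) (ℤ.abs-* (+ 2) k)))
    ... | r with ∣ k ∣
    ...   | zero with () ← r
    ...   | suc j with () ← trans (ℕ.suc-injective r) (ℕ.+-suc j (j + 0))

    -- At any other interior node parity forbids it. With every odd edge at `cur` crossed, the net
    -- inflow of `Q` there is `-2 * ∂ K cur`, an even number, while `balance` makes it 1. The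
    -- terminals are settled by the modes.
    stuck : ∀ {start cur U K rem} → Trail start cur U K rem → rem cur ≡ [] → cur ≡ start ⊎ (cur ≡ t × start ≡ s)
    stuck {start} {cur} {U} {K} tr r≡ with cur Fin.≟ start
    ... | yes q = inj₁ q
    ... | no c≢start with cur Fin.≟ s | cur Fin.≟ t
    ...   | yes q | _ = inj₁ (at-s (tr .mode-s))
      where
      at-s : start ≡ s ⊎ _ → cur ≡ start
      at-s (inj₁ r) = trans q (sym r)
      at-s (inj₂ (_ , ≢)) = ⊥-elim (≢ q)
    ...   | no _ | yes q = at-t (tr .mode-t)
      where
      at-t : start ≡ s ⊎ start ≡ t ⊎ _ → cur ≡ start ⊎ (cur ≡ t × start ≡ s)
      at-t (inj₁ r) = inj₂ (q , r)
      at-t (inj₂ (inj₁ r)) = inj₁ (trans q (sym r))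
      at-t (inj₂ (inj₂ (_ , ≢))) = ⊥-elim (≢ q)
    ...   | no c≢s | no c≢t = ⊥-elim (odd≢even (∂ K cur) (begin
      1ℤ                                          ≡⟨ cong₂ ℤ._-_ (δ-refl cur) (δ-≢ (c≢start ∘ sym)) ⟨
      δ cur cur ℤ.- δ start cur                   ≡⟨ tr .balance (c≢s , c≢t) ⟨
      ∂ (Q U K) cur                               ≡⟨ ∂Q-split U K cur ⟩
      ∂ W cur ℤ.- ∂ U cur ℤ.- + 2 ℤ.* ∂ K cur     ≡⟨ cong₂ (λ w u → w ℤ.- u ℤ.- + 2 ℤ.* ∂ K cur) (cW (c≢s , c≢t))
          ∂U≡0 ⟩
      0ℤ ℤ.- 0ℤ ℤ.- + 2 ℤ.* ∂ K cur               ∎))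
      where
      open ≡-Reasoning
      ∂U≡0 : ∂ U cur ≡ 0ℤ
      ∂U≡0 = trans (∂-∑ U cur) (∑-0 term)
        where
        term : ∀ e → U e ℤ.* incidence e cur ≡ 0ℤ
        term e with head e Fin.≟ cur | tail e Fin.≟ cur
        ... | yes q | _ = trans (cong (ℤ._* incidence e cur) (uncrossed-zero tr r≡ (inn e) q))
            (ℤ.*-zeroˡ (incidence e cur))
        ... | no _ | yes q = trans (cong (ℤ._* incidence e cur) (uncrossed-zero tr r≡ (out e) q))
            (ℤ.*-zeroˡ (incidence e cur))
        ... | no h≢ | no t≢ = trans (cong (U e ℤ.*_) (cong₂ ℤ._-_ (δ-≢ h≢) (δ-≢ t≢))) (ℤ.*-zeroʳ (U e))

    -- A trail from `s` that is stuck at `t` is abandoned and a new one begun at `s`. Interior nodes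
    -- do not notice, and at `s` the net inflow of `Q` has dropped by one; here the equality in
    -- `value` is lost.
    trail-return : ∀ {start cur U K rem} → Trail start cur U K rem → rem cur ≡ [] → Trail start start U K rem
    trail-return tr r≡ with stuck tr r≡
    ... | inj₁ refl = tr
    ... | inj₂ (refl , refl) = record
      { parity = tr .parity
      ; live = tr .live
      ; balance = λ { {v} (v≢s , v≢t) → trans (tr .balance (v≢s , v≢t))
          (cong (ℤ._- δ s v) (trans (δ-≢ (v≢t ∘ sym)) (sym (δ-≢ (v≢s ∘ sym))))) }
      ; value = ℤ.≤-trans (tr .value) (ℤ.+-monoˡ-≤ (ℤ.- δ s s) (subst (δ t s ℤ.≤_) (sym (δ-refl s)) (δ≤1 t s)))
      ; mode-s = inj₁ refl
      ; mode-t = inj₁ refl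
      }

    trail-restart : ∀ {x y U K rem} → Trail x x U K rem → y ≡ s ⊎ (rem s ≡ [] × y ≢ s) → y ≡ s ⊎ y ≡ t ⊎
        (rem t ≡ [] × y ≢ t) →
      Trail y y U K rem
    trail-restart {x} {y} tr ms mt = record
      { parity = tr .parity
      ; live = tr .live
      ; balance = λ {v} iv → trans (tr .balance iv) (trans (ℤ.+-inverseʳ (δ x v)) (sym (ℤ.+-inverseʳ (δ y v))))
      ; value = ℤ.≤-trans (tr .value) (ℤ.≤-reflexive (trans (ℤ.+-inverseʳ (δ x s)) (sym (ℤ.+-inverseʳ (δ y s)))))
      ; mode-s = ms
      ; mode-t = mt
      }

    -- Once everything is scanned `U` vanishes and `Q` is `W - 2 K`. Its conservation gives that of
    -- `K`, and `∂ Q s ≤ 0` is the comparison of the values.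
    trail-done : ∀ {x U K rem} → Trail x x U K rem → (∀ v → rem v ≡ []) → Rounds W K × ∂ W s ℤ.≤ + 2 ℤ.* ∂ K s
    trail-done {x} {U} {K} {rem} tr empty = record
      { lower = λ e → bound₁ e (tr .parity e)
      ; upper = λ e → bound₂ e (tr .parity e)
      ; conserved = λ {v} iv → halve (∂ K v) (flat iv)
      } , below (subst (ℤ._≤ 0ℤ) (∂Q s) (subst (∂ (Q U K) s ℤ.≤_) (ℤ.+-inverseʳ (δ x s)) (tr .value)))
      where
      U≡0 : ∀ e → U e ≡ 0ℤ
      U≡0 e = uncrossed-zero tr (empty (tail e)) (out e) refl
      bound₁ : ∀ e → Parity U K e → ℤ.-1ℤ ℤ.≤ + 2 ℤ.* K e ℤ.- W e
      bound₁ e (settled _ lo _) = lo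
      bound₁ e (odd o _) with () ← trans (sym o) (U≡0 e)
      bound₂ : ∀ e → Parity U K e → + 2 ℤ.* K e ℤ.- W e ℤ.≤ 1ℤ
      bound₂ e (settled _ _ up) = up
      bound₂ e (odd o _) with () ← trans (sym o) (U≡0 e)
      ∂Q : ∀ v → ∂ (Q U K) v ≡ ∂ W v ℤ.- + 2 ℤ.* ∂ K v
      ∂Q v = trans (∂Q-split U K v) (trans (cong (λ u → ∂ W v ℤ.- u ℤ.- + 2 ℤ.* ∂ K v)
          (trans (∂-cong U≡0 v) (∂-0 v))) (cong (ℤ._- + 2 ℤ.* ∂ K v) (ℤ.+-identityʳ (∂ W v))))
      flat : ∀ {v} → Interior v → ℤ.- (+ 2 ℤ.* ∂ K v) ≡ 0ℤ
      flat {v} iv = begin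
        ℤ.- (+ 2 ℤ.* ∂ K v)       ≡⟨ ℤ.+-identityˡ (ℤ.- (+ 2 ℤ.* ∂ K v)) ⟨
        0ℤ ℤ.- + 2 ℤ.* ∂ K v      ≡⟨ cong (ℤ._- + 2 ℤ.* ∂ K v) (cW iv) ⟨
        ∂ W v ℤ.- + 2 ℤ.* ∂ K v   ≡⟨ ∂Q v ⟨
        ∂ (Q U K) v               ≡⟨ tr .balance iv ⟩
        δ x v ℤ.- δ x v           ≡⟨ ℤ.+-inverseʳ (δ x v) ⟩
        0ℤ                        ∎
        where open ≡-Reasoning
      halve : ∀ k → ℤ.- (+ 2 ℤ.* k) ≡ 0ℤ → k ≡ 0ℤ
      halve k q = ℤ.*-cancelˡ-≡ (+ 2) k 0ℤ (trans (sym (ℤ.neg-involutive (+ 2 ℤ.* k))) (cong ℤ.-_ q))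
      below : ∀ {a b} → a ℤ.- b ℤ.≤ 0ℤ → a ℤ.≤ b
      below = ℤ.i-j≤0⇒i≤j

-- The rounding program and its cost.

module RoundingProgram (G : STDAG) where
  open Network G
  open Layout G
  open Rounding G

  module _ (adj : Adjacency) {W : Edge → ℤ} (cW : Conserved W) where
    open Represented adj
    open Trails cW

    -- `home` holds because a stuck trail is taken back to its start at once; the exit test at the
    -- current node therefore reveals that the start is exhausted. `shrinks` remembers the nodes
    -- cleared by earlier trails.
    record OnTrail (x : Node) (rem₀ : Node → List Half) (rest : ℕ) (σ : State) (ψ : ℕ) : Set where
      field
        {cur}    : Node
        {U K}    : Edge → ℤ
        {rem}    : Node → List Half
        cur≡     : σ .vars 6 ≡ + toℕ cur
        U≈       : σ .arrays 13 ≈ U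
        K≈       : σ .arrays 15 ≈ K
        pointers : Pointers (σ .arrays 11) rem
        trail    : Trail x cur U K rem
        home     : rem cur ≡ [] → cur ≡ x
        shrinks  : ∀ v → rem₀ v ≡ [] → rem v ≡ []
        credit   : ψ ≡ sizeOf rem * 3 + rest

    carry≡ : ∀ h → (if does (sgn h ℤ.≤? 0ℤ) then 1ℤ else 0ℤ) ≡ carry h
    carry≡ (out e) = refl
    carry≡ (inn e) = refl

    shrink : ∀ {rem₀ rem : Node → List Half} {c h l} → rem c ≡ h ∷ l → (∀ v → rem₀ v ≡ [] → rem v ≡ []) →
      ∀ v → rem₀ v ≡ [] → (rem [ c ↦ l ]) v ≡ []
    shrink {c = c} r≡ f v q with c Fin.≟ v
    ... | no _ = f v q
    ... | yes refl with () ← trans (sym r≡) (f v q)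

    go-home : ∀ {x rem₀ rest σ c U K rem ψ} → σ .vars 10 ≡ + toℕ x → σ .vars 6 ≡ + toℕ c → σ .arrays 13 ≈ U → σ
        .arrays 15 ≈ K →
      Pointers (σ .arrays 11) rem → Trail x c U K rem → (∀ v → rem₀ v ≡ [] → rem v ≡ []) → ψ ≡ sizeOf rem * 3 + rest →
      wp (ifte (arr 11 (var 6)) skip (assign 6 (var 10))) (λ τ → OnTrail x rem₀ rest τ ψ) σ
    go-home {x} {σ = σ} {c} {rem = rem} x≡ c≡ U≈ K≈ P tr sh ψ≡ =
        (λ ≢0 → record { cur≡ = c≡ ; U≈ = U≈ ; K≈ = K≈ ; pointers = P ; trail = tr ; home = λ q → ⊥-elim
            (nonempty ≢0 q) ; shrinks = sh ; credit = ψ≡ })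
      , (λ ≡0 → record { cur≡ = x≡ ; U≈ = U≈ ; K≈ = K≈ ; pointers = P ; trail = trail-return tr
          (exhausted {σ} c P c≡ ≡0) ; home = λ _ → refl ; shrinks = sh ; credit = ψ≡ })
      where
      nonempty : σ .arrays 11 (σ .vars 6) ≢ 0ℤ → rem c ≢ []
      nonempty ≢0 q with pending {σ} c P c≡ ≢0
      ... | h , l , r≡ , _ with () ← trans (sym r≡) q

    round-step : ∀ {x rem₀ rest σ ψ} → Static σ → σ .vars 10 ≡ + toℕ x → OnTrail x rem₀ rest σ ψ → σ .arrays 11
        (σ .vars 6) ≢ 0ℤ →
      ∃[ χ ] ψ ≡ suc χ × Run roundStep σ χ (OnTrail x rem₀ rest)
    round-step {x} {rem₀} {rest} {σ} {ψ} st x≡ I ≢0 with pending {σ} (I .OnTrail.cur) (I .OnTrail.pointers)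
        (I .OnTrail.cur≡) ≢0
    ... | h , l , r≡ , a≡ = 2 + (sizeOf (rem [ cur ↦ l ]) * 3 + rest) , trans credit
        (cong (λ z → z * 3 + rest) (sizeOf-tail rem cur r≡)) ,
      run-seq (run-load cur st pointers cur≡ r≡) after-load
      where
      open OnTrail I
      after-load : ∀ τ χ → Same load σ τ → Loaded h τ × χ ≡ 1 + (sizeOf (rem [ cur ↦ l ]) * 3 + rest) → Run _ τ χ
          (OnTrail x rem₀ rest)
      after-load τ .(1 + (sizeOf (rem [ cur ↦ l ]) * 3 + rest)) sm (L , refl) =
        run-straight (advance ⨾ turn ⨾ ifte (arr 11 (var 6)) skip (assign 6 (var 10))) (cross , stay)
        where
        open Loaded L
        υ = setArr 11 (τ .vars 6) (τ .arrays 3 (τ .vars 7)) τ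
        stτ : Static τ
        stτ = static-same sm st
        c≡ : τ .vars 6 ≡ + toℕ cur
        c≡ = trans (sm .sameVar 6) cur≡
        x≡τ : τ .vars 10 ≡ + toℕ x
        x≡τ = trans (sm .sameVar 10) x≡
        Uτ : τ .arrays 13 ≈ U
        Uτ e = trans (sm .sameArr 13 _) (U≈ e)
        Kτ : τ .arrays 15 ≈ K
        Kτ e = trans (sm .sameArr 15 _) (K≈ e)
        Pυ : Pointers (υ .arrays 11) (rem [ cur ↦ l ])
        Pυ = pointers-advance cur stτ (pointers-cong (sm .sameArr 11) pointers) c≡ r≡ ptr≡
        U-at : τ .arrays 13 (τ .vars 9) ≡ U (edge h)
        U-at = trans (cong (τ .arrays 13) idx≡) (Uτ (edge h))
        sh = shrink {rem₀} {rem} r≡ shrinks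
        cross : τ .arrays 13 (τ .vars 9) ≢ 0ℤ → _
        cross U≢0 = go-home {x} {rem₀} {rest} {U = U [ edge h ↦ 0ℤ ]} {K = K [ edge h ↦ K (edge h) ℤ.+ carry h ]} x≡τ
            to≡ (write-≈ {f = τ .arrays 13} (edge h) Uτ idx≡ refl)
          (write-≈ {f = τ .arrays 15} (edge h) Kτ idx≡ (cong₂ ℤ._+_ (trans (cong (τ .arrays 15) idx≡) (Kτ (edge h)))
            (trans (cong (λ z → if does (z ℤ.≤? 0ℤ) then 1ℤ else 0ℤ) sgn≡) (carry≡ h))))
          Pυ (trail-cross trail r≡ a≡ (λ z → U≢0 (trans U-at z))) sh refl
        stay : τ .arrays 13 (τ .vars 9) ≡ 0ℤ → _
        stay U≡0 = go-home {x} {rem₀} {rest} x≡τ c≡ Uτ Kτ Pυ (trail-skip trail r≡ (trans (sym U-at) U≡0)) sh refl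

    record Between (x : Node) (rem₀ : Node → List Half) (rest : ℕ) (σ : State) (ψ : ℕ) : Set where
      field
        {U K}    : Edge → ℤ
        {rem}    : Node → List Half
        U≈       : σ .arrays 13 ≈ U
        K≈       : σ .arrays 15 ≈ K
        pointers : Pointers (σ .arrays 11) rem
        trail    : Trail x x U K rem
        cleared  : rem x ≡ []
        shrinks  : ∀ v → rem₀ v ≡ [] → rem v ≡ []
        credit   : ψ ≡ sizeOf rem * 3 + rest

    run-from : ∀ {x σ U K rem rest} → Static σ → σ .vars 10 ≡ + toℕ x → σ .arrays 13 ≈ U → σ .arrays 15 ≈ K →
      Pointers (σ .arrays 11) rem → Trail x x U K rem → Run roundFrom σ (2 + (sizeOf rem * 3 + rest))
          (Between x rem rest)
    run-from {x} {σ} {rem = rem} {rest} st x≡ U≈ K≈ P tr =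
      run-seq {P = λ τ ψ → OnTrail x rem rest τ (sizeOf rem * 3 + rest) × ψ ≡ suc (sizeOf rem * 3 + rest)}
        (run-straight (assign 6 (var 10)) (record { cur≡ = x≡ ; U≈ = U≈ ; K≈ = K≈ ; pointers = P ; trail = tr ;
            home = λ _ → refl ; shrinks = λ _ q → q ; credit = refl } , refl))
        λ { τ .(suc (sizeOf rem * 3 + rest)) sm (I , refl) → run-mono
          (run-while (OnTrail x rem rest) I λ {υ} sm′ J ≢0 →
            round-step (static-same sm′ (static-same sm st)) (trans (sm′ .sameVar 10) (trans (sm .sameVar 10) x≡)) J
                ≢0)
          λ { υ ω _ (_ , J , ≡0) → finish υ J ≡0 } }
      where
      finish : ∀ υ {ω} (J : OnTrail x rem rest υ ω) → υ .arrays 11 (υ .vars 6) ≡ 0ℤ → Between x rem rest υ ω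
      finish υ J ≡0 with exhausted {υ} (J .OnTrail.cur) (J .OnTrail.pointers) (J .OnTrail.cur≡) ≡0
      ... | r≡ with J .OnTrail.home r≡
      ... | refl = record { OnTrail J ; cleared = r≡ }

    half : ℤ → ℤ
    half w = divℤ w (+ 2)

    -- Division leaves a non-negative remainder also for negative `w`, so the residue is never -1
    -- and every odd edge starts rounded down.
    half-parity : ∀ w → w ℤ.- + 2 ℤ.* half w ≡ 0ℤ ⊎ w ℤ.- + 2 ℤ.* half w ≡ 1ℤ
    half-parity w with w ℤ.% + 2 | n%d<d w (+ 2) | a≡a%n+[a/n]*n w (+ 2)
    ... | 0 | _ | q = inj₁ (trans (cong (ℤ._- + 2 ℤ.* half w) q) (lemma (half w)))
      where
      lemma : ∀ k → 0ℤ ℤ.+ k ℤ.* + 2 ℤ.- + 2 ℤ.* k ≡ 0ℤ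
      lemma = ℤRing.solve-∀
    ... | 1 | _ | q = inj₂ (trans (cong (ℤ._- + 2 ℤ.* half w) q) (lemma (half w)))
      where
      lemma : ∀ k → 1ℤ ℤ.+ k ℤ.* + 2 ℤ.- + 2 ℤ.* k ≡ 1ℤ
      lemma = ℤRing.solve-∀
    ... | suc (suc _) | s≤s (s≤s ()) | _

    trail-begin : Trail s s (λ e → W e ℤ.- + 2 ℤ.* half (W e)) (half ∘ W) inc
    trail-begin = record
      { parity = parity′
      ; live = λ h _ → complete h
      ; balance = λ {v} _ → trans (∂Q v) (sym (ℤ.+-inverseʳ (δ s v)))
      ; value = ℤ.≤-reflexive (trans (∂Q s) (sym (ℤ.+-inverseʳ (δ s s))))
      ; mode-s = inj₁ refl
      ; mode-t = inj₁ refl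
      }
      where
      U₀ K₀ : Edge → ℤ
      U₀ e = W e ℤ.- + 2 ℤ.* half (W e)
      K₀ = half ∘ W
      cancel : ∀ w k → w ℤ.- (w ℤ.- + 2 ℤ.* k) ℤ.- + 2 ℤ.* k ≡ 0ℤ
      cancel = ℤRing.solve-∀
      ∂Q : ∀ v → ∂ (Q U₀ K₀) v ≡ 0ℤ
      ∂Q v = trans (∂-cong (λ e → cancel (W e) (half (W e))) v) (∂-0 v)
      negate : ∀ w k → + 2 ℤ.* k ℤ.- w ≡ ℤ.- (w ℤ.- + 2 ℤ.* k)
      negate = ℤRing.solve-∀
      restore : ∀ w k → w ≡ w ℤ.- + 2 ℤ.* k ℤ.+ + 2 ℤ.* k
      restore = ℤRing.solve-∀
      parity′ : ∀ e → Parity U₀ K₀ e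
      parity′ e with half-parity (W e)
      ... | inj₁ q = settled q (subst (ℤ.-1ℤ ℤ.≤_) (sym r) ℤ.-≤+) (subst (ℤ._≤ 1ℤ) (sym r) (+≤+ z≤n))
        where
        r : + 2 ℤ.* half (W e) ℤ.- W e ≡ 0ℤ
        r = trans (negate (W e) (half (W e))) (cong ℤ.-_ q)
      ... | inj₂ q = odd q (trans (restore (W e) (half (W e))) (cong (ℤ._+ + 2 ℤ.* half (W e)) q))

    -- The term `sizeOf inc * 3` occurs once for all trails together, because the lists are not
    -- rewound between starting nodes.
    roundBudget : ℕ → ℕ
    roundBudget rest = 2 + (n * 3 + (2 + (m * 3 + (2 +
        (m * 3 + (3 + (sizeOf inc * 3 + (3 + (2 + (n * 5 + rest))))))))))

    record Sweep (rest i : ℕ) (σ : State) (ψ : ℕ) : Set where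
      field
        {x}       : Node
        {U K}     : Edge → ℤ
        {rem}     : Node → List Half
        {left}    : ℕ
        U≈        : σ .arrays 13 ≈ U
        K≈        : σ .arrays 15 ≈ K
        pointers  : Pointers (σ .arrays 11) rem
        trail     : Trail x x U K rem
        cleared-s : rem s ≡ []
        cleared-t : rem t ≡ []
        cleared   : ∀ v → toℕ v < i → rem v ≡ []
        i+left    : i + left ≡ n
        credit    : ψ ≡ sizeOf rem * 3 + (left * 5 + rest)

    mode-s-cleared : ∀ (rem : Node → List Half) y → rem s ≡ [] → y ≡ s ⊎ (rem s ≡ [] × y ≢ s)
    mode-s-cleared rem y q with y Fin.≟ s
    ... | yes r = inj₁ r
    ... | no r  = inj₂ (q , r)

    mode-t-cleared : ∀ (rem : Node → List Half) y → rem t ≡ [] → y ≡ s ⊎ y ≡ t ⊎ (rem t ≡ [] × y ≢ t)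
    mode-t-cleared rem y q with y Fin.≟ t
    ... | yes r = inj₂ (inj₁ r)
    ... | no r  = inj₂ (inj₂ (q , r))

    later : ∀ a b c → a + (b + c) ≡ b + (a + c)
    later = ℕRing.solve-∀

    run-sweep : ∀ {x σ U K rem rest} → Static σ → σ .arrays 13 ≈ U → σ .arrays 15 ≈ K → Pointers (σ .arrays 11) rem →
      Trail x x U K rem → rem s ≡ [] → rem t ≡ [] →
      Run (for 16 0 (assign 10 (var 16) ⨾ roundFrom)) σ (2 + (sizeOf rem * 3 + (n * 5 + rest))) (Sweep rest n)
    run-sweep {x} {σ} {rem = rem} {rest} st U≈ K≈ P tr rs rt = run-for {N = n} (Sweep rest) (st .n≡)
      (λ z → record { U≈ = U≈ ; K≈ = K≈ ; pointers = P ; trail = tr ; cleared-s = rs ; cleared-t = rt ; cleared = λ _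
          () ; i+left = refl ; credit = refl })
      step
      where
      step : ∀ (i : Fin n) {τ ψ} → Same (for 16 0 (assign 10 (var 16) ⨾ roundFrom)) σ τ → τ .vars 16 ≡ + toℕ i →
          Sweep rest (toℕ i) τ ψ →
        ∃[ χ ] ψ ≡ 2 + χ × Run (assign 10 (var 16) ⨾ roundFrom) τ (suc χ)
          (λ υ ω → ∃[ ω′ ] ω ≡ suc ω′ × ∀ z → Sweep rest (suc (toℕ i)) (setVar 16 z υ) ω′)
      step i {τ} sm 16≡ J with J .Sweep.left in l≡
      ... | zero = ⊥-elim (ℕ.<⇒≢ (toℕ<n i) (trans (sym (ℕ.+-identityʳ _))
          (trans (cong (toℕ i ℕ.+_) (sym l≡)) (J .Sweep.i+left))))
      -- Five credits per starting node: the loop test, the increment, the assignment of the start,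
      -- and two for `roundFrom`.
      ... | suc l = 2 + (sizeOf (J .Sweep.rem) * 3 + suc (l * 5 + rest)) ,
        trans (J .Sweep.credit) (trans (cong (λ l → sizeOf (J .Sweep.rem) * 3 + (l * 5 + rest)) l≡)
            (later (sizeOf (J .Sweep.rem) * 3) 4 (suc (l * 5 + rest)))) ,
        run-seq {P = λ υ ω → υ ≡ setVar 10 (τ .vars 16) τ × ω ≡ 2 + (sizeOf (J .Sweep.rem) * 3 + suc (l * 5 + rest))}
          (run-straight (assign 10 (var 16)) (refl , refl))
          λ { υ ω sm′ (refl , refl) → run-mono
            (run-from (static-same sm′ (static-same sm st)) 16≡ (J .Sweep.U≈) (J .Sweep.K≈) (J .Sweep.pointers)
              (trail-restart (J .Sweep.trail) (mode-s-cleared (J .Sweep.rem) i (J .Sweep.cleared-s))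
                  (mode-t-cleared (J .Sweep.rem) i (J .Sweep.cleared-t))))
            λ υ ω _ B → sizeOf (B .Between.rem) * 3 + (l * 5 + rest) ,
              trans (B .Between.credit) (ℕ.+-suc _ _) ,
              λ z → record
                { U≈ = B .Between.U≈ ; K≈ = B .Between.K≈ ; pointers = B .Between.pointers ; trail = B .Between.trail
                ; cleared-s = B .Between.shrinks s (J .Sweep.cleared-s)
                ; cleared-t = B .Between.shrinks t (J .Sweep.cleared-t)
                ; cleared = λ v v≤i → extend B v v≤i
                ; i+left = trans (sym (ℕ.+-suc (toℕ i) l)) (trans (cong (toℕ i ℕ.+_) (sym l≡)) (J .Sweep.i+left))
                ; credit = refl } }
        where
        extend : ∀ {rest′ υ ω} (B : Between i (J .Sweep.rem) rest′ υ ω) → ∀ v → toℕ v < suc (toℕ i) → B .Between.rem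
            v ≡ []
        extend B v v≤i with v Fin.≟ i
        ... | yes refl = B .Between.cleared
        ... | no v≢i   = B .Between.shrinks v (J .Sweep.cleared v (ℕ.≤∧≢⇒< (ℕ.≤-pred v≤i) (v≢i ∘ toℕ-injective)))

    record Rounded (rest : ℕ) (σ : State) (ψ : ℕ) : Set where
      field
        {K}    : Edge → ℤ
        K≈     : σ .arrays 15 ≈ K
        rounds : Rounds W K
        value  : ∂ W s ℤ.≤ + 2 ℤ.* ∂ K s
        credit : ψ ≡ rest

    run-round : ∀ {σ rest} → Static σ → σ .arrays 18 ≈ W → Run round σ (roundBudget rest) (Rounded rest)
    run-round {σ} {rest} st W≈ =
      run-seq (run-reset st) λ { σ₁ _ sm₁ (P , refl) →
      let st₁ = static-same sm₁ st
          W₁ : σ₁ .arrays 18 ≈ W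
          W₁ e = trans (sm₁ .sameArr 18 _) (W≈ e) in
      run-seq (run-fill {N = m} (half ∘ W) (st₁ .m≡) λ {τ} sm e 5≡ →
        cong (λ z → divℤ z (+ 2)) (trans (cong (τ .arrays 18) 5≡) (trans (sm .sameArr 18 _) (W₁ e)))) λ
            { σ₂ _ sm₂ (K≈ , refl) →
      let st₂ = static-same sm₂ st₁ in
      run-seq (run-fill {N = m} (λ e → W e ℤ.- + 2 ℤ.* half (W e)) (st₂ .m≡) λ {τ} sm e 5≡ →
        cong₂ (λ w k → w ℤ.- + 2 ℤ.* k)
          (trans (cong (τ .arrays 18) 5≡) (trans (sm .sameArr 18 _) (trans (sm₂ .sameArr 18 _) (W₁ e))))
          (trans (cong (τ .arrays 15) 5≡) (trans (sm .sameArr 15 _) (K≈ e)))) λ { σ₃ _ sm₃ (U≈ , refl) →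
      let st₃ = static-same sm₃ st₂
          P₃ = pointers-cong (λ j → trans (sm₃ .sameArr 11 j) (sm₂ .sameArr 11 j)) P in
      run-seq {P = λ τ ψ → τ ≡ setVar 10 (σ₃ .vars 2) σ₃ × ψ ≡ 2 + (sizeOf inc * 3 + (3 + (2 + (n * 5 + rest))))}
        (run-straight (assign 10 (var 2)) (refl , refl)) λ { σ₄ _ sm₄ (refl , refl) →
      let st₄ = static-same sm₄ st₃ in
      run-seq (run-from {x = s} st₄ (st₃ .s≡) U≈ (λ e → trans (sm₃ .sameArr 15 _) (K≈ e)) P₃ trail-begin) λ
          { σ₅ φ₅ sm₅ B →
      let module B = Between B
          st₅ = static-same sm₅ st₄ in
      subst (λ φ → Run _ σ₅ φ (Rounded rest)) (sym (trans B.credit (later (sizeOf B.rem * 3) 3 (2 + (n * 5 + rest)))))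
      (run-seq {P = λ τ ψ → τ ≡ setVar 10 (σ₅ .vars 3) σ₅ × ψ ≡ 2 + (sizeOf B.rem * 3 + (2 + (n * 5 + rest)))}
        (run-straight (assign 10 (var 3)) (refl , refl)) λ { σ₆ _ sm₆ (refl , refl) →
      let st₆ = static-same sm₆ st₅ in
      run-seq (run-from {x = t} st₆ (st₅ .t≡) B.U≈ B.K≈ B.pointers
          (trail-restart B.trail (mode-s-cleared B.rem t B.cleared) (inj₂ (inj₁ refl)))) λ { σ₇ φ₇ sm₇ B′ →
      let module B′ = Between B′
          st₇ = static-same sm₇ st₆ in
      subst (λ φ → Run _ σ₇ φ (Rounded rest)) (sym (trans B′.credit (later (sizeOf B′.rem * 3) 2 (n * 5 + rest))))
      (run-mono (run-sweep st₇ B′.U≈ B′.K≈ B′.pointers B′.trail (B′.shrinks s B.cleared) B′.cleared) λ τ ψ _ →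
          finish) }}) }}}}}
      where
      finish : ∀ {τ ψ} → Sweep rest n τ ψ → Rounded rest τ ψ
      finish J = record
        { K≈ = J .Sweep.K≈ ; rounds = proj₁ done ; value = proj₂ done
        ; credit = trans (J .Sweep.credit) (cong₂ (λ a b → a * 3 + (b * 5 + rest)) empty
            (ℕ.+-cancelˡ-≡ n _ 0 (trans (J .Sweep.i+left) (sym (ℕ.+-identityʳ n))))) }
        where
        all-cleared : ∀ v → J .Sweep.rem v ≡ []
        all-cleared v = J .Sweep.cleared v (toℕ<n v)
        done = trail-done (J .Sweep.trail) all-cleared
        empty : sizeOf (J .Sweep.rem) ≡ 0
        empty = trans (∑ℕ-cong λ v → cong length (all-cleared v)) (trans (∑ℕ-const n 0) (ℕ.*-zeroʳ n))

-- Pieces of the output.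

Segment : (ℤ → ℤ) → ℕ → List ℤ → Set
Segment f b zs = ∀ i → i < length zs → f (+ (b + i)) ≡ entry zs i

segment-write : ∀ f {b} zs {j k v} → Segment f b zs → j ≡ + k → (∀ i → i < length zs → k ≢ b + i) → Segment
    (write j v f) b zs
segment-write f zs {v = v} h refl out i i< = trans (write-miss {v = v} f (λ q → out i i< (ℤ.+-injective q))) (h i i<)

entry-++ˡ : ∀ xs ys {i} → i < length xs → entry (xs ++ ys) i ≡ entry xs i
entry-++ˡ (x ∷ xs) ys {zero}  _       = refl
entry-++ˡ (x ∷ xs) ys {suc i} (s≤s h) = entry-++ˡ xs ys h

entry-++ʳ : ∀ xs ys i → entry (xs ++ ys) (length xs + i) ≡ entry ys i
entry-++ʳ []       ys i = refl
entry-++ʳ (x ∷ xs) ys i = entry-++ʳ xs ys i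

segment-++ : ∀ {f b xs ys} → Segment f b xs → Segment f (b + length xs) ys → Segment f b (xs ++ ys)
segment-++ {f} {b} {xs} {ys} hx hy i i< with i ℕ.<? length xs
... | yes i<x = trans (hx i i<x) (sym (entry-++ˡ xs ys i<x))
... | no i≮x  = subst (λ i → f (+ (b + i)) ≡ entry (xs ++ ys) i) i≡
    (trans (cong (f ∘ +_) (sym (ℕ.+-assoc b (length xs) j)))
      (trans (hy j (ℕ.+-cancelˡ-< (length xs) j (length ys) (subst₂ _<_ (sym i≡) (length-++ xs) i<)))
          (sym (entry-++ʳ xs ys j))))
  where
  j = i ∸ length xs
  i≡ : length xs + j ≡ i
  i≡ = ℕ.m+[n∸m]≡n (ℕ.≮⇒≥ i≮x)

segment-[] : ∀ {f b} → Segment f b []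
segment-[] i ()

-- Splitting a non-negative flow into paths.

module Extraction (G : STDAG) where
  open Network G
  open Cuts G
  open Layout G

  -- While a path is under way, `A` is a flow of value `r - 1` from `s` together with one unit from
  -- `cur` to `t`; this is what `balance` says. An edge is passed over only when it is empty, and
  -- `A` never increases, so `live` persists without rescanning. `progress` excludes a started path
  -- with `r = 0`.
  record Extract (A₀ : Edge → ℤ) (r₀ : ℕ) (cur : Node) (A : Edge → ℤ) (rem : Node → List Half) (r : ℕ)
      (Ps : List STPath) (P : Walk s cur) : Set where
    field
      A≥0      : ∀ e → 0ℤ ℤ.≤ A e
      live     : ∀ e → 0ℤ ℤ.< A e → out e ∈ rem (tail e)
      balance  : ∀ {v} → v ≢ t → ∂ A v ≡ (1ℤ ℤ.- + r) ℤ.* δ s v ℤ.- δ cur v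
      split    : ∀ e → A₀ e ≡ A e ℤ.+ walkFlow P e ℤ.+ pathSum Ps e
      count    : length Ps + r ≡ r₀
      progress : edges P ≡ [] ⊎ 1 ≤ r

  open Extract public

  at-s : ∀ r → (1ℤ ℤ.- + r) ℤ.* δ s s ℤ.- δ s s ≡ ℤ.- (+ r)
  at-s r = trans (cong (λ d → (1ℤ ℤ.- + r) ℤ.* d ℤ.- d) (δ-refl s)) (lemma (+ r))
    where
    lemma : ∀ r → (1ℤ ℤ.- r) ℤ.* 1ℤ ℤ.- 1ℤ ≡ ℤ.- r
    lemma = ℤRing.solve-∀

  off-s : ∀ r {v} → v ≢ s → (1ℤ ℤ.- + r) ℤ.* δ s v ≡ 0ℤ
  off-s r {v} v≢s = trans (cong ((1ℤ ℤ.- + r) ℤ.*_) (δ-≢ (v≢s ∘ sym))) (ℤ.*-zeroʳ (1ℤ ℤ.- + r))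

  extract-begin : ∀ {A₀ r₀} → (∀ e → 0ℤ ℤ.≤ A₀ e) → Conserved A₀ → ∂ A₀ s ≡ ℤ.- (+ r₀) →
    {rem : Node → List Half} → (∀ h → h ∈ rem (at h)) → Extract A₀ r₀ s A₀ rem r₀ [] []
  extract-begin {A₀} {r₀} A≥0 cA val complete = record
    { A≥0 = A≥0 ; live = λ e _ → complete (out e) ; balance = bal ; split = λ e → lemma (A₀ e) ; count = refl ;
        progress = inj₁ refl }
    where
    lemma : ∀ a → a ≡ a ℤ.+ 0ℤ ℤ.+ 0ℤ
    lemma = ℤRing.solve-∀
    bal : ∀ {v} → v ≢ t → ∂ A₀ v ≡ (1ℤ ℤ.- + r₀) ℤ.* δ s v ℤ.- δ s v
    bal {v} v≢t with v Fin.≟ s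
    ... | yes refl = trans val (sym (at-s r₀))
    ... | no v≢s   = trans (cA (v≢s , v≢t)) (sym (cong₂ ℤ._-_ (off-s r₀ v≢s) (δ-≢ (v≢s ∘ sym))))

  empty-walk : ∀ {v} (P : Walk s v) → edges P ≡ [] → v ≡ s
  empty-walk [] _ = refl

  closed-walk : ∀ {v} (P : Walk v v) → edges P ≡ []
  closed-walk []      = refl
  closed-walk (e ∷ p) = ⊥-elim (acyclic e p)

  idle-conserved : ∀ {A₀ r₀ A rem r Ps} {P : Walk s s} → Extract A₀ r₀ s A rem r Ps P → Conserved A
  idle-conserved {r = r} X (v≢s , v≢t) = trans (X .balance v≢t) (cong₂ ℤ._-_ (off-s r v≢s) (δ-≢ (v≢s ∘ sym)))

  -- With `r = 0` the current walk is empty, hence `A` is a conserved flow of value 0, and such a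
  -- flow has no positive edge.
  remaining : ∀ {A₀ r₀ cur A rem r Ps} {P : Walk s cur} e → Extract A₀ r₀ cur A rem r Ps P → 0ℤ ℤ.< A e → 1 ≤ r
  remaining {r = suc r} e X Ae>0 = s≤s z≤n
  remaining {r = zero} {P = P} e X Ae>0 with X .progress
  ... | inj₂ ()
  ... | inj₁ q with empty-walk P q
  ... | refl = ⊥-elim (ℤ.<-irrefl (sym (no-value⇒zero (X .A≥0) (idle-conserved X)
      (ℤ.≤-reflexive (sym (trans (X .balance (s≢t e)) (at-s 0)))) e)) Ae>0)

  extract-skip : ∀ {A₀ r₀ cur A rem r Ps h l} {P : Walk s cur} → Extract A₀ r₀ cur A rem r Ps P → rem cur ≡ h ∷ l →
    (∀ e → h ≡ out e → ¬ 0ℤ ℤ.< A e) → Extract A₀ r₀ cur A (rem [ cur ↦ l ]) r Ps P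
  extract-skip {cur = cur} {A} {rem} {l = l} X r≡ useless = record
    { A≥0 = X .A≥0 ; live = live′ ; balance = X .balance ; split = X .split ; count = X .count ; progress = X
        .progress }
    where
    live′ : ∀ e → 0ℤ ℤ.< A e → out e ∈ (rem [ cur ↦ l ]) (tail e)
    live′ e Ae>0 with cur Fin.≟ tail e
    ... | no _ = X .live e Ae>0
    ... | yes refl with subst (out e ∈_) r≡ (X .live e Ae>0)
    ...   | here q  = ⊥-elim (useless e (sym q) Ae>0)
    ...   | there i = i

  extract-cross : ∀ {A₀ r₀ A rem r Ps} e {P : Walk s (tail e)} → Extract A₀ r₀ (tail e) A rem r Ps P → 0ℤ ℤ.< A e →
    Extract A₀ r₀ (head e) (A [ e ↦ A e ℤ.- 1ℤ ]) rem r Ps (snoc e P)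
  extract-cross {A₀} {A = A} {rem} {r} {Ps} e {P} X Ae>0 = record
    { A≥0 = A′≥0
    ; live = λ f A′f>0 → X .live f (ℤ.<-≤-trans A′f>0 (A′≤A f))
    ; balance = λ {v} v≢t → begin
        ∂ (A [ e ↦ A e ℤ.- 1ℤ ]) v                                                 ≡⟨ ∂-[↦] A e (A e ℤ.- 1ℤ) v ⟩
        ∂ A v ℤ.+ (A e ℤ.- 1ℤ ℤ.- A e) ℤ.* (δ (head e) v ℤ.- δ (tail e) v)         ≡⟨ cong
            (ℤ._+ (A e ℤ.- 1ℤ ℤ.- A e) ℤ.* (δ (head e) v ℤ.- δ (tail e) v)) (X .balance v≢t) ⟩
        (1ℤ ℤ.- + r) ℤ.* δ s v ℤ.- δ (tail e) v ℤ.+ (A e ℤ.- 1ℤ ℤ.- A e) ℤ.* (δ (head e) v ℤ.- δ (tail e) v)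
          ≡⟨ move ((1ℤ ℤ.- + r) ℤ.* δ s v) (A e) (δ (head e) v) (δ (tail e) v) ⟩
        (1ℤ ℤ.- + r) ℤ.* δ s v ℤ.- δ (head e) v                                    ∎
    ; split = λ f → trans (X .split f) (begin
        A f ℤ.+ walkFlow P f ℤ.+ pathSum Ps f
          ≡⟨ swap (A f) (A e) (δ e f) (walkFlow P f) (pathSum Ps f) ⟩
        A f ℤ.+ (A e ℤ.- 1ℤ ℤ.- A e) ℤ.* δ e f ℤ.+ (walkFlow P f ℤ.+ (δ e f ℤ.+ 0ℤ)) ℤ.+ pathSum Ps f
          ≡⟨ cong₂ (λ a p → a ℤ.+ p ℤ.+ pathSum Ps f) ([↦]-δ A e (A e ℤ.- 1ℤ) f) (walkFlow-⁀ P (e ∷ []) f) ⟨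
        (A [ e ↦ A e ℤ.- 1ℤ ]) f ℤ.+ walkFlow (snoc e P) f ℤ.+ pathSum Ps f ∎)
    ; count = X .count
    ; progress = inj₂ (remaining e X Ae>0)
    }
    where
    open ≡-Reasoning
    move : ∀ c a h u → c ℤ.- u ℤ.+ (a ℤ.- 1ℤ ℤ.- a) ℤ.* (h ℤ.- u) ≡ c ℤ.- h
    move = ℤRing.solve-∀
    swap : ∀ x a d p q → x ℤ.+ p ℤ.+ q ≡ x ℤ.+ (a ℤ.- 1ℤ ℤ.- a) ℤ.* d ℤ.+ (p ℤ.+ (d ℤ.+ 0ℤ)) ℤ.+ q
    swap = ℤRing.solve-∀
    A′≥0 : ∀ f → 0ℤ ℤ.≤ (A [ e ↦ A e ℤ.- 1ℤ ]) f
    A′≥0 f with e Fin.≟ f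
    ... | yes refl = ℤ.i≤j⇒0≤j-i (ℤ.i<j⇒suc[i]≤j Ae>0)
    ... | no _     = X .A≥0 f
    A′≤A : ∀ f → (A [ e ↦ A e ℤ.- 1ℤ ]) f ℤ.≤ A f
    A′≤A f with e Fin.≟ f
    ... | yes refl = ℤ.i-j≤i (A e) 1ℤ
    ... | no _     = ℤ.≤-refl

  extract-finish : ∀ {A₀ r₀ A rem r Ps} {P : Walk s t} → Extract A₀ r₀ t A rem (suc r) Ps P → Extract A₀ r₀ s A rem r
      (Ps ++ [ P ]) []
  extract-finish {A₀} {A = A} {r = r} {Ps} {P} X = record
    { A≥0 = X .A≥0
    ; live = X .live
    ; balance = λ {v} v≢t → trans (X .balance v≢t) (trans
        (cong (λ d → (1ℤ ℤ.- + suc r) ℤ.* δ s v ℤ.- d) (δ-≢ (v≢t ∘ sym))) (step (+ r) (δ s v)))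
    ; split = λ e → trans (X .split e) (trans (regroup (A e) (walkFlow P e) (pathSum Ps e))
        (cong (λ p → A e ℤ.+ 0ℤ ℤ.+ p) (sym (pathSum-++ Ps [ P ] e))))
    ; count = trans (cong (_+ r) (length-++ Ps)) (trans (ℕ.+-assoc (length Ps) 1 r) (X .count))
    ; progress = inj₁ refl
    }
    where
    step : ∀ r d → (1ℤ ℤ.- (1ℤ ℤ.+ r)) ℤ.* d ℤ.- 0ℤ ≡ (1ℤ ℤ.- r) ℤ.* d ℤ.- d
    step = ℤRing.solve-∀
    regroup : ∀ a p q → a ℤ.+ p ℤ.+ q ≡ a ℤ.+ 0ℤ ℤ.+ (q ℤ.+ (p ℤ.+ 0ℤ))
    regroup = ℤRing.solve-∀

  -- Nothing leaves `cur`, so its net inflow is non-negative. By `balance` it is -1 away from `s`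
  -- and `- r` at `s`; the scan can run dry only at `s`, with all paths produced and no flow left.
  extract-done : ∀ {A₀ r₀ cur A rem r Ps} {P : Walk s cur} → Extract A₀ r₀ cur A rem r Ps P → cur ≢ t → rem cur ≡ [] →
    (∀ e → A₀ e ≡ pathSum Ps e) × length Ps ≡ r₀
  extract-done {cur = cur} {A} {rem} {r} {Ps} {P} X c≢t r≡ with no-outflow (X .A≥0) dry
    where
    dry : ∀ e → tail e ≡ cur → A e ≡ 0ℤ
    dry e refl = ℤ.≤-antisym (ℤ.≮⇒≥ λ Ae>0 → contra (subst (out e ∈_) r≡ (X .live e Ae>0))) (X .A≥0 e)
      where
      contra : out e ∉ []
      contra ()
  ... | ∂≥0 with cur Fin.≟ s
  ...   | no c≢s with subst (0ℤ ℤ.≤_) (trans (X .balance c≢t) (cong₂ ℤ._-_ (off-s r c≢s) (δ-refl cur))) ∂≥0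
  ...     | ()
  extract-done {A = A} {rem} {r} {Ps} {P} X c≢t r≡ | ∂≥0 | yes refl with none-left r
      (subst (0ℤ ℤ.≤_) (trans (X .balance c≢t) (at-s r)) ∂≥0)
    where
    none-left : ∀ r → 0ℤ ℤ.≤ ℤ.- (+ r) → r ≡ 0
    none-left zero    _ = refl
    none-left (suc r) ()
  ... | refl = (λ e → trans (X .split e) (trans (cong₂ (λ a p → a ℤ.+ p ℤ.+ pathSum Ps e)
      (no-value⇒zero (X .A≥0) (idle-conserved X) ∂≥0 e) (flow0 e)) (ℤ.+-identityˡ (pathSum Ps e))))
                 , trans (sym (ℕ.+-identityʳ _)) (X .count)
    where
    flow0 : ∀ e → walkFlow P e ≡ 0ℤ
    flow0 e = walkFlow-∉ P (λ e∈ → none (subst (e ∈_) (closed-walk P) e∈))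
      where
      none : e ∉ []
      none ()

-- The splitting program and its output.

module ExtractionProgram (G : STDAG) where
  open Network G
  open Cuts G
  open Layout G
  open Extraction G

  item : ℤ → STPath → List ℤ
  item w P = w ∷ + length (edges P) ∷ map (index G) (edges P)

  opaque
    -- Everything after the leading count, which changes with each path and is therefore kept apart.
    payload : WeightedPaths G → List ℤ
    payload D = List.drop 1 (encodeOutput G D)

    payload-[] : payload [] ≡ []
    payload-[] = refl

    payload-∷ʳ : ∀ D w P → payload (D ++ [ w , P ]) ≡ payload D ++ item w P
    payload-∷ʳ D w P = trans (concatMap-++ _ D [ w , P ]) (cong (payload D ++_) (++-identityʳ (item w P)))

    encodeOutput-payload : ∀ D → encodeOutput G D ≡ + length D ∷ payload D
    encodeOutput-payload D = refl

  record Out (D : WeightedPaths G) (σ : State) : Set where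
    field
      pos≡ : σ .vars 11 ≡ + suc (length (payload D))
      cnt≡ : σ .vars 13 ≡ + length D
      seg  : Segment (σ .arrays 1) 1 (payload D)

  module _ (adj : Adjacency) where
    open Represented adj

    module _ (A₀ : Edge → ℤ) (r₀ : ℕ) (w : ℤ) (D₀ : WeightedPaths G) (rest : ℕ) where

      done : List STPath → WeightedPaths G
      done Ps = D₀ ++ map (w ,_) Ps

      -- The reserve holds three credits for each of the at most `n` edges of each of the `r` paths
      -- to come and three for each half-edge to be passed over. The edges of the current walk are
      -- already paid for, hence their term on the right.
      record Extracting (σ : State) (ψ : ℕ) : Set where
        field
          {cur}    : Node
          {A}      : Edge → ℤ
          {rem}    : Node → List Half
          {r}      : ℕ
          {Ps}     : List STPath
          {P}      : Walk s cur
          cur≡     : σ .vars 6 ≡ + toℕ cur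
          A≈       : σ .arrays 16 ≈ A
          pointers : Pointers (σ .arrays 11) rem
          extract  : Extract A₀ r₀ cur A rem r Ps P
          cur≢t    : cur ≢ t
          len≡     : σ .vars 12 ≡ + length (edges P)
          output   : Out (done Ps) σ
          partial  : Segment (σ .arrays 1) (3 + length (payload (done Ps))) (map (index G) (edges P))
          credit   : (n * r + sizeOf rem) * 3 + rest ≤ ψ + length (edges P) * 3

      payload-done : ∀ Ps P → payload (done (Ps ++ [ P ])) ≡ payload (done Ps) ++ item w P
      payload-done Ps P = trans (cong payload (trans (cong (D₀ ++_) (map-++ (w ,_) Ps [ P ]))
          (sym (++-assoc D₀ (map (w ,_) Ps) [ w , P ]))))
        (payload-∷ʳ (done Ps) w P)

      finish-path : ∀ {σ A rem r Ps} {P : Walk s t} {ψ} → Static σ → s ≢ t → σ .vars 14 ≡ w → σ .arrays 16 ≈ A →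
          Pointers (σ .arrays 11) rem →
        Extract A₀ r₀ t A rem (suc r) Ps P → σ .vars 12 ≡ + length (edges P) → Out (done Ps) σ →
        Segment (σ .arrays 1) (3 + length (payload (done Ps))) (map (index G) (edges P)) →
        (n * suc r + sizeOf rem) * 3 + rest ≤ ψ + length (edges P) * 3 →
        wp finishPath (λ τ → Extracting τ ψ) σ
      finish-path {σ} {A} {rem} {r} {Ps} {P} {ψ} st s≢t w≡ A≈ ptrs X len≡ O part cr = record
        { cur≡ = st .s≡ ; A≈ = A≈ ; pointers = ptrs ; extract = extract-finish X ; cur≢t = s≢t ; len≡ = refl
        ; output = record
          { pos≡ = trans (cong₂ (λ p l → + 2 ℤ.+ p ℤ.+ l) pos≡ len≡) (cong +_ (cong suc (sym total)))
          ; cnt≡ = trans (cong (ℤ._+ 1ℤ) cnt≡) (cong +_ (sym length-done))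
          ; seg = subst (Segment g 1) (sym (payload-done Ps P))
              (segment-++ {g} {1} {payload (done Ps)} {item w P} old new)
          }
        ; partial = segment-[] {g} {3 + length (payload (done (Ps ++ [ P ])))}
        ; credit = paid
        }
        where
        open Out O
        B L : ℕ
        B = length (payload (done Ps))
        L = length (edges P)
        xs = map (index G) (edges P)
        f f₁ g : ℤ → ℤ
        f  = σ .arrays 1
        f₁ = write (σ .vars 11) (σ .vars 14) f
        g  = write (1ℤ ℤ.+ σ .vars 11) (σ .vars 12) f₁
        pos+1≡ : 1ℤ ℤ.+ σ .vars 11 ≡ + (2 + B)
        pos+1≡ = cong (λ p → 1ℤ ℤ.+ p) pos≡
        both : ∀ {b} zs → Segment f b zs → (∀ i → i < length zs → suc B ≢ b + i) →
            (∀ i → i < length zs → 2 + B ≢ b + i) → Segment g b zs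
        both zs sg o₁ o₂ = segment-write f₁ zs (segment-write f zs sg pos≡ o₁) pos+1≡ o₂
        old : Segment g 1 (payload (done Ps))
        old = both (payload (done Ps)) seg (λ i i< q → ℕ.<⇒≢ i< (sym (ℕ.suc-injective q)))
            (λ i i< q → ℕ.<⇒≢ (ℕ.m<n⇒m<1+n i<) (sym (ℕ.suc-injective q)))
        tail-part : Segment g (3 + B) xs
        tail-part = both xs part (λ i _ q → ℕ.m≢1+m+n B (trans (ℕ.suc-injective q) (cong suc (sym (ℕ.+-suc B i)))))
                              (λ i _ q → ℕ.m≢1+m+n B (ℕ.suc-injective (ℕ.suc-injective q)))
        new : Segment g (1 + B) (item w P)
        new zero _ = trans (cong (g ∘ +_) (ℕ.+-identityʳ (1 + B)))
            (trans (write-miss {v = σ .vars 12} f₁ (λ q → ℕ.1+n≢n (ℤ.+-injective (trans (sym pos+1≡) q))))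
          (trans (write-hit {v = σ .vars 14} f pos≡) w≡))
        new (suc zero) _ = trans (cong (g ∘ +_) (ℕ.+-comm (1 + B) 1))
            (trans (write-hit {v = σ .vars 12} f₁ pos+1≡) len≡)
        new (suc (suc i)) (s≤s (s≤s i<)) = trans (cong (g ∘ +_) (shift B i)) (tail-part i i<)
          where
          shift : ∀ b i → 1 + b + (2 + i) ≡ 3 + b + i
          shift = ℕRing.solve-∀
        total : length (payload (done (Ps ++ [ P ]))) ≡ 2 + B + L
        total = trans (cong length (payload-done Ps P))
            (trans (length-++ (payload (done Ps))) (trans (cong (λ l → B + (2 + l)) (length-map (index G) (edges P)))
            (shift B L)))
          where
          shift : ∀ b l → b + (2 + l) ≡ 2 + b + l
          shift = ℕRing.solve-∀
        length-done : length (done (Ps ++ [ P ])) ≡ length (done Ps) + 1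
        length-done = trans (cong length (trans (cong (D₀ ++_) (map-++ (w ,_) Ps [ P ]))
            (sym (++-assoc D₀ (map (w ,_) Ps) [ w , P ])))) (length-++ (done Ps))
        -- A finished path releases its reserve of `n` edges, at least as many as it has.
        paid : (n * r + sizeOf rem) * 3 + rest ≤ ψ + 0
        paid = ℕ.+-cancelʳ-≤ (L * 3) _ _ (begin
          (n * r + sizeOf rem) * 3 + rest + L * 3  ≤⟨ ℕ.+-monoʳ-≤ ((n * r + sizeOf rem) * 3 + rest)
              (ℕ.*-monoˡ-≤ 3 (ℕ.<⇒≤ (walk-short P))) ⟩
          (n * r + sizeOf rem) * 3 + rest + n * 3  ≡⟨ arith n r (sizeOf rem) rest ⟩
          (n * suc r + sizeOf rem) * 3 + rest      ≤⟨ cr ⟩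
          ψ + L * 3                                ≡⟨ cong (_+ L * 3) (ℕ.+-identityʳ ψ) ⟨
          ψ + 0 + L * 3                            ∎)
          where
          open ℕ.≤-Reasoning
          arith : ∀ n r s z → (n * r + s) * 3 + z + n * 3 ≡ (n * suc r + s) * 3 + z
          arith = ℕRing.solve-∀

      finish-at : ∀ {σ c A rem r Ps} {P : Walk s c} {ψ} → c ≡ t → Static σ → s ≢ t → σ .vars 14 ≡ w → σ .arrays 16 ≈
          A → Pointers (σ .arrays 11) rem →
        Extract A₀ r₀ c A rem r Ps P → 1 ≤ r → σ .vars 12 ≡ + length (edges P) → Out (done Ps) σ →
        Segment (σ .arrays 1) (3 + length (payload (done Ps))) (map (index G) (edges P)) →
        (n * r + sizeOf rem) * 3 + rest ≤ ψ + length (edges P) * 3 →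
        wp finishPath (λ τ → Extracting τ ψ) σ
      finish-at refl st s≢t w≡ A≈ ptrs X (s≤s z≤n) = finish-path st s≢t w≡ A≈ ptrs X

      cross-ok : ∀ {σ A rem r Ps ψ} e {P : Walk s (tail e)} → Static σ → σ .vars 14 ≡ w → σ .vars 9 ≡ + toℕ e → σ
          .vars 17 ≡ + toℕ (head e) →
        σ .arrays 16 ≈ A → Pointers (σ .arrays 11) rem → Extract A₀ r₀ (tail e) A rem r Ps P → 0ℤ ℤ.< A e →
        σ .vars 12 ≡ + length (edges P) → Out (done Ps) σ →
        Segment (σ .arrays 1) (3 + length (payload (done Ps))) (map (index G) (edges P)) →
        (n * r + sizeOf rem) * 3 + rest ≤ 3 + ψ + length (edges P) * 3 →
        wp decCross (λ τ → Extracting τ ψ) σ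
      cross-ok {σ} {A} {rem} {r} {Ps} {ψ} e {P} st w≡ idx≡ to≡ A≈ ptrs X Ae>0 len≡ O part cr = finishing , continuing
        where
        open Out O
        υ : State
        υ = setVar 6 (σ .vars 17) (setVar 12 (σ .vars 12 ℤ.+ 1ℤ)
            (setArr 1 (+ 2 ℤ.+ σ .vars 11 ℤ.+ σ .vars 12) (σ .vars 9)
              (setArr 16 (σ .vars 9) (σ .arrays 16 (σ .vars 9) ℤ.- 1ℤ) σ)))
        B L : ℕ
        B = length (payload (done Ps))
        L = length (edges P)
        xs = map (index G) (edges P)
        f g : ℤ → ℤ
        f = σ .arrays 1
        g = write (+ 2 ℤ.+ σ .vars 11 ℤ.+ σ .vars 12) (σ .vars 9) f
        -- One cell for the count, `B` for the finished paths, and two kept for the weight and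
        -- length of this path.
        slot : + 2 ℤ.+ σ .vars 11 ℤ.+ σ .vars 12 ≡ + (3 + B + L)
        slot = cong₂ (λ p l → + 2 ℤ.+ p ℤ.+ l) pos≡ len≡
        edges′ : edges (snoc e P) ≡ edges P ++ [ e ]
        edges′ = edges-⁀ P (e ∷ [])
        length′ : length (edges (snoc e P)) ≡ L + 1
        length′ = trans (cong length edges′) (length-++ (edges P))
        X′ = extract-cross e X Ae>0
        A′ = A [ e ↦ A e ℤ.- 1ℤ ]
        A′≈ : υ .arrays 16 ≈ A′
        A′≈ = write-≈ {f = σ .arrays 16} e A≈ idx≡ (cong (ℤ._- 1ℤ) (trans (cong (σ .arrays 16) idx≡) (A≈ e)))
        len′ : υ .vars 12 ≡ + length (edges (snoc e P))
        len′ = trans (cong (ℤ._+ 1ℤ) len≡) (cong +_ (sym length′))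
        out′ : Out (done Ps) υ
        out′ = record
          { pos≡ = pos≡ ; cnt≡ = cnt≡
          ; seg = segment-write f (payload (done Ps)) seg slot λ i i< q → ℕ.<⇒≢
              (ℕ.<-≤-trans i< (ℕ.≤-trans (ℕ.m≤m+n B L) (ℕ.m≤n+m (B + L) 2))) (sym (ℕ.suc-injective q)) }
        part′ : Segment (υ .arrays 1) (3 + B) (map (index G) (edges (snoc e P)))
        part′ = subst (Segment g (3 + B)) (sym (trans (cong (map (index G)) edges′)
            (map-++ (index G) (edges P) [ e ])))
          (segment-++ {g} {3 + B} {xs} {[ + toℕ e ]}
            (segment-write f xs part slot λ i i< q → ℕ.<⇒≢ i<
                (trans (sym (ℕ.+-cancelˡ-≡ (3 + B) L i q)) (sym (length-map (index G) (edges P)))))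
            last)
          where
          last : Segment g (3 + B + length xs) [ + toℕ e ]
          last zero _ = trans (write-hit {v = σ .vars 9} f
              (trans slot (cong +_ (trans (cong (3 + B ℕ.+_) (sym (length-map (index G) (edges P))))
              (sym (ℕ.+-identityʳ _)))))) idx≡
          last (suc i) (s≤s ())
        credit′ : (n * r + sizeOf rem) * 3 + rest ≤ ψ + length (edges (snoc e P)) * 3
        credit′ = ℕ.≤-trans cr (ℕ.≤-reflexive (trans (arith ψ L) (cong (λ l → ψ + l * 3) (sym length′))))
          where
          arith : ∀ a l → 3 + a + l * 3 ≡ a + (l + 1) * 3
          arith = ℕRing.solve-∀
        finishing : ⟦ op eq (var 6) (var 3) ⟧ υ ≢ 0ℤ → wp finishPath (λ τ → Extracting τ ψ) υ
        finishing ≢0 = finish-at {c = head e} (+toℕ-injective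
            (trans (sym to≡) (trans (boolℤ≢0 (_ ℤ.≟ _) ≢0) (st .t≡))))
          (record { Static st }) (s≢t e) w≡ A′≈ ptrs X′ (remaining e X Ae>0) len′ out′ part′ credit′
        continuing : ⟦ op eq (var 6) (var 3) ⟧ υ ≡ 0ℤ → Extracting υ ψ
        continuing ≡0 = record
          { cur≡ = to≡ ; A≈ = A′≈ ; pointers = ptrs ; extract = X′
          ; cur≢t = λ q → boolℤ≡0 (_ ℤ.≟ _) ≡0 (trans to≡ (trans (cong (+_ ∘ toℕ) q) (sym (st .t≡))))
          ; len≡ = len′ ; output = out′ ; partial = part′ ; credit = credit′ }

      -- By `progress`, a non-empty walk is covered by the reserve of a path still to be finished.
      walked : ∀ {cur A rem r Ps} {P : Walk s cur} → Extract A₀ r₀ cur A rem r Ps P → length (edges P) ≤ n * r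
      walked {r = r} {P = P} X with X .progress
      ... | inj₁ q = subst (_≤ n * r) (sym (cong length q)) z≤n
      ... | inj₂ (s≤s {n = r′} z≤n) = ℕ.≤-trans (ℕ.<⇒≤ (walk-short P)) (ℕ.m≤m*n n (suc r′))

      cross-any : ∀ {σ cur A rem r Ps χ} {P : Walk s cur} h → at h ≡ cur → Static σ → σ .vars 14 ≡ w → Loaded h σ →
        σ .arrays 16 ≈ A → Pointers (σ .arrays 11) rem → Extract A₀ r₀ cur A rem r Ps P →
        σ .vars 12 ≡ + length (edges P) → Out (done Ps) σ →
        Segment (σ .arrays 1) (3 + length (payload (done Ps))) (map (index G) (edges P)) →
        (n * r + sizeOf rem) * 3 + rest ≤ 3 + χ + length (edges P) * 3 →
        1ℤ ℤ.≤ sgn h ℤ.* A (edge h) → wp decCross (λ τ → Extracting τ χ) σ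
      cross-any {A = A} (out e) refl st w≡ Ld A≈ ptrs X len≡ O part cr 1≤ = cross-ok e st w≡ (Loaded.idx≡ Ld)
          (Loaded.to≡ Ld) A≈ ptrs X
        (ℤ.suc[i]≤j⇒i<j (subst (1ℤ ℤ.≤_) (ℤ.*-identityˡ (A e)) 1≤)) len≡ O part cr
      -- Against the edge the tested product is `- A e`, never positive, so the program cannot cross
      -- it.
      cross-any {A = A} (inn e) refl st w≡ Ld A≈ ptrs X len≡ O part cr 1≤
        with ℤ.≤-trans 1≤ (ℤ.≤-trans (ℤ.≤-reflexive (ℤ.-1*i≡-i (A e))) (ℤ.neg-mono-≤ (X .A≥0 e)))
      ... | +≤+ ()

      after-load : ∀ {σ cur A rem r Ps h l χ} {P : Walk s cur} → Static σ → σ .vars 14 ≡ w → Loaded h σ → rem cur ≡ h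
          ∷ l → at h ≡ cur →
        σ .vars 6 ≡ + toℕ cur → σ .arrays 16 ≈ A → Pointers (σ .arrays 11) rem → Extract A₀ r₀ cur A rem r Ps P → cur
            ≢ t →
        σ .vars 12 ≡ + length (edges P) → Out (done Ps) σ →
        Segment (σ .arrays 1) (3 + length (payload (done Ps))) (map (index G) (edges P)) →
        (n * r + sizeOf rem) * 3 + rest ≤ 3 + χ + length (edges P) * 3 →
        wp (ifte (op leq (const 1ℤ) (op mul (var 8) (arr 16 (var 9)))) decCross advance) (λ τ → Extracting τ χ) σ
      after-load {σ} {cur} {A} {rem} {r} {Ps} {h} {l} {χ} {P} st w≡ Ld r≡ a≡ c≡ A≈ ptrs X c≢t len≡ O part cr =
          (λ ≢0 → cross-any h a≡ st w≡ Ld A≈ ptrs X len≡ O part cr (subst (1ℤ ℤ.≤_) flow≡ (boolℤ≢0 (_ ℤ.≤? _) ≢0)))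
        , (λ ≡0 → record
          { cur≡ = c≡ ; A≈ = A≈ ; pointers = pointers-advance {σ} cur st ptrs c≡ r≡ ptr≡
          ; extract = extract-skip X r≡ λ { e refl Ae>0 → boolℤ≡0 (_ ℤ.≤? _) ≡0
              (subst (1ℤ ℤ.≤_) (sym (trans (flow≡) (ℤ.*-identityˡ (A e)))) (ℤ.i<j⇒suc[i]≤j Ae>0)) }
          ; cur≢t = c≢t ; len≡ = len≡ ; output = record { Out O } ; partial = part
          ; credit = ℕ.+-cancelˡ-≤ 3 _ _ (ℕ.≤-trans
              (ℕ.≤-reflexive (trans (sym (arith (n * r) (sizeOf (rem [ cur ↦ l ])) rest))
              (cong (λ z → (n * r + z) * 3 + rest) (sym (sizeOf-tail rem cur r≡))))) cr) })
        where
        open Loaded Ld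
        flow≡ : σ .vars 8 ℤ.* σ .arrays 16 (σ .vars 9) ≡ sgn h ℤ.* A (edge h)
        flow≡ = cong₂ ℤ._*_ sgn≡ (trans (cong (σ .arrays 16) idx≡) (A≈ (edge h)))
        arith : ∀ a b c → (a + suc b) * 3 + c ≡ 3 + ((a + b) * 3 + c)
        arith = ℕRing.solve-∀

      dec-step : ∀ {σ ψ} → Static σ → σ .vars 14 ≡ w → Extracting σ ψ → σ .arrays 11 (σ .vars 6) ≢ 0ℤ →
        ∃[ χ ] ψ ≡ suc χ × Run decStep σ χ Extracting
      dec-step {σ} {ψ} st w≡ I ≢0 with pending {σ} (I .Extracting.cur) (I .Extracting.pointers) (I .Extracting.cur≡)
          ≢0
      ... | h , l , r≡ , a≡ = go ψ 3≤ψ credit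
        where
        open Extracting I
        L = length (edges P)
        -- The walk has drawn only on the reserve `n * r`, so the three credits of the listed
        -- half-edge are untouched.
        3≤ψ : 3 ≤ ψ
        3≤ψ = ℕ.+-cancelʳ-≤ (L * 3) 3 ψ (begin
          3 + L * 3                          ≤⟨ ℕ.+-monoʳ-≤ 3
              (ℕ.*-monoˡ-≤ 3 (ℕ.≤-trans (walked extract) (ℕ.m≤m+n (n * r) (sizeOf (rem [ cur ↦ l ]))))) ⟩
          suc (n * r + sizeOf (rem [ cur ↦ l ])) * 3 ≡⟨ cong (_* 3)
              (trans (sym (ℕ.+-suc (n * r) _)) (cong (n * r ℕ.+_) (sym (sizeOf-tail rem cur r≡)))) ⟩
          (n * r + sizeOf rem) * 3           ≤⟨ ℕ.m≤m+n _ rest ⟩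
          (n * r + sizeOf rem) * 3 + rest    ≤⟨ credit ⟩
          ψ + L * 3                          ∎)
          where open ℕ.≤-Reasoning
        go : ∀ ψ → 3 ≤ ψ → (n * r + sizeOf rem) * 3 + rest ≤ ψ + L * 3 → ∃[ χ ] ψ ≡ suc χ × Run decStep σ χ Extracting
        go (suc (suc (suc χ))) (s≤s (s≤s (s≤s z≤n))) cr = 2 + χ , refl ,
          run-seq (run-load cur st pointers cur≡ r≡) λ { τ .(1 + χ) sm (Ld , refl) →
            run-straight (ifte (op leq (const 1ℤ) (op mul (var 8) (arr 16 (var 9)))) decCross advance)
              (after-load (static-same sm st) (trans (sm .sameVar 14) w≡) Ld r≡ a≡ (trans (sm .sameVar 6) cur≡)
                (λ e → trans (sm .sameArr 16 _) (A≈ e)) (pointers-cong (sm .sameArr 11) pointers) extract cur≢t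
                (trans (sm .sameVar 12) len≡)
                (record { pos≡ = trans (sm .sameVar 11) (Out.pos≡ output) ; cnt≡ = trans (sm .sameVar 13)
                    (Out.cnt≡ output)
                        ; seg = λ i i< → trans (sm .sameArr 1 _) (Out.seg output i i<) })
                (λ i i< → trans (sm .sameArr 1 _) (partial i i<)) cr) }

      record Extracted (σ : State) (ψ : ℕ) : Set where
        field
          {paths} : List STPath
          sums    : ∀ e → A₀ e ≡ pathSum paths e
          count   : length paths ≡ r₀
          output  : Out (done paths) σ
          credit  : rest ≤ ψ

      run-dec : ∀ {σ} → s ≢ t → Static σ → σ .vars 14 ≡ w → σ .arrays 16 ≈ A₀ → (∀ e → 0ℤ ℤ.≤ A₀ e) → Conserved A₀ →
          ∂ A₀ s ≡ ℤ.- (+ r₀) → Out D₀ σ →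
        Run dec σ (5 + (n * 3 + ((n * r₀ + sizeOf inc) * 3 + rest))) Extracted
      run-dec {σ} s≢t st w≡ A≈ A≥0 cA val O = run-more
          (ℕ.≤-reflexive (arith (n * 3) ((n * r₀ + sizeOf inc) * 3 + rest)))
        (run-seq (run-reset st) λ { σ₁ _ sm₁ (ptrs , refl) →
        let st₁ = static-same sm₁ st in
        run-seq {P = λ τ ψ → τ ≡ setVar 6 (σ₁ .vars 2) σ₁ × ψ ≡ 2 + ((n * r₀ + sizeOf inc) * 3 + rest)}
            (run-straight (assign 6 (var 2)) (refl , refl)) λ { σ₂ _ sm₂ (refl , refl) →
        run-seq {P = λ τ ψ → τ ≡ setVar 12 0ℤ σ₂ × ψ ≡ 1 + ((n * r₀ + sizeOf inc) * 3 + rest)}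
            (run-straight (assign 12 (const 0ℤ)) (refl , refl)) λ { σ₃ _ sm₃ (refl , refl) →
        run-mono (run-while Extracting (record
          { cur≡ = st₁ .s≡ ; A≈ = λ e → trans (sm₁ .sameArr 16 _) (A≈ e) ; pointers = ptrs
          ; extract = extract-begin A≥0 cA val complete ; cur≢t = s≢t ; len≡ = refl
          ; output = record { pos≡ = trans (sm₁ .sameVar 11)
              (trans (Out.pos≡ O) (cong (λ D → + suc (length (payload D))) (sym (++-identityʳ D₀))))
                            ; cnt≡ = trans (sm₁ .sameVar 13)
                                (trans (Out.cnt≡ O) (cong (λ D → + length D) (sym (++-identityʳ D₀))))
                            ; seg = subst (λ D → Segment (σ₁ .arrays 1) 1 (payload D)) (sym (++-identityʳ D₀)) λ i i<
                                → trans (sm₁ .sameArr 1 _) (Out.seg O i i<) }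
          ; partial = segment-[] {σ₁ .arrays 1} {3 + length (payload (done []))} ; credit = ℕ.≤-reflexive
              (sym (ℕ.+-identityʳ _)) })
          λ {τ} sm I ≢0 → dec-step (static-same sm (static-same sm₃ (static-same sm₂ st₁)))
              (trans (sm .sameVar 14) (trans (sm₁ .sameVar 14) w≡)) I ≢0)
        λ { τ ψ _ (_ , I , ≡0) → finish I ≡0 } }}})
        where
        arith : ∀ a b → 2 + (a + (1 + (1 + (1 + b)))) ≡ 5 + (a + b)
        arith = ℕRing.solve-∀
        finish : ∀ {τ ψ} → Extracting τ ψ → τ .arrays 11 (τ .vars 6) ≡ 0ℤ → Extracted τ ψ
        finish {τ} {ψ} I ≡0 = record
          { sums = proj₁ ended ; count = proj₂ ended ; output = output
          ; credit = ℕ.+-cancelʳ-≤ (L * 3) rest ψ (ℕ.≤-trans (ℕ.≤-reflexive (ℕ.+-comm rest (L * 3)))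
              (ℕ.≤-trans (ℕ.+-monoˡ-≤ rest (ℕ.*-monoˡ-≤ 3
              (ℕ.≤-trans (walked extract) (ℕ.m≤m+n (n * r) (sizeOf rem))))) credit)) }
          where
          open Extracting I
          L = length (edges P)
          ended = extract-done extract cur≢t (exhausted {τ} cur pointers cur≡ ≡0)

-- Minimum cover of the support by push-relabel.

module Preflow (G : STDAG) where
  open Network G
  open Cuts G
  open Layout G

  source-value : ∀ {A} → (∀ e → 0ℤ ℤ.≤ A e) → ∃[ r ] ∂ A s ≡ ℤ.- (+ r)
  source-value {A} A≥0 = nonpositive (∂ A s) (subst (ℤ._≤ 0ℤ) (sym (∂-∑ A s))
      (subst (∑ (λ e → A e ℤ.* incidence e s) ℤ.≤_) (∑-0 {f = λ _ → 0ℤ} λ _ → refl) (∑-mono term)))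
    where
    out-only : ∀ a d → a ℤ.* (0ℤ ℤ.- d) ≡ ℤ.- (a ℤ.* d)
    out-only = ℤRing.solve-∀
    term : ∀ e → A e ℤ.* incidence e s ℤ.≤ 0ℤ
    term e = subst (ℤ._≤ 0ℤ) (sym (trans (cong (λ d → A e ℤ.* (d ℤ.- δ (tail e) s)) (δ-≢ (s-source e)))
        (out-only (A e) (δ (tail e) s))))
      (ℤ.neg-mono-≤ (*-≥0 (A≥0 e) (δ≥0 (tail e) s)))
    nonpositive : ∀ z → z ℤ.≤ 0ℤ → ∃[ r ] z ≡ ℤ.- (+ r)
    nonpositive (+ zero)   _ = 0 , refl
    nonpositive (+ suc _)  (+≤+ ())
    nonpositive -[1+ r ]   _ = suc r , refl

  module Pending (ℓ : Edge → ℤ) where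

    -- The first k edges of the support: each puts one unit of excess on its head.
    mask : ℕ → Edge → ℤ
    mask k e = if toℕ e ℕ.<ᵇ k then ℓ e else 0ℤ

    mask-< : ∀ {k e} → toℕ e < k → mask k e ≡ ℓ e
    mask-< {k} {e} h with toℕ e ℕ.<ᵇ k | ℕ.<⇒<ᵇ h
    ... | true | _ = refl

    mask-≥ : ∀ {k e} → ¬ (toℕ e < k) → mask k e ≡ 0ℤ
    mask-≥ {k} {e} h with toℕ e ℕ.<ᵇ k | ℕ.<ᵇ⇒< (toℕ e) k
    ... | true  | f = ⊥-elim (h (f tt))
    ... | false | _ = refl

    mask-suc : ∀ i e → mask (suc (toℕ i)) e ≡ (mask (toℕ i) [ i ↦ ℓ i ]) e
    mask-suc i e with i Fin.≟ e
    ... | yes refl = mask-< {suc (toℕ i)} {i} ℕ.≤-refl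
    ... | no i≢e with toℕ e ℕ.<? toℕ i
    ...   | yes e<i = trans (mask-< {suc (toℕ i)} {e} (ℕ.m<n⇒m<1+n e<i)) (sym (mask-< {toℕ i} {e} e<i))
    ...   | no e≮i  = trans (mask-≥ {suc (toℕ i)} {e} λ e≤i → e≮i
        (ℕ.≤∧≢⇒< (ℕ.≤-pred e≤i) (i≢e ∘ sym ∘ toℕ-injective)))
                        (sym (mask-≥ {toℕ i} {e} e≮i))

    excess : ℕ → Node → ℤ
    excess k v = ∑ λ e → mask k e ℤ.* δ (head e) v

    excess-0 : ∀ v → excess 0 v ≡ 0ℤ
    excess-0 v = ∑-0 λ e → ℤ.*-zeroˡ (δ (head e) v)

    excess-suc : ∀ i v → excess (suc (toℕ i)) v ≡ excess (toℕ i) v ℤ.+ ℓ i ℤ.* δ (head i) v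
    excess-suc i v = begin
      excess (suc (toℕ i)) v
        ≡⟨ ∑-cong (λ e → trans (cong (ℤ._* δ (head e) v) (trans (mask-suc i e) (trans ([↦]-δ (mask (toℕ i)) i (ℓ i) e)
             (cong (λ z → mask (toℕ i) e ℤ.+ (ℓ i ℤ.- z) ℤ.* δ i e) (mask-≥ {toℕ i} {i} (ℕ.n≮n (toℕ i)))))))
             (expand (mask (toℕ i) e) (ℓ i) (δ i e) (δ (head e) v))) ⟩
      ∑ (λ e → mask (toℕ i) e ℤ.* δ (head e) v ℤ.+ ℓ i ℤ.* (δ (head e) v ℤ.* δ i e))
        ≡⟨ ∑-+ (λ e → mask (toℕ i) e ℤ.* δ (head e) v) (λ e → ℓ i ℤ.* (δ (head e) v ℤ.* δ i e)) ⟩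
      excess (toℕ i) v ℤ.+ ∑ (λ e → ℓ i ℤ.* (δ (head e) v ℤ.* δ i e))
        ≡⟨ cong (λ z → excess (toℕ i) v ℤ.+ z) (trans (∑-* (ℓ i) (λ e → δ (head e) v ℤ.* δ i e))
            (cong (ℓ i ℤ.*_) (∑-δ (λ e → δ (head e) v) i))) ⟩
      excess (toℕ i) v ℤ.+ ℓ i ℤ.* δ (head i) v ∎
      where
      open ≡-Reasoning
      expand : ∀ a l d h → (a ℤ.+ (l ℤ.- 0ℤ) ℤ.* d) ℤ.* h ≡ a ℤ.* h ℤ.+ l ℤ.* (h ℤ.* d)
      expand = ℤRing.solve-∀

  module Push (ℓ : Edge → ℤ) where
    open Pending ℓ

    -- There are lower bounds but no capacities: raising the flow on an edge is always possible,
    -- lowering it only down to `ℓ`.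
    Residual : (Edge → ℤ) → Half → Set
    Residual Z h = ℓ (edge h) ℤ.≤ Z (edge h) ℤ.+ sgn h

    -- Labels estimate the residual distance to `s`, since a unit returned to `s` lowers the value
    -- and one let out at `t` does not. Of the excess units all but one are pending in `excess`; the
    -- remaining one is the token at `cur`.
    record Pushing (k : ℕ) (cur : Node) (Z : Edge → ℤ) (D : Node → ℕ) (rem : Node → List Half) : Set where
      field
        ℓ≤Z     : ∀ e → ℓ e ℤ.≤ Z e
        D-s     : D s ≡ 0
        D-t     : D t ≡ n
        valid   : ∀ h → Residual Z h → D (at h) ≤ suc (D (to h))
        live    : ∀ h → Interior (at h) → Residual Z h → D (at h) ≡ suc (D (to h)) → h ∈ rem (at h)
        balance : ∀ {v} → Interior v → ∂ Z v ≡ excess k v ℤ.+ δ cur v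

    open Pushing public

    forward-residual : ∀ {k cur Z D rem} → Pushing k cur Z D rem → ∀ e → Residual Z (out e)
    forward-residual {Z = Z} S e = ℤ.≤-trans (S .ℓ≤Z e) (ℤ.i≤i+j (Z e) 1ℤ)

    -- The edges of a walk from `v` to `t` are residual forwards, so along each of them the label
    -- falls by at most one. The walk has fewer than `n` edges and ends at label `n`.
    height : ∀ {k cur Z D rem} → Pushing k cur Z D rem → ∀ v → D v < n + n
    height {D = D} S v = ℕ.≤-<-trans (climb (to-t v))
        (subst (λ d → length (edges (to-t v)) + d < n + n) (sym (S .D-t)) (ℕ.+-monoˡ-< n (walk-short (to-t v))))
      where
      climb : ∀ {u w} (p : Walk u w) → D u ≤ length (edges p) + D w
      climb []      = ℕ.≤-refl
      climb (e ∷ p) = ℕ.≤-trans (S .valid (out e) (forward-residual S e)) (s≤s (climb p))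

    push-skip : ∀ {k cur Z D rem h l} → Pushing k cur Z D rem → rem cur ≡ h ∷ l →
      (Residual Z h → D (at h) ≢ suc (D (to h))) → Pushing k cur Z D (rem [ cur ↦ l ])
    push-skip {cur = cur} {Z} {D} {rem} {l = l} S r≡ useless = record
      { ℓ≤Z = S .ℓ≤Z ; D-s = S .D-s ; D-t = S .D-t ; valid = S .valid ; balance = S .balance ; live = live′ }
      where
      live′ : ∀ g → Interior (at g) → Residual Z g → D (at g) ≡ suc (D (to g)) → g ∈ (rem [ cur ↦ l ]) (at g)
      live′ g iv R adm with cur Fin.≟ at g
      ... | no _ = S .live g iv R adm
      ... | yes refl with subst (g ∈_) r≡ (S .live g iv R adm)
      ...   | here refl = ⊥-elim (useless R adm)
      ...   | there i   = i

    -- Only the reverse of `h` can become residual. It leads to a higher label, so it satisfies the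
    -- label bound and is not admissible; no list has to be rewound.
    push-move : ∀ {k Z D rem} h → Pushing k (at h) Z D rem → Residual Z h → D (at h) ≡ suc (D (to h)) →
      Pushing k (to h) (Z [ edge h ↦ Z (edge h) ℤ.+ sgn h ]) D rem
    push-move {k} {Z} {D} {rem} h S R adm = record
      { ℓ≤Z = ℓ≤Z′ ; D-s = S .D-s ; D-t = S .D-t
      ; valid = λ g R′ → valid′ g R′
      ; live = λ g iv R′ adm′ → S .live g iv (old g R′ adm′) adm′
      ; balance = λ {v} iv → begin
          ∂ Z′ v                                                    ≡⟨ ∂-[↦] Z e (Z e ℤ.+ sgn h) v ⟩
          ∂ Z v ℤ.+ (Z e ℤ.+ sgn h ℤ.- Z e) ℤ.* incidence e v       ≡⟨ cong₂ (λ a b → a ℤ.+ b) (S .balance iv)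
              (trans (cong (ℤ._* incidence e v) (drop (Z e) (sgn h))) (sgn-incidence h v)) ⟩
          excess k v ℤ.+ δ (at h) v ℤ.+ (δ (to h) v ℤ.- δ (at h) v) ≡⟨ shift (excess k v) (δ (at h) v) (δ (to h) v) ⟩
          excess k v ℤ.+ δ (to h) v                                 ∎
      }
      where
      open ≡-Reasoning
      e = edge h
      Z′ = Z [ e ↦ Z e ℤ.+ sgn h ]
      drop : ∀ a b → a ℤ.+ b ℤ.- a ≡ b
      drop = ℤRing.solve-∀
      shift : ∀ x a b → x ℤ.+ a ℤ.+ (b ℤ.- a) ≡ x ℤ.+ b
      shift = ℤRing.solve-∀
      ℓ≤Z′ : ∀ f → ℓ f ℤ.≤ Z′ f
      ℓ≤Z′ f with e Fin.≟ f
      ... | yes refl = R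
      ... | no _     = S .ℓ≤Z f
      on-edge : ∀ g h → edge h ≡ edge g → g ≡ h ⊎ (at g ≡ to h × to g ≡ at h)
      on-edge (out _) (out _) refl = inj₁ refl
      on-edge (inn _) (inn _) refl = inj₁ refl
      on-edge (out _) (inn _) refl = inj₂ (refl , refl)
      on-edge (inn _) (out _) refl = inj₂ (refl , refl)
      valid′ : ∀ g → Residual Z′ g → D (at g) ≤ suc (D (to g))
      valid′ g R′ with e Fin.≟ edge g
      ... | no _ = S .valid g R′
      ... | yes q with on-edge g h q
      ...   | inj₁ refl = ℕ.≤-reflexive adm
      ...   | inj₂ (a , b) = subst₂ _≤_ (cong D (sym a)) (cong (suc ∘ D) (sym b))
          (ℕ.≤-trans (ℕ.n≤1+n _) (ℕ.≤-trans (ℕ.≤-reflexive (sym adm)) (ℕ.n≤1+n _)))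
      old : ∀ g → Residual Z′ g → D (at g) ≡ suc (D (to g)) → Residual Z g
      old g R′ adm′ with e Fin.≟ edge g
      ... | no _ = R′
      ... | yes q with on-edge g h q
      ...   | inj₁ refl = R
      ...   | inj₂ (a , b) = ⊥-elim (ℕ.m≢1+n+m (D (to h)) {1}
          (trans (cong D (sym a)) (trans adm′ (cong suc (trans (cong D b) adm)))))

    -- An empty list means that no residual half-edge at `cur` is admissible, so all of them satisfy
    -- the label bound with room for one more. Raising the label makes no half-edge into `cur`
    -- admissible, so only the list of `cur` is restarted.
    push-relabel : ∀ {k cur Z D rem l} → Pushing k cur Z D rem → Interior cur → rem cur ≡ [] →
        (∀ h → at h ≡ cur → h ∈ l) →
      Pushing k cur Z (D [ cur ↦ suc (D cur) ]) (rem [ cur ↦ l ])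
    push-relabel {cur = cur} {Z} {D} {rem} {l} S (c≢s , c≢t) r≡ complete = record
      { ℓ≤Z = S .ℓ≤Z
      ; D-s = trans (↦-miss D (suc (D cur)) c≢s) (S .D-s)
      ; D-t = trans (↦-miss D (suc (D cur)) c≢t) (S .D-t)
      ; valid = valid′ ; live = live′ ; balance = S .balance }
      where
      D′ = D [ cur ↦ suc (D cur) ]
      raised : ∀ v → D v ≤ D′ v
      raised v with cur Fin.≟ v
      ... | yes refl = ℕ.n≤1+n (D cur)
      ... | no _     = ℕ.≤-refl
      below : ∀ h → at h ≡ cur → Residual Z h → suc (D (at h)) ≤ suc (D (to h))
      below h refl R = ℕ.≤∧≢⇒< (S .valid h R) λ adm → none (subst (h ∈_) r≡ (S .live h (c≢s , c≢t) R adm))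
        where
        none : h ∉ []
        none ()
      valid′ : ∀ h → Residual Z h → D′ (at h) ≤ suc (D′ (to h))
      valid′ h R with cur Fin.≟ at h
      ... | yes q = ℕ.≤-trans (subst (λ v → suc (D v) ≤ suc (D (to h))) (sym q) (below h (sym q) R))
          (s≤s (raised (to h)))
      ... | no _  = ℕ.≤-trans (S .valid h R) (s≤s (raised (to h)))
      live′ : ∀ h → Interior (at h) → Residual Z h → D′ (at h) ≡ suc (D′ (to h)) → h ∈ (rem [ cur ↦ l ]) (at h)
      live′ h iv R adm with cur Fin.≟ at h
      ... | yes q = complete h (sym q)
      ... | no _ with cur Fin.≟ to h
      ...   | yes q = ⊥-elim (ℕ.<⇒≱ (ℕ.≤-reflexive (sym adm))
          (subst (λ v → D (at h) ≤ suc (D v)) (sym q) (S .valid h R)))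
      ...   | no _  = S .live h iv R adm

    push-launch : ∀ {i Z D rem} → Pushing (suc (toℕ i)) s Z D rem → ℓ i ≡ 1ℤ → Pushing (toℕ i) (head i) Z D rem
    push-launch {i} S ℓ≡1 = record
      { ℓ≤Z = S .ℓ≤Z ; D-s = S .D-s ; D-t = S .D-t ; valid = S .valid ; live = S .live
      ; balance = λ {v} iv → trans (S .balance iv) (trans (cong₂ ℤ._+_ (excess-suc i v) (δ-≢ (proj₁ iv ∘ sym)))
          (trans (ℤ.+-identityʳ (excess (toℕ i) v ℤ.+ ℓ i ℤ.* δ (head i) v))
            (cong (λ z → excess (toℕ i) v ℤ.+ z) (trans (cong (ℤ._* δ (head i) v) ℓ≡1)
                (ℤ.*-identityˡ (δ (head i) v)))))) }

    push-idle : ∀ {i Z D rem} → Pushing (suc (toℕ i)) s Z D rem → ℓ i ≡ 0ℤ → Pushing (toℕ i) s Z D rem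
    push-idle {i} S ℓ≡0 = record
      { ℓ≤Z = S .ℓ≤Z ; D-s = S .D-s ; D-t = S .D-t ; valid = S .valid ; live = S .live
      ; balance = λ {v} iv → trans (S .balance iv) (cong (ℤ._+ δ s v) (trans (excess-suc i v)
          (trans (cong (λ z → excess (toℕ i) v ℤ.+ z ℤ.* δ (head i) v) ℓ≡0)
              (trans (cong (λ z → excess (toℕ i) v ℤ.+ z) (ℤ.*-zeroˡ (δ (head i) v)))
              (ℤ.+-identityʳ (excess (toℕ i) v)))))) }

    -- The token parked at `s` stands for no token at all, because `balance` looks at interior nodes
    -- only.
    push-land : ∀ {k cur Z D rem} → Pushing k cur Z D rem → cur ≡ s ⊎ cur ≡ t → Pushing k s Z D rem
    push-land S (inj₁ refl) = S
    push-land {k} S (inj₂ refl) = record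
      { ℓ≤Z = S .ℓ≤Z ; D-s = S .D-s ; D-t = S .D-t ; valid = S .valid ; live = S .live
      ; balance = λ {v} iv → trans (S .balance iv) (cong (λ d → excess k v ℤ.+ d)
          (trans (δ-≢ (proj₂ iv ∘ sym)) (sym (δ-≢ (proj₁ iv ∘ sym))))) }

    record MinimalCover (Z : Edge → ℤ) (k : ℕ) : Set where
      field
        covers    : ∀ e → ℓ e ℤ.≤ Z e
        conserved : Conserved Z
        value     : ∂ Z s ≡ ℤ.- (+ k)
        k≤m       : k ≤ m
        minimal   : ∀ {Y} → Conserved Y → (∀ e → ℓ e ℤ.≤ Y e) → ∂ Y s ℤ.≤ ℤ.- (+ k)

    -- Without pending units the preflow is a flow. Where it exceeds `ℓ` the backward half-edge is
    -- residual, so the label cannot rise by two or more along the edge: these are the hypotheses of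
    -- the cut argument.
    push-done : ∀ {Z D rem} → (∀ e → 0ℤ ℤ.≤ ℓ e) → (∀ e → ℓ e ℤ.≤ 1ℤ) → Pushing 0 s Z D rem → ∃[ k ] MinimalCover Z k
    push-done {Z} {D} ℓ≥0 ℓ≤1 S = k , record
      { covers = S .ℓ≤Z ; conserved = cZ ; value = value
      ; k≤m = ℤ.drop‿+≤+ (ℤ.neg-cancel-≤ (subst (ℤ.- (+ m) ℤ.≤_) value (L.value≤m {Z} {ℓ} cZ backward ℓ≤1)))
      ; minimal = λ cY ℓ≤Y → subst (_ ℤ.≤_) value (L.minimal cZ backward cY ℓ≤Y) }
      where
      forward : ∀ e → D (tail e) ≤ suc (D (head e))
      forward e = S .valid (out e) (forward-residual S e)
      module L = Labelling D (S .D-s) (S .D-t) forward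
      cZ : Conserved Z
      cZ {v} iv = trans (S .balance iv) (cong₂ ℤ._+_ (excess-0 v) (δ-≢ (proj₁ iv ∘ sym)))
      backward : ∀ e → suc (D (tail e)) < D (head e) → Z e ≡ ℓ e
      backward e far = ℤ.≤-antisym (ℤ.≮⇒≥ λ ℓ<Z → ℕ.<⇒≱ far (S .valid (inn e) (residual ℓ<Z))) (S .ℓ≤Z e)
        where
        residual : ℓ e ℤ.< Z e → ℓ e ℤ.≤ Z e ℤ.+ ℤ.-1ℤ
        residual ℓ<Z = subst (ℤ._≤ Z e ℤ.+ ℤ.-1ℤ) (lemma (ℓ e)) (ℤ.+-monoˡ-≤ ℤ.-1ℤ (ℤ.i<j⇒suc[i]≤j ℓ<Z))
          where
          lemma : ∀ l → 1ℤ ℤ.+ l ℤ.+ ℤ.-1ℤ ≡ l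
          lemma = ℤRing.solve-∀
      sv = source-value (λ e → ℤ.≤-trans (ℓ≥0 e) (S .ℓ≤Z e))
      k = proj₁ sv
      value : ∂ Z s ≡ ℤ.- (+ k)
      value = proj₂ sv

    -- Together with D at the token this decreases: a push lowers the label at the token by one, and a
    -- relabelling pays for itself and for rescanning the list of the node.
    potential : (Node → List Half) → (Node → ℕ) → (Node → List Half) → ℕ
    potential inc D rem = ∑ℕ (λ v → (n + n ∸ D v) * (length (inc v) + 2)) + sizeOf rem

    -- Of the two units gained, one makes up for the higher label under the token and the other pays
    -- for the relabelling.
    potential-relabel : ∀ inc D rem v → D v < n + n → rem v ≡ [] →
      2 + potential inc (D [ v ↦ suc (D v) ]) (rem [ v ↦ inc v ]) ≡ potential inc D rem
    potential-relabel inc D rem v D< r≡ = ℕ.+-cancelʳ-≡ (f v) _ _ (begin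
      2 + (∑ℕ f′ + sizeOf rem′) + f v               ≡⟨ shuffle₁ (∑ℕ f′) (sizeOf rem′) (f v) ⟩
      ∑ℕ f′ + f v + (2 + sizeOf rem′)               ≡⟨ cong₂ (λ a b → a + (2 + b)) labels sizes ⟩
      ∑ℕ f + x + (2 + (sizeOf rem + deg))           ≡⟨ shuffle₂ (∑ℕ f) x (sizeOf rem) deg ⟩
      ∑ℕ f + sizeOf rem + (deg + 2 + x)             ≡⟨ cong (∑ℕ f + sizeOf rem ℕ.+_) (cong (_* (deg + 2)) gapped) ⟨
      ∑ℕ f + sizeOf rem + f v                       ∎)
      where
      open ≡-Reasoning
      deg = length (inc v)
      f : Node → ℕ
      f w = (n + n ∸ D w) * (length (inc w) + 2)
      f′ : Node → ℕ
      f′ w = (n + n ∸ (D [ v ↦ suc (D v) ]) w) * (length (inc w) + 2)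
      rem′ = rem [ v ↦ inc v ]
      x = (n + n ∸ suc (D v)) * (deg + 2)
      gapped : n + n ∸ D v ≡ suc (n + n ∸ suc (D v))
      gapped = ℕ.+-∸-assoc 1 D<
      updated : ∀ w → f′ w ≡ (f [ v ↦ x ]) w
      updated w with v Fin.≟ w
      ... | yes refl = refl
      ... | no _     = refl
      labels : ∑ℕ f′ + f v ≡ ∑ℕ f + x
      labels = trans (cong (_+ f v) (∑ℕ-cong updated)) (∑ℕ-[↦] f v x)
      sizes : sizeOf rem′ ≡ sizeOf rem + deg
      sizes = trans (sym (ℕ.+-identityʳ _)) (trans (cong (λ l → sizeOf rem′ + length l) (sym r≡))
          (sizeOf-[↦] rem v (inc v)))
      shuffle₁ : ∀ a b c → 2 + (a + b) + c ≡ a + c + (2 + b)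
      shuffle₁ = ℕRing.solve-∀
      shuffle₂ : ∀ a b c d → a + b + (2 + (c + d)) ≡ a + c + (d + 2 + b)
      shuffle₂ = ℕRing.solve-∀

  module Pull (ℓ : Edge → ℤ) (ℓ≥0 : ∀ e → 0ℤ ℤ.≤ ℓ e) where
    open Pending ℓ

    -- The routes back to s leave the capacity into t untouched, so no residual half-edge leaves t.
    record Pulling (k : ℕ) (cur : Node) (Z : Edge → ℤ) : Set where
      field
        covers  : ∀ e → mask k e ℤ.≤ Z e
        balance : ∀ {v} → Interior v → ∂ Z v ≡ excess k v ℤ.- δ cur v
        at-t    : ∀ e → head e ≡ t → Z e ℤ.≤ mask k e
        cur≢t   : cur ≢ t

    open Pulling public

    grow : ∀ (Z : Edge → ℤ) i e → Z e ℤ.≤ (Z [ i ↦ Z i ℤ.+ 1ℤ ]) e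
    grow Z i e with i Fin.≟ e
    ... | yes refl = ℤ.i≤i+j (Z i) 1ℤ
    ... | no _     = ℤ.≤-refl

    ∂-grow : ∀ Z i v → ∂ (Z [ i ↦ Z i ℤ.+ 1ℤ ]) v ≡ ∂ Z v ℤ.+ (δ (head i) v ℤ.- δ (tail i) v)
    ∂-grow Z i v = trans (∂-[↦] Z i (Z i ℤ.+ 1ℤ) v) (cong (λ z → ∂ Z v ℤ.+ z) (lemma (Z i) (incidence i v)))
      where
      lemma : ∀ a d → (a ℤ.+ 1ℤ ℤ.- a) ℤ.* d ≡ d
      lemma = ℤRing.solve-∀

    pull-start : s ≢ t → Pulling 0 s (λ _ → 0ℤ)
    pull-start s≢t = record
      { covers = λ e → ℤ.≤-refl
      ; balance = λ {v} iv → trans (∂-0 v) (sym (cong₂ ℤ._-_ (excess-0 v) (δ-≢ (proj₁ iv ∘ sym))))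
      ; at-t = λ e _ → ℤ.≤-refl ; cur≢t = s≢t }

    pull-begin : ∀ {i Z} → Pulling (toℕ i) s Z → ℓ i ≡ 1ℤ → Pulling (suc (toℕ i)) (tail i) (Z [ i ↦ Z i ℤ.+ 1ℤ ])
    pull-begin {i} {Z} S ℓ≡1 = record
      { covers = λ e → subst (ℤ._≤ (Z [ i ↦ Z i ℤ.+ 1ℤ ]) e) (sym (mask-suc i e)) (covers′ e)
      ; balance = λ {v} iv → trans (∂-grow Z i v) (trans
          (cong (ℤ._+ (δ (head i) v ℤ.- δ (tail i) v))
          (trans (S .balance iv) (cong (λ d → excess (toℕ i) v ℤ.- d) (δ-≢ (proj₁ iv ∘ sym)))))
          (trans (shift (excess (toℕ i) v) (δ (head i) v) (δ (tail i) v))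
              (cong (ℤ._- δ (tail i) v) (sym (trans (excess-suc i v)
              (cong (λ l → excess (toℕ i) v ℤ.+ l ℤ.* δ (head i) v) ℓ≡1))))))
      ; at-t = λ e q → subst ((Z [ i ↦ Z i ℤ.+ 1ℤ ]) e ℤ.≤_) (sym (mask-suc i e)) (at-t′ e q)
      ; cur≢t = t-sink i }
      where
      shift : ∀ x h u → x ℤ.- 0ℤ ℤ.+ (h ℤ.- u) ≡ x ℤ.+ 1ℤ ℤ.* h ℤ.- u
      shift = ℤRing.solve-∀
      mask-i : mask (toℕ i) i ≡ 0ℤ
      mask-i = mask-≥ {toℕ i} {i} (ℕ.n≮n (toℕ i))
      covers′ : ∀ e → (mask (toℕ i) [ i ↦ ℓ i ]) e ℤ.≤ (Z [ i ↦ Z i ℤ.+ 1ℤ ]) e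
      covers′ e with i Fin.≟ e
      ... | yes refl = subst (ℤ._≤ Z i ℤ.+ 1ℤ) (trans (ℤ.+-identityˡ 1ℤ) (sym ℓ≡1))
          (ℤ.+-monoˡ-≤ 1ℤ (subst (ℤ._≤ Z i) mask-i (S .covers i)))
      ... | no _     = S .covers e
      at-t′ : ∀ e → head e ≡ t → (Z [ i ↦ Z i ℤ.+ 1ℤ ]) e ℤ.≤ (mask (toℕ i) [ i ↦ ℓ i ]) e
      at-t′ e q with i Fin.≟ e
      ... | yes refl = subst (Z i ℤ.+ 1ℤ ℤ.≤_) (trans (ℤ.+-identityˡ 1ℤ) (sym ℓ≡1))
          (ℤ.+-monoˡ-≤ 1ℤ (subst (Z i ℤ.≤_) mask-i (S .at-t i q)))
      ... | no _     = S .at-t e q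

    pull-step : ∀ {k Z} e → Pulling k (head e) Z → Pulling k (tail e) (Z [ e ↦ Z e ℤ.+ 1ℤ ])
    pull-step {k} {Z} e S = record
      { covers = λ f → ℤ.≤-trans (S .covers f) (grow Z e f)
      ; balance = λ {v} iv → trans (∂-grow Z e v) (trans
          (cong (ℤ._+ (δ (head e) v ℤ.- δ (tail e) v)) (S .balance iv))
          (shift (excess k v) (δ (head e) v) (δ (tail e) v)))
      ; at-t = λ f q → subst (ℤ._≤ mask k f) (sym (↦-miss Z {e} {f} (Z e ℤ.+ 1ℤ) λ { refl → S .cur≢t q }))
          (S .at-t f q)
      ; cur≢t = t-sink e }
      where
      shift : ∀ x h u → x ℤ.- h ℤ.+ (h ℤ.- u) ≡ x ℤ.- u
      shift = ℤRing.solve-∀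

    pull-skip : ∀ {i Z} → Pulling (toℕ i) s Z → ℓ i ≡ 0ℤ → Pulling (suc (toℕ i)) s Z
    pull-skip {i} {Z} S ℓ≡0 = record
      { covers = λ e → subst (ℤ._≤ Z e) (sym (same e)) (S .covers e)
      ; balance = λ {v} iv → trans (S .balance iv) (cong (ℤ._- δ s v)
          (∑-cong λ e → cong (ℤ._* δ (head e) v) (sym (same e))))
      ; at-t = λ e q → subst (Z e ℤ.≤_) (sym (same e)) (S .at-t e q)
      ; cur≢t = S .cur≢t }
      where
      same : ∀ e → mask (suc (toℕ i)) e ≡ mask (toℕ i) e
      same e = trans (mask-suc i e) (unchanged e)
        where
        unchanged : ∀ e → (mask (toℕ i) [ i ↦ ℓ i ]) e ≡ mask (toℕ i) e
        unchanged e with i Fin.≟ e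
        ... | yes refl = trans ℓ≡0 (sym (mask-≥ {toℕ i} {i} (ℕ.n≮n (toℕ i))))
        ... | no _     = refl

    open Push ℓ using (Pushing; Residual)

    sinkLabel : Node → ℕ
    sinkLabel v = if does (v Fin.≟ t) then n else 0

    push-start : ∀ {Z inc} → Pulling m s Z → (∀ h → h ∈ inc (at h)) → Pushing m s Z sinkLabel inc
    push-start {Z} S complete = record
      { ℓ≤Z = λ e → subst (ℤ._≤ Z e) (full e) (S .covers e)
      ; D-s = ↦-s
      ; D-t = ↦-t
      ; valid = valid′
      ; live = λ h _ _ _ → complete h
      ; balance = λ {v} iv → trans (S .balance iv) (cong (λ d → excess m v ℤ.+ d)
          (trans (cong ℤ.-_ (δ-≢ (proj₁ iv ∘ sym))) (sym (δ-≢ (proj₁ iv ∘ sym))))) }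
      where
      full : ∀ e → mask m e ≡ ℓ e
      full e = mask-< {m} {e} (toℕ<n e)
      ↦-s : sinkLabel s ≡ 0
      ↦-s with s Fin.≟ t
      ... | yes q = ⊥-elim (S .cur≢t q)
      ... | no _  = refl
      ↦-t : sinkLabel t ≡ n
      ↦-t with t Fin.≟ t
      ... | yes _ = refl
      ... | no ≢  = ⊥-elim (≢ refl)
      valid′ : ∀ h → Residual Z h → sinkLabel (at h) ≤ suc (sinkLabel (to h))
      valid′ h R with at h Fin.≟ t
      ... | no _ = z≤n
      ... | yes q = ⊥-elim (blocked h q R)
        where
        blocked : ∀ h → at h ≡ t → ¬ Residual Z h
        blocked (out e) q R = t-sink e q
        blocked (inn e) q R = ℤ.<⇒≱ (ℤ.suc[i]≤j⇒i<j (ℤ.≤-reflexive (lemma (Z e))))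
            (ℤ.≤-trans (subst (Z e ℤ.≤_) (full e) (S .at-t e q)) R)
          where
          lemma : ∀ z → 1ℤ ℤ.+ (z ℤ.+ ℤ.-1ℤ) ≡ z
          lemma = ℤRing.solve-∀

spend : ∀ c {x ψ} → c + x ≤ ψ → ∃[ χ ] ψ ≡ c + χ × x ≤ χ
spend c {x} {ψ} h = ψ ∸ c , sym (ℕ.m+[n∸m]≡n (ℕ.≤-trans (ℕ.m≤m+n c x) h)) ,
  subst (_≤ ψ ∸ c) (ℕ.m+n∸m≡n c x) (ℕ.∸-monoˡ-≤ c h)

-- The cover program and its cost.

module CoverProgram (G : STDAG) where
  open Network G
  open Cuts G
  open Layout G
  open Preflow G

  module _ (adj : Adjacency) (ℓ : Edge → ℤ) (ℓ≥0 : ∀ e → 0ℤ ℤ.≤ ℓ e) (ℓ≤1 : ∀ e → ℓ e ℤ.≤ 1ℤ) where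
    open Represented adj
    open Pending ℓ
    open Pull ℓ ℓ≥0
    open Push ℓ

    ℓ≢0 : ∀ e → ℓ e ≢ 0ℤ → ℓ e ≡ 1ℤ
    ℓ≢0 e ≢0 = ℤ.≤-antisym (ℓ≤1 e) (ℤ.i<j⇒suc[i]≤j (ℤ.≤∧≢⇒< (ℓ≥0 e) (≢0 ∘ sym)))

    Parents : State → Set
    Parents σ = ∀ {v} → v ≢ s → ∃[ e ] head e ≡ v × σ .arrays 9 (+ toℕ v) ≡ + toℕ e

    -- `route` is what has been walked backwards so far. Acyclicity keeps it below `n` edges, so
    -- that a supply proportional to `n` lasts until `s` is reached.
    record OnPull (k : ℕ) (u : Node) (rest : ℕ) (σ : State) (ψ : ℕ) : Set where
      field
        {cur}  : Node
        {Z}    : Edge → ℤ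
        cur≡   : σ .vars 6 ≡ + toℕ cur
        Z≈     : σ .arrays 10 ≈ Z
        pulls  : Pulling k cur Z
        route  : Walk cur u
        credit : n * 2 + rest ≤ ψ + length (edges route) * 2

    pull-body : ∀ {k u rest σ ψ} → Static σ → Parents σ → OnPull k u rest σ ψ → ⟦ op sub (var 6) (var 2) ⟧ σ ≢ 0ℤ →
      ∃[ χ ] ψ ≡ suc χ × Run pullStep σ χ (OnPull k u rest)
    pull-body {k} {u} {rest} {σ} {ψ} st par I ≢0 with par c≢s
      where
      open OnPull I
      c≢s : cur ≢ s
      c≢s refl = ≢0 (trans (cong₂ ℤ._-_ cur≡ (st .s≡)) (ℤ.+-inverseʳ (+ toℕ s)))
    ... | e , refl , par≡ = let χ , ψ≡ , enough = spend 2 paid in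
      1 + χ , ψ≡ , run-straight pullStep (record
        { cur≡ = trans (cong (σ .arrays 7) e≡) (st .tail≈ e)
        ; Z≈ = write-≈ {f = σ .arrays 10} e Z≈ e≡ (cong (ℤ._+ 1ℤ) (trans (cong (σ .arrays 10) e≡) (Z≈ e)))
        ; pulls = pull-step e pulls
        ; route = e ∷ route
        ; credit = ℕ.≤-trans (ℕ.≤-reflexive (sym (ℕ.m∸n+n≡m longer)))
            (ℕ.+-monoˡ-≤ (suc (length (edges route)) * 2) enough) })
      where
      open OnPull I
      e≡ : σ .arrays 9 (σ .vars 6) ≡ + toℕ e
      e≡ = trans (cong (σ .arrays 9) cur≡) par≡
      longer : suc (length (edges route)) * 2 ≤ n * 2 + rest
      longer = ℕ.≤-trans (ℕ.*-monoˡ-≤ 2 (ℕ.<⇒≤ (walk-short (e ∷ route)))) (ℕ.m≤m+n (n * 2) rest)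
      paid : 2 + (n * 2 + rest ∸ suc (length (edges route)) * 2) ≤ ψ
      paid = ℕ.+-cancelʳ-≤ (length (edges route) * 2) _ ψ (ℕ.≤-trans (ℕ.≤-reflexive
        (trans (move (n * 2 + rest ∸ suc (length (edges route)) * 2) (length (edges route))) (ℕ.m∸n+n≡m longer)))
            credit)
        where
        move : ∀ a l → 2 + a + l * 2 ≡ a + suc l * 2
        move = ℕRing.solve-∀

    record Pulled (rest k : ℕ) (σ : State) (ψ : ℕ) : Set where
      field
        {Z}    : Edge → ℤ
        {left} : ℕ
        Z≈     : σ .arrays 10 ≈ Z
        pulls  : Pulling k s Z
        k+left : k + left ≡ m
        credit : left * (n * 2 + 5) + rest ≤ ψ

    run-pull : ∀ {σ rest} → s ≢ t → Static σ → Parents σ → σ .arrays 6 ≈ ℓ → (∀ e → σ .arrays 10 (+ toℕ e) ≡ 0ℤ) →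
      Run pull σ (2 + (m * (n * 2 + 5) + rest)) (Pulled rest m)
    run-pull {σ} {rest} s≢t st par ℓ≈ Z≡0 = run-for {N = m} (Pulled rest) (st .m≡)
      (λ z → record { Z≈ = Z≡0 ; pulls = pull-start s≢t ; k+left = refl ; credit = ℕ.≤-refl })
      step
      where
      body : Program
      body = ifte (arr 6 (var 15))
               ((store 10 (var 15) (op add (arr 10 (var 15)) (const 1ℤ)) ⨾ assign 6 (arr 7 (var 15))) ⨾
                 while (op sub (var 6) (var 2)) pullStep)
               skip
      step : ∀ (i : Fin m) {τ ψ} → Same (for 15 1 body) σ τ → τ .vars 15 ≡ + toℕ i → Pulled rest (toℕ i) τ ψ →
        ∃[ χ ] ψ ≡ 2 + χ × Run body τ (suc χ) (λ υ ω → ∃[ ω′ ] ω ≡ suc ω′ × ∀ z → Pulled rest (suc (toℕ i))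
            (setVar 15 z υ) ω′)
      step i {τ} {ψ} sm 15≡ J with J .Pulled.left in l≡
      ... | zero = ⊥-elim (ℕ.<⇒≢ (toℕ<n i) (trans (sym (ℕ.+-identityʳ _))
          (trans (cong (toℕ i ℕ.+_) (sym l≡)) (J .Pulled.k+left))))
      ... | suc l = let χ , ψ≡ , enough = spend 5 {n * 2 + (l * (n * 2 + 5) + rest)} paid in
        3 + χ , ψ≡ , run-if (λ ≢0 → go χ enough (ℓ≢0 i (λ z → ≢0 (trans ℓ-at z)))) (λ ≡0 → run-straight skip
          (1 + χ , refl , λ z → record { Z≈ = Z≈ ; pulls = pull-skip pulls (trans (sym ℓ-at) ≡0) ; k+left = k+left′
            ; credit = ℕ.≤-trans (ℕ.m≤n+m _ (n * 2)) (ℕ.≤-trans enough (ℕ.n≤1+n χ)) }))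
        where
        open Pulled J
        stτ = static-same sm st
        ℓ-at : τ .arrays 6 (τ .vars 15) ≡ ℓ i
        ℓ-at = trans (cong (τ .arrays 6) 15≡) (trans (sm .sameArr 6 _) (ℓ≈ i))
        k+left′ : suc (toℕ i) + l ≡ m
        k+left′ = trans (sym (ℕ.+-suc (toℕ i) l)) (trans (cong (toℕ i ℕ.+_) (sym l≡)) k+left)
        paid : 5 + (n * 2 + (l * (n * 2 + 5) + rest)) ≤ ψ
        paid = ℕ.≤-trans (ℕ.≤-reflexive (trans (arith n l rest) (cong (λ l → l * (n * 2 + 5) + rest) (sym l≡))))
            credit
          where
          arith : ∀ n l r → 5 + (n * 2 + (l * (n * 2 + 5) + r)) ≡ suc l * (n * 2 + 5) + r
          arith = ℕRing.solve-∀
        go : ∀ χ → n * 2 + (l * (n * 2 + 5) + rest) ≤ χ → ℓ i ≡ 1ℤ →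
          Run _ τ (3 + χ) (λ υ ω → ∃[ ω′ ] ω ≡ suc ω′ × ∀ z → Pulled rest (suc (toℕ i)) (setVar 15 z υ) ω′)
        go χ enough ℓ≡1 =
          run-seq {P = λ υ ω → OnPull (suc (toℕ i)) (tail i) (1 + (l * (n * 2 + 5) + rest)) υ (1 + χ) × ω ≡ 2 + χ}
            (run-straight (store 10 (var 15) (op add (arr 10 (var 15)) (const 1ℤ)) ⨾ assign 6 (arr 7 (var 15)))
              (record { cur≡ = trans (cong (τ .arrays 7) 15≡) (stτ .tail≈ i)
                      ; Z≈ = write-≈ {f = τ .arrays 10} i Z≈ 15≡
                          (cong (ℤ._+ 1ℤ) (trans (cong (τ .arrays 10) 15≡) (Z≈ i)))
                      ; pulls = pull-begin pulls ℓ≡1 ; route = []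
                      ; credit = ℕ.≤-trans (ℕ.≤-reflexive (ℕ.+-suc (n * 2) _))
                          (ℕ.≤-trans (s≤s enough) (ℕ.≤-reflexive (sym (ℕ.+-identityʳ _)))) } , refl))
            λ { υ ω sm₁ (I , refl) → run-mono
              (run-while {b = op sub (var 6) (var 2)} (OnPull (suc (toℕ i)) (tail i) (1 + (l * (n * 2 + 5) + rest)))
                  I λ {τ′} sm₂ I′ ≢0 →
                pull-body (static-same sm₂ (static-same sm₁ stτ)) (λ v≢s → let e , h , q = par v≢s in e , h , trans (sm₂ .sameArr 9 _) (trans (sm₁ .sameArr 9 _) (trans (sm .sameArr 9 _) q))) I′ ≢0)
              λ { υ′ ω′ sm₃ (sm₂ , I′ , ≡0) → finish (static-same sm₂ (static-same sm₁ stτ)) I′ ≡0 } }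
          where
          finish : ∀ {υ ω} → Static υ → OnPull (suc (toℕ i)) (tail i) (1 + (l * (n * 2 + 5) + rest)) υ ω → ⟦ op sub
              (var 6) (var 2) ⟧ υ ≡ 0ℤ →
            ∃[ ω′ ] ω ≡ suc ω′ × ∀ z → Pulled rest (suc (toℕ i)) (setVar 15 z υ) ω′
          finish {υ} {ω} stυ I ≡0 = let ω′ , ω≡ , enough′ = spend 1 {l * (n * 2 + 5) + rest} paid′ in
            ω′ , ω≡ , λ z → record { Z≈ = I.Z≈ ; pulls = subst (λ c → Pulling (suc (toℕ i)) c I.Z) c≡s I.pulls ;
                k+left = k+left′ ; credit = enough′ }
            where
            module I = OnPull I
            c≡s : I.cur ≡ s
            c≡s = +toℕ-injective (trans (sym I.cur≡) (trans (ℤ.i-j≡0⇒i≡j (υ .vars 6) (υ .vars 2) ≡0) (stυ .s≡)))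
            paid′ : 1 + (l * (n * 2 + 5) + rest) ≤ ω
            paid′ = ℕ.+-cancelˡ-≤ (n * 2) _ ω (ℕ.≤-trans I.credit
                (ℕ.≤-trans (ℕ.+-monoʳ-≤ ω (ℕ.*-monoˡ-≤ 2 (ℕ.<⇒≤ (walk-short I.route))))
                (ℕ.≤-reflexive (ℕ.+-comm ω (n * 2)))))

    Φ : (Node → ℕ) → (Node → List Half) → ℕ
    Φ = potential inc

    -- Four credits per unit of potential: the loop test, the test for an empty list, loading a
    -- half-edge and acting on it.
    record OnPush (k rest : ℕ) (σ : State) (ψ : ℕ) : Set where
      field
        {cur}    : Node
        {Z}      : Edge → ℤ
        {D}      : Node → ℕ
        {rem}    : Node → List Half
        cur≡     : σ .vars 6 ≡ + toℕ cur
        Z≈       : σ .arrays 10 ≈ Z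
        D≈       : σ .arrays 12 ≈ λ v → + D v
        pointers : Pointers (σ .arrays 11) rem
        pushing  : Pushing k cur Z D rem
        credit   : (Φ D rem + D cur) * 4 + rest ≤ ψ

    Φ-tail : ∀ D rem v {h l} → rem v ≡ h ∷ l → Φ D rem ≡ suc (Φ D (rem [ v ↦ l ]))
    Φ-tail D rem v q = trans (cong (∑ℕ _ ℕ.+_) (sizeOf-tail rem v q)) (ℕ.+-suc _ _)

    push-advance : ∀ {k rest σ h l χ cur Z D rem} → Static σ → Loaded h σ → rem cur ≡ h ∷ l → σ .vars 6 ≡ + toℕ cur →
        σ .arrays 10 ≈ Z →
      σ .arrays 12 ≈ (λ v → + D v) → Pointers (σ .arrays 11) rem → Pushing k cur Z D rem → (Φ D rem + D cur) * 4 +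
          rest ≤ 4 + χ →
      (Residual Z h → D (at h) ≢ suc (D (to h))) → wp advance (λ τ → OnPush k rest τ χ) σ
    push-advance {k} {rest} {σ} {h} {l} {χ} {cur} {Z} {D} {rem} st Ld r≡ c≡ Z≈ D≈ P S cr useless = record
      { cur≡ = c≡ ; Z≈ = Z≈ ; D≈ = D≈ ; pointers = pointers-advance {σ} cur st P c≡ r≡ (Loaded.ptr≡ Ld) ; pushing =
          push-skip S r≡ useless
      ; credit = ℕ.+-cancelˡ-≤ 4 _ χ (ℕ.≤-trans (ℕ.≤-reflexive
          (cong (λ p → (p + D cur) * 4 + rest) (sym (Φ-tail D rem cur r≡)))) cr) }

    push-over : ∀ {k rest σ χ cur Z D rem} h → at h ≡ cur → Loaded h σ → σ .arrays 10 ≈ Z →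
      σ .arrays 12 ≈ (λ v → + D v) → Pointers (σ .arrays 11) rem → Pushing k cur Z D rem → (Φ D rem + D cur) * 4 +
          rest ≤ 4 + χ →
      Residual Z h → D cur ≡ suc (D (to h)) → wp (store 10 (var 9) (op add (arr 10 (var 9)) (var 8)) ⨾ assign 6
          (var 17)) (λ τ → OnPush k rest τ χ) σ
    push-over {k} {rest} {σ} {χ} {_} {Z} {D} {rem} h refl Ld Z≈ D≈ P S cr R adm = record
      { cur≡ = to≡ ; Z≈ = write-≈ {f = σ .arrays 10} (edge h) Z≈ idx≡
          (cong₂ ℤ._+_ (trans (cong (σ .arrays 10) idx≡) (Z≈ (edge h))) sgn≡)
      ; D≈ = D≈ ; pointers = P ; pushing = push-move h S R adm
      ; credit = ℕ.+-cancelˡ-≤ 4 _ χ (ℕ.≤-trans (ℕ.≤-reflexive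
          (trans (arith (Φ D rem) (D (to h)) rest) (cong (λ d → (Φ D rem + d) * 4 + rest) (sym adm)))) cr) }
      where
      open Loaded Ld
      arith : ∀ p d r → 4 + ((p + d) * 4 + r) ≡ (p + suc d) * 4 + r
      arith = ℕRing.solve-∀

    push-body : ∀ {k rest σ ψ} → Static σ → σ .arrays 6 ≈ ℓ → OnPush k rest σ ψ → ⟦ op mul (op sub (var 6) (var 2))
        (op sub (var 6) (var 3)) ⟧ σ ≢ 0ℤ →
      ∃[ χ ] ψ ≡ suc χ × Run pushStep σ χ (OnPush k rest)
    push-body {k} {rest} {σ} {ψ} st ℓ≈ I ≢0 = split (rem cur) refl
      where
      open OnPush I
      interior : Interior cur
      interior = (λ { refl → ≢0 (trans (cong (ℤ._* (σ .vars 6 ℤ.- σ .vars 3))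
          (trans (cong₂ ℤ._-_ cur≡ (st .s≡)) (ℤ.+-inverseʳ (+ toℕ s)))) (ℤ.*-zeroˡ (σ .vars 6 ℤ.- σ .vars 3))) })
               , (λ { refl → ≢0 (trans (cong ((σ .vars 6 ℤ.- σ .vars 2) ℤ.*_)
                   (trans (cong₂ ℤ._-_ cur≡ (st .t≡)) (ℤ.+-inverseʳ (+ toℕ t))))
                   (ℤ.*-zeroʳ (σ .vars 6 ℤ.- σ .vars 2))) })
      split : ∀ l → rem cur ≡ l → ∃[ χ ] ψ ≡ suc χ × Run pushStep σ χ (OnPush k rest)
      split [] r≡ = let χ , ψ≡ , enough = spend 4 {(Φ D′ rem′ + D′ cur) * 4 + rest} paid in
        3 + χ , ψ≡ , run-if (λ ≢0 → absurd ≢0)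
          (λ _ → run-straight (store 12 (var 6) (op add (const 1ℤ) (arr 12 (var 6))) ⨾ store 11 (var 6)
              (arr 4 (var 6))) (record
            { cur≡ = cur≡ ; Z≈ = Z≈
            ; D≈ = D′≈
            ; pointers = pointers-write cur pointers cur≡ (trans (cong (σ .arrays 4) cur≡) (st .first≈ cur))
                (linked cur) (inc-at cur)
            ; pushing = push-relabel pushing interior r≡ λ { h refl → complete h }
            ; credit = ℕ.≤-trans enough (ℕ.n≤1+n χ) }))
        where
        D′ = D [ cur ↦ suc (D cur) ]
        rem′ = rem [ cur ↦ inc cur ]
        absurd : σ .arrays 11 (σ .vars 6) ≢ 0ℤ → Run _ σ _ _
        absurd ≢0 with pending {σ} cur pointers cur≡ ≢0
        ... | _ , _ , r , _ with () ← trans (sym r≡) r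
        D′≈ : write (σ .vars 6) (1ℤ ℤ.+ σ .arrays 12 (σ .vars 6)) (σ .arrays 12) ≈ λ v → + D′ v
        D′≈ v = trans (write-≈ {f = σ .arrays 12} cur D≈ cur≡
            (cong (λ d → 1ℤ ℤ.+ d) (trans (cong (σ .arrays 12) cur≡) (D≈ cur))) v) (same v)
          where
          same : ∀ v → ((λ v → + D v) [ cur ↦ + suc (D cur) ]) v ≡ + D′ v
          same v with cur Fin.≟ v
          ... | yes _ = refl
          ... | no _  = refl
        paid : 4 + ((Φ D′ rem′ + D′ cur) * 4 + rest) ≤ ψ
        paid = ℕ.≤-trans (ℕ.≤-reflexive (trans (cong (λ d → 4 + ((Φ D′ rem′ + d) * 4 + rest))
            (↦-hit D cur (suc (D cur))))
          (trans (arith (Φ D′ rem′) (D cur) rest) (cong (λ p → (p + D cur) * 4 + rest)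
              (potential-relabel inc D rem cur (height pushing cur) r≡))))) credit
          where
          arith : ∀ p d r → 4 + ((p + suc d) * 4 + r) ≡ (2 + p + d) * 4 + r
          arith = ℕRing.solve-∀
      split (h ∷ l) r≡ = let χ , ψ≡ , enough = spend 4 {(Φ D (rem [ cur ↦ l ]) + D cur) * 4 + rest} paid in
        3 + χ , ψ≡ , run-if (λ _ → go χ (subst ((Φ D rem + D cur) * 4 + rest ≤_) ψ≡ credit)) absurd
        where
        a≡ : at h ≡ cur
        a≡ with subst (All (λ h → at h ≡ cur)) r≡ (pointers .rem-at cur)
        ... | a ∷ _ = a
        paid : 4 + ((Φ D (rem [ cur ↦ l ]) + D cur) * 4 + rest) ≤ ψ
        paid = ℕ.≤-trans (ℕ.≤-reflexive (cong (λ p → (p + D cur) * 4 + rest) (sym (Φ-tail D rem cur r≡)))) credit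
        absurd : σ .arrays 11 (σ .vars 6) ≡ 0ℤ → Run _ σ _ _
        absurd ≡0 with () ← trans (sym r≡) (exhausted {σ} cur pointers cur≡ ≡0)
        go : ∀ χ → (Φ D rem + D cur) * 4 + rest ≤ 4 + χ → Run _ σ (2 + χ) (OnPush k rest)
        go χ cr = run-seq (run-load cur st pointers cur≡ r≡) λ { τ .(1 + χ) sm (Ld , refl) →
          let open Loaded Ld
              stτ = static-same sm st
              c≡ = trans (sm .sameVar 6) cur≡
              Zτ = λ e → trans (sm .sameArr 10 _) (Z≈ e)
              Dτ = λ v → trans (sm .sameArr 12 _) (D≈ v)
              Pτ = pointers-cong (sm .sameArr 11) pointers
              capacity = cong₂ ℤ._≤_ (trans (cong (τ .arrays 6) idx≡) (trans (sm .sameArr 6 _) (ℓ≈ (edge h))))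
                                     (cong₂ ℤ._+_ (trans (cong (τ .arrays 10) idx≡) (Zτ (edge h))) sgn≡)
              d-cur = trans (cong (τ .arrays 12) c≡) (Dτ cur)
              d-to  = cong (λ d → 1ℤ ℤ.+ d) (trans (cong (τ .arrays 12) to≡) (Dτ (to h)))
              skipping = push-advance stτ Ld r≡ c≡ Zτ Dτ Pτ pushing cr
          in run-straight (ifte (op leq (arr 6 (var 9)) (op add (arr 10 (var 9)) (var 8)))
               (ifte (op eq (arr 12 (var 6)) (op add (const 1ℤ) (arr 12 (var 17))))
                 (store 10 (var 9) (op add (arr 10 (var 9)) (var 8)) ⨾ assign 6 (var 17)) advance) advance)
             ( (λ R → (λ adm → push-over h a≡ Ld Zτ Dτ Pτ pushing cr (subst id capacity (boolℤ≢0 (_ ℤ.≤? _) R))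
                          (ℤ.+-injective (trans (sym d-cur) (trans (boolℤ≢0 (_ ℤ.≟ _) adm) d-to))))
                    , (λ ¬adm → skipping λ _ adm → boolℤ≡0 (_ ℤ.≟ _) ¬adm
                        (trans d-cur (trans (cong +_ (trans (cong D (sym a≡)) adm)) (sym d-to)))))
             , (λ ¬R → skipping λ R → ⊥-elim (boolℤ≡0 (_ ℤ.≤? _) ¬R (subst id (sym capacity) R)))) }

    -- Each pending unit reserves `(n + n) * 4` credits for the label at which it will start,
    -- bounded by `height`, and 5 for being sent: two tests, two assignments and the exit from the
    -- inner loop.
    record Idle (rest k : ℕ) (σ : State) (ψ : ℕ) : Set where
      field
        {Z}      : Edge → ℤ
        {D}      : Node → ℕ
        {rem}    : Node → List Half
        Z≈       : σ .arrays 10 ≈ Z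
        D≈       : σ .arrays 12 ≈ λ v → + D v
        pointers : Pointers (σ .arrays 11) rem
        pushing  : Pushing k s Z D rem
        k≤m      : k ≤ m
        credit   : Φ D rem * 4 + (k * ((n + n) * 4 + 5) + rest) ≤ ψ

    SomeIdle : ℕ → State → ℕ → Set
    SomeIdle rest σ ψ = ∃[ k ] σ .vars 15 ≡ + k × Idle rest k σ ψ

    run-send : ∀ {rest σ ψ} → Static σ → σ .arrays 6 ≈ ℓ → SomeIdle rest σ ψ → σ .vars 15 ≢ 0ℤ →
      ∃[ χ ] ψ ≡ suc χ × Run send σ χ (SomeIdle rest)
    run-send st ℓ≈ (zero , k≡ , _) ≢0 = ⊥-elim (≢0 k≡)
    run-send {rest} {σ} {ψ} st ℓ≈ (suc k , k≡ , I) _ = let χ , ψ≡ , enough = spend 5 {base + (n + n) * 4} paid in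
      4 + χ , ψ≡ ,
      run-seq {P = λ τ ω → τ ≡ setVar 15 (σ .vars 15 ℤ.- 1ℤ) σ × ω ≡ 3 + χ}
          (run-straight (assign 15 (op sub (var 15) (const 1ℤ))) (refl , refl))
      λ { τ .(3 + χ) sm (refl , refl) → run-if
        (λ ≢0 → launch χ enough τ sm (σ .arrays 6 (σ .vars 15 ℤ.- 1ℤ)) refl ≢0)
        (λ ≡0 → run-straight skip (k , i≡k , record
          { Z≈ = Z≈ ; D≈ = D≈ ; pointers = pointers ; pushing = subst (λ k → Pushing k s Z D rem) i≡
              (push-idle {i} start (trans (sym ℓ-at) ≡0))
          ; k≤m = ℕ.<⇒≤ k≤m ; credit = ℕ.≤-trans (ℕ.m≤m+n base _) (ℕ.≤-trans enough (ℕ.n≤1+n χ)) })) }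
      where
      open Idle I
      base = Φ D rem * 4 + (k * ((n + n) * 4 + 5) + rest)
      i : Edge
      i = fromℕ< k≤m
      i≡ : toℕ i ≡ k
      i≡ = toℕ-fromℕ< k≤m
      i≡k : σ .vars 15 ℤ.- 1ℤ ≡ + k
      i≡k = cong (ℤ._- 1ℤ) k≡
      index≡ : σ .vars 15 ℤ.- 1ℤ ≡ + toℕ i
      index≡ = trans i≡k (cong +_ (sym i≡))
      ℓ-at : σ .arrays 6 (σ .vars 15 ℤ.- 1ℤ) ≡ ℓ i
      ℓ-at = trans (cong (σ .arrays 6) index≡) (ℓ≈ i)
      start : Pushing (suc (toℕ i)) s Z D rem
      start = subst (λ k → Pushing (suc k) s Z D rem) (sym i≡) pushing
      paid : 5 + (base + (n + n) * 4) ≤ ψ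
      paid = ℕ.≤-trans (ℕ.≤-reflexive (arith (Φ D rem) k ((n + n) * 4) rest)) credit
        where
        arith : ∀ p k c r → 5 + (p * 4 + (k * (c + 5) + r) + c) ≡ p * 4 + (suc k * (c + 5) + r)
        arith = ℕRing.solve-∀
      launch : ∀ χ → base + (n + n) * 4 ≤ χ → ∀ τ → Same (assign 15 (op sub (var 15) (const 1ℤ))) σ τ → ∀ z → z ≡ σ
          .arrays 6 (σ .vars 15 ℤ.- 1ℤ) → z ≢ 0ℤ →
        Run (assign 6 (arr 2 (var 15)) ⨾ while outside pushStep) (setVar 15 (σ .vars 15 ℤ.- 1ℤ) σ) (2 + χ)
            (SomeIdle rest)
      launch χ enough _ _ z refl ≢0 =
        run-seq {P = λ υ ω → OnPush k (k * ((n + n) * 4 + 5) + rest) υ χ × υ .vars 15 ≡ + k × ω ≡ suc χ}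
          (run-straight (assign 6 (arr 2 (var 15))) (record
            { cur≡ = trans (cong (σ .arrays 2) index≡) (st .head≈ i) ; Z≈ = Z≈ ; D≈ = D≈ ; pointers = pointers
            ; pushing = subst (λ k → Pushing k (head i) Z D rem) i≡
                (push-launch {i} start (ℓ≢0 i (λ z → ≢0 (trans ℓ-at z))))
            ; credit = ℕ.≤-trans (ℕ.≤-trans (ℕ.≤-reflexive
                (arith (Φ D rem) (D (head i)) (k * ((n + n) * 4 + 5) + rest)))
                (ℕ.+-monoʳ-≤ base (ℕ.*-monoˡ-≤ 4 (ℕ.<⇒≤ (height pushing (head i)))))) enough } , i≡k , refl))
          λ { υ .(suc χ) sm₁ (J , 15≡ , refl) → run-mono
            (run-while {b = outside} (OnPush k (k * ((n + n) * 4 + 5) + rest)) J λ {τ′} sm₂ J′ ≢0 →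
              push-body (static-same sm₂ (static-same sm₁
                  (static-same (exec-same {assign 15 (op sub (var 15) (const 1ℤ))} assign) st)))
                (λ e → trans (sm₂ .sameArr 6 _) (trans (sm₁ .sameArr 6 _) (ℓ≈ e))) J′ ≢0)
            λ { υ′ ω′ sm₃ (sm₂ , J′ , ≡0) → k , trans (sm₂ .sameVar 15) 15≡ ,
              finish (static-same sm₂ (static-same sm₁
                  (static-same (exec-same {assign 15 (op sub (var 15) (const 1ℤ))} assign) st))) J′ ≡0 } }
        where
        arith : ∀ p d r → (p + d) * 4 + r ≡ p * 4 + r + d * 4
        arith = ℕRing.solve-∀
        finish : ∀ {υ ω} → Static υ → OnPush k (k * ((n + n) * 4 + 5) + rest) υ ω → ⟦ outside ⟧ υ ≡ 0ℤ → Idle rest k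
            υ ω
        finish {υ} stυ J ≡0 = record
          { Z≈ = J.Z≈ ; D≈ = J.D≈ ; pointers = J.pointers ; pushing = push-land J.pushing landed ; k≤m = ℕ.<⇒≤ k≤m
          ; credit = ℕ.≤-trans (ℕ.+-monoˡ-≤ _ (ℕ.*-monoˡ-≤ 4 (ℕ.m≤m+n (Φ J.D J.rem) (J.D J.cur)))) J.credit }
          where
          module J = OnPush J
          landed : J.cur ≡ s ⊎ J.cur ≡ t
          landed with ℤ.i*j≡0⇒i≡0∨j≡0 (υ .vars 6 ℤ.- υ .vars 2) ≡0
          ... | inj₁ q = inj₁ (+toℕ-injective (trans (sym J.cur≡)
              (trans (ℤ.i-j≡0⇒i≡j (υ .vars 6) (υ .vars 2) q) (stυ .s≡))))
          ... | inj₂ q = inj₂ (+toℕ-injective (trans (sym J.cur≡)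
              (trans (ℤ.i-j≡0⇒i≡j (υ .vars 6) (υ .vars 3) q) (stυ .t≡))))

    record Covered (rest : ℕ) (σ : State) (ψ : ℕ) : Set where
      field
        {Z}     : Edge → ℤ
        {k}     : ℕ
        Z≈      : σ .arrays 10 ≈ Z
        minimal : MinimalCover Z k
        credit  : rest ≤ ψ

    pushBudget : ℕ → ℕ
    pushBudget rest = 2 + (n * 3 + (2 + (n * 3 + (2 + (Φ sinkLabel inc * 4 + (m * ((n + n) * 4 + 5) + rest))))))

    run-push : ∀ {σ Z rest} → Static σ → σ .arrays 6 ≈ ℓ → σ .arrays 10 ≈ Z → Pulling m s Z → Run push σ
        (pushBudget rest) (Covered rest)
    run-push {σ} {Z} {rest} st ℓ≈ Z≈ S =
      run-seq (run-reset st) λ { σ₁ _ sm₁ (P , refl) →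
      let st₁ = static-same sm₁ st in
      run-seq (run-fill {N = n} (λ v → + sinkLabel v) (st₁ .n≡) λ {τ} sm v 5≡ →
        labels v (trans (sm .sameVar 0) (st₁ .n≡)) 5≡ (trans (sm .sameVar 3) (st₁ .t≡))) λ { σ₂ _ sm₂ (D≈ , refl) →
      let st₂ = static-same sm₂ st₁ in
      run-seq {P = λ τ ψ → τ ≡ setVar 15 (σ₂ .vars 1) σ₂ × ψ ≡ 1 +
          (Φ sinkLabel inc * 4 + (m * ((n + n) * 4 + 5) + rest))}
        (run-straight (assign 15 (var 1)) (refl , refl)) λ { σ₃ _ sm₃ (refl , refl) →
      run-mono (run-while {b = var 15} {p = send} (SomeIdle rest)
        (m , st₂ .m≡ , record
          { Z≈ = λ e → trans (sm₂ .sameArr 10 _) (trans (sm₁ .sameArr 10 _) (Z≈ e)) ; D≈ = D≈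
          ; pointers = pointers-cong (sm₂ .sameArr 11) P ; pushing = push-start S complete ; k≤m = ℕ.≤-refl ;
              credit = ℕ.≤-refl })
        λ sm I ≢0 → run-send (static-same sm (static-same sm₃ st₂))
            (λ e → trans (sm .sameArr 6 _) (trans (sm₂ .sameArr 6 _) (trans (sm₁ .sameArr 6 _) (ℓ≈ e)))) I ≢0)
      λ { τ ψ _ (_ , (k , k≡ , I) , ≡0) → finish k (ℤ.+-injective (trans (sym k≡) ≡0)) I } }}}
      where
      labels : ∀ {a b c} v → a ≡ + n → b ≡ + toℕ v → c ≡ + toℕ t → a ℤ.* (if does (b ℤ.≟ c) then 1ℤ else 0ℤ) ≡ +
          sinkLabel v
      labels v refl refl refl with v Fin.≟ t
      ... | yes q = trans (cong ((+ n) ℤ.*_) (boolℤ-yes (_ ℤ.≟ _) (cong (+_ ∘ toℕ) q))) (ℤ.*-identityʳ (+ n))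
      ... | no r  = trans (cong ((+ n) ℤ.*_) (boolℤ-no (_ ℤ.≟ _) (r ∘ +toℕ-injective))) (ℤ.*-zeroʳ (+ n))
      finish : ∀ k {τ ψ} → k ≡ 0 → Idle rest k τ ψ → Covered rest τ ψ
      finish _ refl I = record { Z≈ = I.Z≈ ; minimal = proj₂ (push-done ℓ≥0 ℓ≤1 I.pushing) ; credit = ℕ.≤-trans
          (ℕ.m≤n+m rest _) I.credit }
        where module I = Idle I

-- Reading the input and building the lists.

entry-triples : ∀ {M N} (a b c : Fin M → ℤ) (g : Fin N → Fin M) i →
  let zs = concatMap (λ e → a e ∷ b e ∷ [ c e ]) (tabulate g) in
  entry zs (toℕ i * 3) ≡ a (g i) × entry zs (1 + toℕ i * 3) ≡ b (g i) × entry zs (2 + toℕ i * 3) ≡ c (g i)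
entry-triples a b c g Fin.zero    = refl , refl , refl
entry-triples a b c g (Fin.suc i) = entry-triples a b c (g ∘ Fin.suc) i

∣∣≤‖‖ : ∀ {N} (X : Fin N → ℤ) e → ∣ X e ∣ ≤ ‖ X ‖
∣∣≤‖‖ {N} X e = All.lookup (xs≤max 0 (map (λ e → ∣ X e ∣) (allFin N))) (∈-map⁺ (λ e → ∣ X e ∣) (∈-allFin e))

module Setup (G : STDAG) (X : Fin (STDAG.m G) → ℤ) where
  open Network G
  open Layout G

  support : Edge → ℤ
  support e = 1ℤ ℤ.- (if does (X e ℤ.≟ 0ℤ) then 1ℤ else 0ℤ)

  support-0 : ∀ {e} → X e ≡ 0ℤ → support e ≡ 0ℤ
  support-0 {e} q = cong (λ b → 1ℤ ℤ.- b) (boolℤ-yes (X e ℤ.≟ 0ℤ) q)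

  support-1 : ∀ {e} → X e ≢ 0ℤ → support e ≡ 1ℤ
  support-1 {e} q = cong (λ b → 1ℤ ℤ.- b) (boolℤ-no (X e ℤ.≟ 0ℤ) q)

  support≥0 : ∀ e → 0ℤ ℤ.≤ support e
  support≥0 e = go (X e ℤ.≟ 0ℤ)
    where
    go : Dec (X e ≡ 0ℤ) → 0ℤ ℤ.≤ support e
    go (yes q) = ℤ.≤-reflexive (sym (support-0 q))
    go (no q)  = subst (0ℤ ℤ.≤_) (sym (support-1 q)) (+≤+ z≤n)

  support≤1 : ∀ e → support e ℤ.≤ 1ℤ
  support≤1 e = go (X e ℤ.≟ 0ℤ)
    where
    go : Dec (X e ≡ 0ℤ) → support e ℤ.≤ 1ℤ
    go (yes q) = subst (ℤ._≤ 1ℤ) (sym (support-0 q)) (+≤+ z≤n)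
    go (no q)  = ℤ.≤-reflexive (support-1 q)

  Linked-write : ∀ {f c v} l → All (λ h → code h ≢ c) l → Linked (f ∘ code) l → Linked (write c v f ∘ code) l
  Linked-write []      _        _        = tt
  Linked-write {f} {c} {v} (h ∷ l) (≢ ∷ al) (q , lk) = trans (write-miss {v = v} f (≢ ∘ sym)) q , Linked-write {f}
      {c} {v} l al lk

  record Lists (f₃ f₄ : ℤ → ℤ) (inc : Node → List Half) : Set where
    field
      first≈ : f₄ ≈ λ v → hd (inc v)
      linked : ∀ v → Linked (f₃ ∘ code) (inc v)
      inc-at : ∀ v → All (λ h → at h ≡ v) (inc v)

  insert : Half → (Node → List Half) → Node → List Half
  insert h inc = inc [ at h ↦ h ∷ inc (at h) ]

  -- The new half-edge is in no list yet, so writing its `next` cell disturbs none of the existing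
  -- links.
  lists-insert : ∀ {f₃ f₄ inc i₃ i₄ v₃ v₄} h → Lists f₃ f₄ inc → (∀ v → h ∉ inc v) →
    i₃ ≡ code h → v₃ ≡ hd (inc (at h)) → i₄ ≡ + toℕ (at h) → v₄ ≡ code h →
    Lists (write i₃ v₃ f₃) (write i₄ v₄ f₄) (insert h inc)
  lists-insert {f₃} {f₄} {inc} {v₃ = v₃} h L fresh refl v₃≡ i₄≡ v₄≡ = record
    { first≈ = λ v → trans (write-≈ {f = f₄} (at h) L.first≈ i₄≡ v₄≡ v) (first′ v)
    ; linked = linked′
    ; inc-at = inc-at′ }
    where
    module L = Lists L
    others : ∀ v → All (λ g → code g ≢ code h) (inc v)
    others v = All.tabulate λ {g} g∈ q → fresh v (subst (_∈ inc v) (code-injective q) g∈)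
    first′ : ∀ v → ((λ v → hd (inc v)) [ at h ↦ code h ]) v ≡ hd (insert h inc v)
    first′ v with at h Fin.≟ v
    ... | yes _ = refl
    ... | no _  = refl
    linked′ : ∀ v → Linked (write (code h) v₃ f₃ ∘ code) (insert h inc v)
    linked′ v with at h Fin.≟ v
    ... | yes refl = trans (write-hit {v = v₃} f₃ refl) v₃≡ , Linked-write {f₃} (inc (at h)) (others (at h))
        (L.linked (at h))
    ... | no _     = Linked-write {f₃} (inc v) (others v) (L.linked v)
    inc-at′ : ∀ v → All (λ g → at g ≡ v) (insert h inc v)
    inc-at′ v with at h Fin.≟ v
    ... | yes refl = refl ∷ L.inc-at (at h)
    ... | no _     = L.inc-at v

  insert-new : ∀ h inc → h ∈ insert h inc (at h)
  insert-new h inc = subst (h ∈_) (sym (↦-hit inc (at h) (h ∷ inc (at h)))) (here refl)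

  insert-old : ∀ h inc {g v} → g ∈ inc v → g ∈ insert h inc v
  insert-old h inc {g} {v} g∈ with at h Fin.≟ v
  ... | yes refl = there g∈
  ... | no _     = g∈

  insert-inv : ∀ h inc {g v} → g ∈ insert h inc v → g ≡ h ⊎ g ∈ inc v
  insert-inv h inc {g} {v} g∈ with at h Fin.≟ v | g∈
  ... | yes refl | here q   = inj₁ q
  ... | yes refl | there g∈ = inj₂ g∈
  ... | no _     | g∈       = inj₂ g∈

  insert-size : ∀ h inc → sizeOf (insert h inc) ≡ suc (sizeOf inc)
  insert-size h inc = ℕ.+-cancelʳ-≡ (length (inc (at h))) _ _
      (trans (sizeOf-[↦] inc (at h) (h ∷ inc (at h))) (ℕ.+-suc (sizeOf inc) (length (inc (at h)))))

  record Chained (k : ℕ) (σ : State) : Set where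
    field
      {inc}    : Node → List Half
      lists    : Lists (σ .arrays 3) (σ .arrays 4) inc
      complete : ∀ h → toℕ (edge h) < k → h ∈ inc (at h)
      bounded  : ∀ {h v} → h ∈ inc v → toℕ (edge h) < k
      size     : sizeOf inc ≡ k * 2

  chain-step : ∀ {σ} (e : Edge) → σ .vars 15 ≡ + toℕ e → σ .arrays 7 ≈ (λ e → + toℕ (tail e)) → σ .arrays 2 ≈
      (λ e → + toℕ (head e)) → Chained (toℕ e) σ →
    wp (store 3 (op add (const 1ℤ) (var 15)) (arr 4 (arr 7 (var 15))) ⨾ store 4 (arr 7 (var 15))
        (op add (const 1ℤ) (var 15)) ⨾
        store 3 (op sub (const ℤ.-1ℤ) (var 15)) (arr 4 (arr 2 (var 15))) ⨾ store 4 (arr 2 (var 15))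
            (op sub (const ℤ.-1ℤ) (var 15)))
      (λ τ → ∀ z → Chained (suc (toℕ e)) (setVar 15 z τ)) σ
  chain-step {σ} e e≡ tail≈ head≈ C z = record
    { inc = inc₂
    ; lists = L₂
    ; complete = complete′
    ; bounded = λ h∈ → bounded′ (insert-inv (inn e) inc₁ h∈)
    ; size = trans (insert-size (inn e) inc₁) (cong suc (trans (insert-size (out e) inc) (cong suc size))) }
    where
    open Chained C
    inc₁ inc₂ : Node → List Half
    inc₁ = insert (out e) inc
    inc₂ = insert (inn e) inc₁
    out≡ : 1ℤ ℤ.+ σ .vars 15 ≡ code (out e)
    out≡ = cong (λ z → 1ℤ ℤ.+ z) e≡
    minus : ∀ k → ℤ.-1ℤ ℤ.- + k ≡ -[1+ k ]
    minus zero    = refl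
    minus (suc k) = refl
    inn≡ : ℤ.-1ℤ ℤ.- σ .vars 15 ≡ code (inn e)
    inn≡ = trans (cong (λ z → ℤ.-1ℤ ℤ.- z) e≡) (minus (toℕ e))
    tail≡ : σ .arrays 7 (σ .vars 15) ≡ + toℕ (tail e)
    tail≡ = trans (cong (σ .arrays 7) e≡) (tail≈ e)
    head≡ : σ .arrays 2 (σ .vars 15) ≡ + toℕ (head e)
    head≡ = trans (cong (σ .arrays 2) e≡) (head≈ e)
    fresh : ∀ h → edge h ≡ e → ∀ v → h ∉ inc v
    fresh h refl v h∈ = ℕ.<-irrefl refl (bounded h∈)
    f₄ : ℤ → ℤ
    f₄ = write (σ .arrays 7 (σ .vars 15)) (1ℤ ℤ.+ σ .vars 15) (σ .arrays 4)
    L₁ : Lists (write (1ℤ ℤ.+ σ .vars 15) (σ .arrays 4 (σ .arrays 7 (σ .vars 15))) (σ .arrays 3)) f₄ inc₁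
    L₁ = lists-insert (out e) lists (fresh (out e) refl) out≡
        (trans (cong (σ .arrays 4) tail≡) (Lists.first≈ lists (tail e))) tail≡ out≡
    fresh₁ : ∀ v → inn e ∉ inc₁ v
    fresh₁ v h∈ with insert-inv (out e) inc h∈
    ... | inj₂ h∈ = fresh (inn e) refl v h∈
    L₂ : Lists _ _ inc₂
    L₂ = lists-insert (inn e) L₁ fresh₁ inn≡ (trans (cong f₄ head≡) (Lists.first≈ L₁ (head e))) head≡ inn≡
    complete′ : ∀ h → toℕ (edge h) < suc (toℕ e) → h ∈ inc₂ (at h)
    complete′ h h≤ with edge h Fin.≟ e
    complete′ (out _) h≤ | yes refl = insert-old (inn e) inc₁ (insert-new (out e) inc)
    complete′ (inn _) h≤ | yes refl = insert-new (inn e) inc₁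
    complete′ h h≤ | no ≢ = insert-old (inn e) inc₁
        (insert-old (out e) inc (complete h (ℕ.≤∧≢⇒< (ℕ.≤-pred h≤) (≢ ∘ toℕ-injective))))
    bounded′ : ∀ {h v} → h ≡ inn e ⊎ h ∈ inc₁ v → toℕ (edge h) < suc (toℕ e)
    bounded′ (inj₁ refl) = ℕ.≤-refl
    bounded′ (inj₂ h∈) with insert-inv (out e) inc h∈
    ... | inj₁ refl = ℕ.≤-refl
    ... | inj₂ h∈′  = ℕ.m<n⇒m<1+n (bounded h∈′)

  -- A node without an in-edge among those read so far stays in the second alternative; after all
  -- edges this can only be `s`.
  Parented : ℕ → State → Set
  Parented k σ = ∀ v → (∃[ e ] head e ≡ v × σ .arrays 9 (+ toℕ v) ≡ + toℕ e) ⊎ (∀ e → toℕ e < k → head e ≢ v)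

  parent-step : ∀ {σ} (e : Edge) → σ .vars 15 ≡ + toℕ e → σ .arrays 2 ≈ (λ e → + toℕ (head e)) → Parented (toℕ e) σ →
    ∀ z → Parented (suc (toℕ e)) (setVar 15 z (setArr 9 (σ .arrays 2 (σ .vars 15)) (σ .vars 15) σ))
  parent-step {σ} e e≡ head≈ Pa z v with head e Fin.≟ v
  ... | yes refl = inj₁ (e , refl , trans (write-hit {v = σ .vars 15} (σ .arrays 9)
      (trans (cong (σ .arrays 2) e≡) (head≈ e))) e≡)
  ... | no h≢v with Pa v
  ...   | inj₁ (f , q , r) = inj₁ (f , q , trans (write-miss {v = σ .vars 15} (σ .arrays 9)
      (λ q → h≢v (+toℕ-injective (trans (sym (trans (cong (σ .arrays 2) e≡) (head≈ e))) q)))) r)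
  ...   | inj₂ none = inj₂ later
    where
    later : ∀ f → toℕ f < suc (toℕ e) → head f ≢ v
    later f f≤e with f Fin.≟ e
    ... | yes refl = h≢v
    ... | no f≢e   = none f (ℕ.≤∧≢⇒< (ℕ.≤-pred f≤e) (f≢e ∘ toℕ-injective))

  -- The computed maximum enters through two inequalities: `bounds` feeds the halving of the norm,
  -- and `M≤‖X‖` limits the number of rounds.
  record Normed (k : ℕ) (σ : State) : Set where
    field
      {M}     : ℕ
      M≡      : σ .vars 4 ≡ + M
      bounds  : ∀ e → toℕ e < k → ∣ X e ∣ ≤ M
      M≤‖X‖   : M ≤ ‖ X ‖

  abs≡ : ∀ x → x ℤ.* (+ 2 ℤ.* (if does (0ℤ ℤ.≤? x) then 1ℤ else 0ℤ) ℤ.- 1ℤ) ≡ + ∣ x ∣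
  abs≡ (+ k)      = ℤ.*-identityʳ (+ k)
  abs≡ (-[1+ k ]) = cong +_ (ℕ.*-identityʳ (suc k))

  norm-step : ∀ {σ} (e : Edge) → σ .vars 15 ≡ + toℕ e → σ .arrays 5 ≈ X → Normed (toℕ e) σ →
    wp (assign 9 (op mul (arr 5 (var 15)) (op sub (op mul (const (+ 2)) (op leq (const 0ℤ) (arr 5 (var 15))))
        (const 1ℤ))) ⨾
        ifte (op leq (var 4) (var 9)) (assign 4 (var 9)) skip) (λ τ → ∀ z → Normed (suc (toℕ e)) (setVar 15 z τ)) σ
  norm-step {σ} e e≡ X≈ N = (λ ≢0 z → record
      { M≡ = q≡ ; bounds = extend (bigger ≢0) ℕ.≤-refl ; M≤‖X‖ = ∣∣≤‖‖ X e })
    , (λ ≡0 z → record { M≡ = M≡ ; bounds = extend ℕ.≤-refl (smaller ≡0) ; M≤‖X‖ = M≤‖X‖ })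
    where
    open Normed N
    q : ℤ
    q = σ .arrays 5 (σ .vars 15) ℤ.* (+ 2 ℤ.* (if does (0ℤ ℤ.≤? σ .arrays 5 (σ .vars 15)) then 1ℤ else 0ℤ) ℤ.- 1ℤ)
    q≡ : q ≡ + ∣ X e ∣
    q≡ = trans (abs≡ (σ .arrays 5 (σ .vars 15))) (cong (+_ ∘ ∣_∣) (trans (cong (σ .arrays 5) e≡) (X≈ e)))
    bigger : (if does (σ .vars 4 ℤ.≤? q) then 1ℤ else 0ℤ) ≢ 0ℤ → M ≤ ∣ X e ∣
    bigger ≢0 = ℤ.drop‿+≤+ (subst₂ ℤ._≤_ M≡ q≡ (boolℤ≢0 (_ ℤ.≤? _) ≢0))
    smaller : (if does (σ .vars 4 ℤ.≤? q) then 1ℤ else 0ℤ) ≡ 0ℤ → ∣ X e ∣ ≤ M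
    smaller ≡0 = ℕ.<⇒≤ (ℕ.≰⇒> λ M≤ → boolℤ≡0 (_ ℤ.≤? _) ≡0 (subst₂ ℤ._≤_ (sym M≡) (sym q≡) (+≤+ M≤)))
    extend : ∀ {M′} → M ≤ M′ → ∣ X e ∣ ≤ M′ → ∀ f → toℕ f < suc (toℕ e) → ∣ X f ∣ ≤ M′
    extend M≤ X≤ f f≤e with f Fin.≟ e
    ... | yes refl = X≤
    ... | no f≢e   = ℕ.≤-trans (bounds f (ℕ.≤∧≢⇒< (ℕ.≤-pred f≤e) (f≢e ∘ toℕ-injective))) M≤

  record Ready (rest : ℕ) (σ : State) (ψ : ℕ) : Set where
    field
      adj     : Adjacency
      static  : Represented.Static adj σ
      parents : ∀ {v} → v ≢ s → ∃[ e ] head e ≡ v × σ .arrays 9 (+ toℕ v) ≡ + toℕ e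
      X≈      : σ .arrays 5 ≈ X
      ℓ≈      : σ .arrays 6 ≈ support
      Z≈      : ∀ j → σ .arrays 10 j ≡ 0ℤ
      {M}     : ℕ
      M≡      : σ .vars 4 ≡ + M
      bounds  : ∀ e → ∣ X e ∣ ≤ M
      M≤‖X‖   : M ≤ ‖ X ‖
      credit  : ψ ≡ rest

  private
    σ₀ σ₁ : State
    σ₀ = initial (encodeInput G X)
    σ₁ = setVar 3 (+ toℕ t) (setVar 2 (+ toℕ s) (setVar 1 (+ m) (setVar 0 (+ n) σ₀)))

  setupBudget : ℕ → ℕ
  setupBudget rest = 1 + (2 + (m * 3 + (2 + (m * 3 +
      (2 + (m * 3 + (2 + (m * 3 + (2 + (m * 3 + (2 + (m * 3 + (2 + (m * 3 + rest))))))))))))))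

  run-setup : ∀ {rest} → Run setup σ₀ (setupBudget rest) (Ready rest)
  run-setup {rest} =
    run-seq {P = λ τ ψ → τ ≡ σ₁ × ψ ≡ 2 + (m * 3 + (2 +
        (m * 3 + (2 + (m * 3 + (2 + (m * 3 + (2 + (m * 3 + (2 + (m * 3 + (2 + (m * 3 + rest)))))))))))))}
      (run-straight constants (refl , refl)) λ { _ _ _ (refl , refl) →
    run-seq (run-fill {N = m} (λ e → + toℕ (tail e)) refl λ {τ} sm e 5≡ → trans (input 4 sm 5≡) (proj₁ (triple e))) λ
        { σ₂ _ sm₂ (tail≈ , refl) →
    run-seq (run-fill {N = m} (λ e → + toℕ (head e)) (sm₂ .sameVar 1) λ {τ} sm e 5≡ →
      trans (sm .sameArr 0 _) (trans (sm₂ .sameArr 0 _) (trans (index-input 5 5≡) (proj₁ (proj₂ (triple e)))))) λ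
          { σ₃ _ sm₃ (head≈ , refl) →
    run-seq (run-fill {N = m} X (trans (sm₃ .sameVar 1) (sm₂ .sameVar 1)) λ {τ} sm e 5≡ →
      trans (sm .sameArr 0 _) (trans (sm₃ .sameArr 0 _)
          (trans (sm₂ .sameArr 0 _) (trans (index-input 6 5≡) (proj₂ (proj₂ (triple e))))))) λ
          { σ₄ _ sm₄ (X≈ , refl) →
    run-seq (run-fill {N = m} support (trans (sm₄ .sameVar 1) (trans (sm₃ .sameVar 1) (sm₂ .sameVar 1))) λ {τ} sm e
        5≡ →
      cong (λ x → 1ℤ ℤ.- (if does (x ℤ.≟ 0ℤ) then 1ℤ else 0ℤ))
          (trans (cong (τ .arrays 5) 5≡) (trans (sm .sameArr 5 _) (X≈ e)))) λ { σ₅ _ sm₅ (ℓ≈ , refl) →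
    let m₅ = trans (sm₅ .sameVar 1) (trans (sm₄ .sameVar 1) (trans (sm₃ .sameVar 1) (sm₂ .sameVar 1)))
        tail₅ = λ e → trans (sm₅ .sameArr 7 _) (trans (sm₄ .sameArr 7 _) (trans (sm₃ .sameArr 7 _) (tail≈ e)))
        head₅ = λ e → trans (sm₅ .sameArr 2 _) (trans (sm₄ .sameArr 2 _) (head≈ e))
        X₅ = λ e → trans (sm₅ .sameArr 5 _) (X≈ e)
        zero₅ = λ j → trans (sm₅ .sameArr 4 j) (trans (sm₄ .sameArr 4 j)
            (trans (sm₃ .sameArr 4 j) (sm₂ .sameArr 4 j))) in
    run-seq (run-for-straight {N = m} Chained m₅ (λ z → chain-start zero₅)
      λ e {τ} sm e≡ C → chain-step {τ} e e≡ (λ f → trans (sm .sameArr 7 _) (tail₅ f))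
          (λ f → trans (sm .sameArr 2 _) (head₅ f)) C) λ { σ₆ _ sm₆ (C , refl) →
    run-seq (run-for-straight {N = m} Parented (trans (sm₆ .sameVar 1) m₅) (λ z v → inj₂ λ _ ())
      λ e {τ} sm e≡ Pa → parent-step {τ} e e≡ (λ f → trans (sm .sameArr 2 _) (trans (sm₆ .sameArr 2 _) (head₅ f)))
          Pa) λ { σ₇ _ sm₇ (Pa , refl) →
    run-mono (run-for-straight {N = m} Normed (trans (sm₇ .sameVar 1) (trans (sm₆ .sameVar 1) m₅))
      (λ z → record { M≡ = trans (sm₇ .sameVar 4) (trans (sm₆ .sameVar 4)
          (trans (sm₅ .sameVar 4) (trans (sm₄ .sameVar 4) (trans (sm₃ .sameVar 4) (sm₂ .sameVar 4)))))
                    ; bounds = λ _ () ; M≤‖X‖ = z≤n })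
      λ e {τ} sm e≡ N → norm-step {τ} e e≡ (λ f → trans (sm .sameArr 5 _)
          (trans (sm₇ .sameArr 5 _) (trans (sm₆ .sameArr 5 _) (X₅ f)))) N) λ { σ₈ _ sm₈ (N , ψ≡) →
    let module C = Chained C
        module L = Lists C.lists
        var₈ : ∀ x {a} {b} {c} {d} {e} {f} {g} → σ₈ .vars x ≡ σ₁ .vars x
        var₈ x {a} {b} {c} {d} {e} {f} {g} = trans (sm₈ .sameVar x {a})
            (trans (sm₇ .sameVar x {b}) (trans (sm₆ .sameVar x {c}) (trans (sm₅ .sameVar x {d})
          (trans (sm₄ .sameVar x {e}) (trans (sm₃ .sameVar x {f}) (sm₂ .sameVar x {g}))))))
        adj : Adjacency
        adj = record { inc = C.inc ; next = σ₆ .arrays 3 ∘ code ; linked = L.linked ; inc-at = L.inc-at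
                     ; complete = λ h → C.complete h (toℕ<n (edge h)) ; size = C.size }
    in record
      { adj = adj
      ; static = record
        { n≡ = var₈ 0 ; m≡ = var₈ 1 ; s≡ = var₈ 2 ; t≡ = var₈ 3
        ; head≈ = λ e → trans (sm₈ .sameArr 2 _) (trans (sm₇ .sameArr 2 _) (trans (sm₆ .sameArr 2 _) (head₅ e)))
        ; tail≈ = λ e → trans (sm₈ .sameArr 7 _) (trans (sm₇ .sameArr 7 _) (trans (sm₆ .sameArr 7 _) (tail₅ e)))
        ; next≡ = λ h → trans (sm₈ .sameArr 3 _) (sm₇ .sameArr 3 _)
        ; first≈ = λ v → trans (sm₈ .sameArr 4 _) (trans (sm₇ .sameArr 4 _) (L.first≈ v)) }
      ; parents = λ v≢s → parented {σ₇} {σ₈} (λ j → sm₈ .sameArr 9 j) Pa v≢s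
      ; X≈ = λ e → trans (sm₈ .sameArr 5 _) (trans (sm₇ .sameArr 5 _) (trans (sm₆ .sameArr 5 _) (X₅ e)))
      ; ℓ≈ = λ e → trans (sm₈ .sameArr 6 _) (trans (sm₇ .sameArr 6 _) (trans (sm₆ .sameArr 6 _) (ℓ≈ e)))
      ; Z≈ = λ j → trans (sm₈ .sameArr 10 j) (trans (sm₇ .sameArr 10 j)
          (trans (sm₆ .sameArr 10 j) (trans (sm₅ .sameArr 10 j)
          (trans (sm₄ .sameArr 10 j) (trans (sm₃ .sameArr 10 j) (sm₂ .sameArr 10 j))))))
      ; M≡ = Normed.M≡ N ; bounds = λ e → Normed.bounds N e (toℕ<n e) ; M≤‖X‖ = Normed.M≤‖X‖ N
      ; credit = ψ≡ } }}}}}}}}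
    where
    triple = entry-triples (λ e → + toℕ (tail e)) (λ e → + toℕ (head e)) X id
    index-input : ∀ {z} {e : Edge} j → z ≡ + toℕ e → σ₀ .arrays 0 (+ j ℤ.+ z ℤ.* + 3) ≡ entry (encodeInput G X)
        (j + toℕ e * 3)
    index-input {e = e} j refl = cong (λ z → σ₀ .arrays 0 (+ j ℤ.+ z)) (sym (ℤ.pos-* (toℕ e) 3))
    input : ∀ {p τ z} {_ : T (not (writesArr 0 p))} {e : Edge} j → Same p σ₁ τ → z ≡ + toℕ e → τ .arrays 0
        (+ j ℤ.+ z ℤ.* + 3) ≡ entry (encodeInput G X) (j + toℕ e * 3)
    input {p} {_} {_} {w} j sm z≡ = trans (sm .sameArr 0 {w} _) (index-input j z≡)
    chain-start : ∀ {τ z} → (∀ j → τ .arrays 4 j ≡ 0ℤ) → Chained 0 (setVar 15 z τ)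
    chain-start zeros = record
      { inc = λ _ → [] ; lists = record { first≈ = λ v → zeros _ ; linked = λ _ → tt ; inc-at = λ _ → [] }
      ; complete = λ _ () ; bounded = λ () ; size = trans (∑ℕ-const n 0) (ℕ.*-zeroʳ n) }
    parented : ∀ {σ τ} → (∀ j → τ .arrays 9 j ≡ σ .arrays 9 j) → Parented m σ → ∀ {v} → v ≢ s → ∃[ e ] head e ≡ v × τ
        .arrays 9 (+ toℕ v) ≡ + toℕ e
    parented sm Pa {v} v≢s with Pa v
    ... | inj₁ (e , q , r) = e , q , trans (sm _) r
    ... | inj₂ none = let e , q = in-edge v≢s in ⊥-elim (none e (toℕ<n e) q)

-- Arithmetic of halving.

small⇒0 : ∀ k → ℤ.-1ℤ ℤ.≤ + 2 ℤ.* k → + 2 ℤ.* k ℤ.≤ 1ℤ → k ≡ 0ℤ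
small⇒0 (+ zero)     _  _  = refl
small⇒0 (+ (suc k))  _  (+≤+ (s≤s h)) with () ← ℕ.≤-trans (ℕ.≤-reflexive (sym (ℕ.+-suc k (k + 0)))) h
small⇒0 (-[1+ k ])   (ℤ.-≤- h) _ with () ← ℕ.≤-trans (ℕ.≤-reflexive (sym (ℕ.+-suc k (k + 0)))) h

-- An even number that is at least -1 is at least 0. Through this, integrality absorbs the last unit
-- of rounding error.
nonneg-half : ∀ k → ℤ.-1ℤ ℤ.≤ + 2 ℤ.* k → 0ℤ ℤ.≤ k
nonneg-half (+ k)      _ = +≤+ z≤n
nonneg-half (-[1+ k ]) (ℤ.-≤- h) with () ← ℕ.≤-trans (ℕ.≤-reflexive (sym (ℕ.+-suc k (k + 0)))) h

⌊r+q*2/2⌋≡q : ∀ r q → r < 2 → ℕ.⌊ r + q * 2 /2⌋ ≡ q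
⌊r+q*2/2⌋≡q 0 zero    _ = refl
⌊r+q*2/2⌋≡q 1 zero    _ = refl
⌊r+q*2/2⌋≡q (suc (suc _)) zero (s≤s (s≤s ()))
⌊r+q*2/2⌋≡q r (suc q) r<2 = trans (cong ℕ.⌊_/2⌋ (trans (ℕ.+-suc r (suc (q * 2))) (cong suc (ℕ.+-suc r (q * 2)))))
    (cong suc (⌊r+q*2/2⌋≡q r q r<2))

div-2 : ∀ a → divℤ (+ a) (+ 2) ≡ + ℕ.⌊ a /2⌋
div-2 a = trans (ℤ.*-identityˡ (+ (a ℕ./ 2))) (cong +_
    (sym (trans (cong ℕ.⌊_/2⌋ (m≡m%n+[m/n]*n a 2)) (⌊r+q*2/2⌋≡q (a ℕ.% 2) (a ℕ./ 2) (m%n<n a 2)))))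

-- `2 * ∣ k ∣` is at most the rounding error plus `∣ x ∣`, hence at most `M + 1`, half of which
-- rounds down to `⌈ M /2⌉`.
half-bound : ∀ {M} k x → ∣ x ∣ ≤ M → ℤ.-1ℤ ℤ.≤ + 2 ℤ.* k ℤ.- x → + 2 ℤ.* k ℤ.- x ℤ.≤ 1ℤ → ∣ k ∣ ≤ ℕ.⌈ M /2⌉
half-bound {M} k x x≤M lo hi = subst (_≤ ℕ.⌈ M /2⌉) (sym (ℕ.n≡⌊n+n/2⌋ ∣ k ∣)) (ℕ.⌊n/2⌋-mono (begin
  ∣ k ∣ + ∣ k ∣                       ≡⟨ cong (∣ k ∣ ℕ.+_) (ℕ.+-identityʳ ∣ k ∣) ⟨
  2 * ∣ k ∣                           ≡⟨ ℤ.abs-* (+ 2) k ⟨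
  ∣ + 2 ℤ.* k ∣                       ≡⟨ cong ∣_∣ (restore (+ 2 ℤ.* k) x) ⟩
  ∣ (+ 2 ℤ.* k ℤ.- x) ℤ.+ x ∣         ≤⟨ ℤ.∣i+j∣≤∣i∣+∣j∣ (+ 2 ℤ.* k ℤ.- x) x ⟩
  ∣ + 2 ℤ.* k ℤ.- x ∣ + ∣ x ∣         ≤⟨ ℕ.+-mono-≤ (unit≤ (+ 2 ℤ.* k ℤ.- x) lo hi) x≤M ⟩
  suc M                               ∎))
  where
  open ℕ.≤-Reasoning
  restore : ∀ a x → a ≡ (a ℤ.- x) ℤ.+ x
  restore = ℤRing.solve-∀
  unit≤ : ∀ z → ℤ.-1ℤ ℤ.≤ z → z ℤ.≤ 1ℤ → ∣ z ∣ ≤ 1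
  unit≤ (+ z)      _          (+≤+ h) = h
  unit≤ (-[1+ z ]) (ℤ.-≤- h)  _       = s≤s h

sumℤ-++ : ∀ xs ys → sumℤ (xs ++ ys) ≡ sumℤ xs ℤ.+ sumℤ ys
sumℤ-++ []       ys = sym (ℤ.+-identityˡ (sumℤ ys))
sumℤ-++ (x ∷ xs) ys = trans (cong (λ z → x ℤ.+ z) (sumℤ-++ xs ys)) (sym (ℤ.+-assoc x (sumℤ xs) (sumℤ ys)))

-- One stage: splitting off the odd part.

module Stage (G : STDAG) where
  open Network G
  open Cuts G
  open Layout G
  open Preflow G
  open Rounding G
  open RoundingProgram G
  open ExtractionProgram G

  opaque
    weight : WeightedPaths G → Edge → ℤ
    weight = superposition G

    weight-superposition : ∀ D e → superposition G D e ≡ weight D e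
    weight-superposition D e = refl

    weight-++ : ∀ D E e → weight (D ++ E) e ≡ weight D e ℤ.+ weight E e
    weight-++ D E e = trans (cong sumℤ (map-++ _ D E)) (sumℤ-++ (map _ D) (map _ E))

    weight-[] : ∀ e → weight [] e ≡ 0ℤ
    weight-[] e = refl

    weight-uniform : ∀ c Ps e → weight (map (c ,_) Ps) e ≡ c ℤ.* pathSum Ps e
    weight-uniform c []       e = sym (ℤ.*-zeroʳ c)
    weight-uniform c (P ∷ Ps) e = trans (cong₂ ℤ._+_ (cong (c ℤ.*_) (pathFlow-walkFlow P e)) (weight-uniform c Ps e))
        (sym (ℤ.*-distribˡ-+ c (walkFlow P e) (pathSum Ps e)))

  module _ {Z : Edge → ℤ} (cZ : Conserved Z) (Z≥0 : ∀ e → 0ℤ ℤ.≤ Z e) {k : ℕ} (value : ∂ Z s ≡ ℤ.- (+ k)) where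

    -- Rounding x/2 to K₁ and (Z + x)/2 to K₂ splits x - 2K₁ into a positive part K₂ - K₁ and a negative
    -- part K₂ + K₁ - x, whose values add up to at most that of Z.
    module Parts {x K₁ K₂ : Edge → ℤ} (cx : Conserved x) (supported : ∀ e → x e ≢ 0ℤ → 1ℤ ℤ.≤ Z e)
        (R₁ : Rounds x K₁) (R₂ : Rounds (λ e → Z e ℤ.+ x e) K₂) (less : ∂ (λ e → Z e ℤ.+ x e) s ℤ.≤ + 2 ℤ.* ∂ K₂ s)
            where
      open Rounds

      A B : Edge → ℤ
      A e = K₂ e ℤ.- K₁ e
      B e = K₂ e ℤ.+ K₁ e ℤ.- x e

      -- Where `Z` vanishes so does `x`, and then both roundings are 0. Everywhere else `Z` is at
      -- least 1, enough to outweigh two rounding errors up to parity.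
      halves : ∀ e → (K₁ e ≡ 0ℤ × K₂ e ≡ 0ℤ × x e ≡ 0ℤ) ⊎ 1ℤ ℤ.≤ Z e
      halves e with x e ℤ.≟ 0ℤ | Z e ℤ.≟ 0ℤ
      ... | no x≢0 | _ = inj₂ (supported e x≢0)
      ... | yes _  | no Z≢0 = inj₂ (ℤ.i<j⇒suc[i]≤j (ℤ.≤∧≢⇒< (Z≥0 e) (Z≢0 ∘ sym)))
      ... | yes x≡0 | yes Z≡0 = inj₁
        ( small⇒0 (K₁ e) (subst (ℤ.-1ℤ ℤ.≤_) (drop₁ (K₁ e)) (R₁ .lower e))
            (subst (ℤ._≤ 1ℤ) (drop₁ (K₁ e)) (R₁ .upper e))
        , small⇒0 (K₂ e) (subst (ℤ.-1ℤ ℤ.≤_) (drop₂ (K₂ e)) (R₂ .lower e))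
            (subst (ℤ._≤ 1ℤ) (drop₂ (K₂ e)) (R₂ .upper e))
        , x≡0 )
        where
        drop₁ : ∀ a → + 2 ℤ.* a ℤ.- x e ≡ + 2 ℤ.* a
        drop₁ a = trans (cong (λ z → + 2 ℤ.* a ℤ.- z) x≡0) (ℤ.+-identityʳ (+ 2 ℤ.* a))
        drop₂ : ∀ a → + 2 ℤ.* a ℤ.- (Z e ℤ.+ x e) ≡ + 2 ℤ.* a
        drop₂ a = trans (cong₂ (λ z y → + 2 ℤ.* a ℤ.- (z ℤ.+ y)) Z≡0 x≡0) (ℤ.+-identityʳ (+ 2 ℤ.* a))

      three : ∀ {a b c} → ℤ.-1ℤ ℤ.≤ a → ℤ.-1ℤ ℤ.≤ b → 1ℤ ℤ.≤ c → ℤ.-1ℤ ℤ.≤ a ℤ.+ b ℤ.+ c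
      three {a} {b} {c} p q r = ℤ.+-mono-≤ { ℤ.-1ℤ ℤ.+ ℤ.-1ℤ} {a ℤ.+ b} {1ℤ} {c}
          (ℤ.+-mono-≤ { ℤ.-1ℤ} {a} { ℤ.-1ℤ} {b} p q) r

      -- `2 * A` is `Z` plus two rounding errors, each at least -1. Where `Z` is at least 1 this is
      -- an even number not below -1.
      A≥0 : ∀ e → 0ℤ ℤ.≤ A e
      A≥0 e with halves e
      ... | inj₁ (k₁ , k₂ , _) = subst (0ℤ ℤ.≤_) (sym (cong₂ ℤ._-_ k₂ k₁)) ℤ.≤-refl
      ... | inj₂ 1≤Z = nonneg-half (A e) (subst (ℤ.-1ℤ ℤ.≤_) (identity (K₁ e) (K₂ e) (x e) (Z e))
          (three (R₂ .lower e) (ℤ.neg-mono-≤ (R₁ .upper e)) 1≤Z))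
        where
        identity : ∀ a b x z → (+ 2 ℤ.* b ℤ.- (z ℤ.+ x)) ℤ.+ ℤ.- (+ 2 ℤ.* a ℤ.- x) ℤ.+ z ≡ + 2 ℤ.* (b ℤ.- a)
        identity = ℤRing.solve-∀

      B≥0 : ∀ e → 0ℤ ℤ.≤ B e
      B≥0 e with halves e
      ... | inj₁ (k₁ , k₂ , x0) = subst (0ℤ ℤ.≤_) (sym (cong₂ ℤ._-_ (cong₂ ℤ._+_ k₂ k₁) x0)) ℤ.≤-refl
      ... | inj₂ 1≤Z = nonneg-half (B e) (subst (ℤ.-1ℤ ℤ.≤_) (identity (K₁ e) (K₂ e) (x e) (Z e))
          (three (R₂ .lower e) (R₁ .lower e) 1≤Z))
        where
        identity : ∀ a b x z → (+ 2 ℤ.* b ℤ.- (z ℤ.+ x)) ℤ.+ (+ 2 ℤ.* a ℤ.- x) ℤ.+ z ≡ + 2 ℤ.* (b ℤ.+ a ℤ.- x)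
        identity = ℤRing.solve-∀

      cA : Conserved A
      cA = Conserved-minus {K₂} {K₁} (R₂ .conserved) (R₁ .conserved)

      cB : Conserved B
      cB = Conserved-minus {λ e → K₂ e ℤ.+ K₁ e} {x} (Conserved-+ {K₂} {K₁} (R₂ .conserved) (R₁ .conserved)) cx

      rA rB : ℕ
      rA = proj₁ (source-value A≥0)
      rB = proj₁ (source-value B≥0)

      -- `A + B` is `2 K₂ - x`. As rounding did not increase the value of `Z + x`, the value of
      -- `A + B` is at most that of `Z`.
      values : rA + rB ≤ k
      values = ℤ.drop‿+≤+ (ℤ.neg-cancel-≤ (subst₂ ℤ._≤_ value (trans parts (sym (ℤ.neg-distrib-+ (+ rA) (+ rB))))
        (subst₂ ℤ._≤_ (trans (cong (ℤ._- ∂ x s) (∂-+ Z x s)) (cancel (∂ Z s) (∂ x s))) refl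
            (ℤ.+-monoˡ-≤ (ℤ.- ∂ x s) less))))
        where
        cancel : ∀ a b → a ℤ.+ b ℤ.- b ≡ a
        cancel = ℤRing.solve-∀
        identity : ∀ a b x → + 2 ℤ.* b ℤ.- x ≡ (b ℤ.- a) ℤ.+ (b ℤ.+ a ℤ.- x)
        identity = ℤRing.solve-∀
        parts : + 2 ℤ.* ∂ K₂ s ℤ.- ∂ x s ≡ ℤ.- (+ rA) ℤ.+ ℤ.- (+ rB)
        parts = trans (identity (∂ K₁ s) (∂ K₂ s) (∂ x s)) (sym (cong₂ ℤ._+_
          (trans (sym (proj₂ (source-value A≥0))) (∂-minus K₂ K₁ s))
          (trans (sym (proj₂ (source-value B≥0))) (trans (∂-minus (λ e → K₂ e ℤ.+ K₁ e) x s)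
              (cong (ℤ._- ∂ x s) (∂-+ K₂ K₁ s))))))

    module _ (s≢t : s ≢ t) (adj : Adjacency) where
      open Represented adj

      S : ℕ
      S = sizeOf inc

      -- The two splittings share one reserve `n * k * 3`, since together they produce at most `k`
      -- paths; it is listed last because its division is not known in advance.
      stageTail stageBudget : ℕ → ℕ
      stageTail rest = 2 + (m * 3 + (5 + (n * 3 + (S * 3 +
          (1 + (2 + (m * 3 + (5 + (n * 3 + (S * 3 + (n * k * 3 + rest)))))))))))
      stageBudget rest = 2 + (m * 3 + roundBudget adj {λ e → Z e} cZ (stageTail rest))

      record Staged (x K₁ : Edge → ℤ) (c : ℤ) (D : WeightedPaths G) (rest : ℕ) (σ : State) (ψ : ℕ) : Set where
        field
          {D′}    : WeightedPaths G
          weights : ∀ e → weight D′ e ≡ weight D e ℤ.+ c ℤ.* (x e ℤ.- + 2 ℤ.* K₁ e)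
          count   : length D′ ≤ length D + k
          output  : Out D′ σ
          weight≡ : σ .vars 14 ≡ ℤ.- c
          credit  : rest ≤ ψ

      run-stage : ∀ {σ x K₁ c D rest} → Static σ → σ .arrays 10 ≈ Z → σ .arrays 5 ≈ x → σ .arrays 14 ≈ K₁ → σ .vars
          14 ≡ c → Out D σ →
        Conserved x → (∀ e → x e ≢ 0ℤ → 1ℤ ℤ.≤ Z e) → Rounds x K₁ → Run stage σ (stageBudget rest)
            (Staged x K₁ c D rest)
      run-stage {σ} {x} {K₁} {c} {D} {rest} st Z≈ x≈ K₁≈ c≡ O cx supp R₁ =
        run-seq (run-fill {N = m} (λ e → Z e ℤ.+ x e) (st .m≡) λ {τ} sm e 5≡ →
          cong₂ ℤ._+_ (trans (cong (τ .arrays 10) 5≡) (trans (sm .sameArr 10 _) (Z≈ e)))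
              (trans (cong (τ .arrays 5) 5≡) (trans (sm .sameArr 5 _) (x≈ e))))
        λ { σ₁ _ sm₁ (W≈ , refl) →
        let st₁ = static-same sm₁ st in
        run-seq (run-round adj (Conserved-+ {Z} {x} cZ cx) st₁ W≈) λ { σ₂ _ sm₂ Rd →
        let module R = Rounded Rd
            module P = Parts cx supp R₁ R.rounds R.value
            st₂ = static-same sm₂ st₁
            K₁≈₂ = λ e → trans (sm₂ .sameArr 14 _) (trans (sm₁ .sameArr 14 _) (K₁≈ e))
            x≈₂ = λ e → trans (sm₂ .sameArr 5 _) (trans (sm₁ .sameArr 5 _) (x≈ e)) in
        run-more (ℕ.≤-trans (affordable P.rA P.rB P.values) (ℕ.≤-reflexive (sym R.credit)))
        (run-seq (run-fill {N = m} P.A (st₂ .m≡) λ {τ} sm e 5≡ →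
          cong₂ ℤ._-_ (trans (cong (τ .arrays 15) 5≡) (trans (sm .sameArr 15 _) (R.K≈ e)))
              (trans (cong (τ .arrays 14) 5≡) (trans (sm .sameArr 14 _) (K₁≈₂ e))))
        λ { σ₃ _ sm₃ (A≈ , refl) →
        let st₃ = static-same sm₃ st₂ in
        run-seq (run-dec adj P.A P.rA c D (1 + (2 + (m * 3 + (5 + (n * 3 + ((n * P.rB + S) * 3 + rest)))))) s≢t st₃
          (trans (sm₃ .sameVar 14) (trans (sm₂ .sameVar 14) (trans (sm₁ .sameVar 14) c≡))) A≈ P.A≥0 P.cA
              (proj₂ (source-value P.A≥0))
          (record { pos≡ = trans (sm₃ .sameVar 11) (trans (sm₂ .sameVar 11) (trans (sm₁ .sameVar 11) (Out.pos≡ O)))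
                  ; cnt≡ = trans (sm₃ .sameVar 13) (trans (sm₂ .sameVar 13) (trans (sm₁ .sameVar 13) (Out.cnt≡ O)))
                  ; seg = λ i i< → trans (sm₃ .sameArr 1 _)
                      (trans (sm₂ .sameArr 1 _) (trans (sm₁ .sameArr 1 _) (Out.seg O i i<))) }))
        λ { σ₄ φ₄ sm₄ E →
        let module E = Extracted E
            st₄ = static-same sm₄ st₃ in
        run-more E.credit
        (run-seq {P = λ τ ψ → τ ≡ setVar 14 (0ℤ ℤ.- σ₄ .vars 14) σ₄ × ψ ≡ 2 +
            (m * 3 + (5 + (n * 3 + ((n * P.rB + S) * 3 + rest))))}
            (run-straight (assign 14 (op sub (const 0ℤ) (var 14))) (refl , refl))
        λ { σ₅ _ sm₅ (refl , refl) →
        let st₅ = static-same sm₅ st₄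
            c₅ : σ₅ .vars 14 ≡ ℤ.- c
            c₅ = trans (ℤ.+-identityˡ (ℤ.- σ₄ .vars 14))
                (cong ℤ.-_ (trans (sm₄ .sameVar 14)
                (trans (sm₃ .sameVar 14) (trans (sm₂ .sameVar 14) (trans (sm₁ .sameVar 14) c≡))))) in
        run-seq (run-fill {N = m} P.B (st₅ .m≡) λ {τ} sm e 5≡ →
          cong₂ ℤ._-_ (cong₂ ℤ._+_ (trans (cong (τ .arrays 15) 5≡)
              (trans (sm .sameArr 15 _) (trans (sm₄ .sameArr 15 _) (trans (sm₃ .sameArr 15 _) (R.K≈ e)))))
              (trans (cong (τ .arrays 14) 5≡) (trans (sm .sameArr 14 _)
                  (trans (sm₄ .sameArr 14 _) (trans (sm₃ .sameArr 14 _) (K₁≈₂ e))))))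
            (trans (cong (τ .arrays 5) 5≡) (trans (sm .sameArr 5 _)
                (trans (sm₄ .sameArr 5 _) (trans (sm₃ .sameArr 5 _) (x≈₂ e))))))
        λ { σ₆ _ sm₆ (B≈ , refl) →
        run-mono (run-dec adj P.B P.rB (ℤ.- c) (D ++ map (c ,_) E.paths) rest s≢t (static-same sm₆ st₅)
            (trans (sm₆ .sameVar 14) c₅) B≈ P.B≥0 P.cB (proj₂ (source-value P.B≥0))
          (record { pos≡ = trans (sm₆ .sameVar 11) (Out.pos≡ E.output) ; cnt≡ = trans (sm₆ .sameVar 13)
              (Out.cnt≡ E.output)
                  ; seg = λ i i< → trans (sm₆ .sameArr 1 _) (Out.seg E.output i i<) }))
        λ { τ ψ sm₇ F → finish P.A P.B (λ e → split (K₁ e) (R.K e) (x e)) E.sums (Extracted.sums F)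
            (subst₂ (λ a b → a + b ≤ k) (sym E.count) (sym (Extracted.count F)) P.values)
            (Extracted.output F) (trans (sm₇ .sameVar 14) (trans (sm₆ .sameVar 14) c₅)) (Extracted.credit F) } } }) }
                }) } }
        where
        affordable : ∀ a b → a + b ≤ k →
          2 + (m * 3 + (5 + (n * 3 + ((n * a + S) * 3 +
              (1 + (2 + (m * 3 + (5 + (n * 3 + ((n * b + S) * 3 + rest)))))))))) ≤ stageTail rest
        affordable a b a+b≤k = ℕ.≤-trans (ℕ.≤-reflexive (arith m n S a b rest))
            (ℕ.≤-trans (ℕ.+-monoʳ-≤ _ (ℕ.*-monoˡ-≤ 3 (ℕ.*-monoʳ-≤ n a+b≤k)))
            (ℕ.≤-reflexive (sym (arith′ m n S (n * k) rest))))
          where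
          arith : ∀ m n S a b r → 2 + (m * 3 + (5 +
              (n * 3 + ((n * a + S) * 3 + (1 + (2 + (m * 3 + (5 + (n * 3 + ((n * b + S) * 3 + r))))))))))
            ≡ 15 + m * 6 + n * 6 + S * 6 + r + n * (a + b) * 3
          arith = ℕRing.solve-∀
          arith′ : ∀ m n S p r → 2 + (m * 3 + (5 + (n * 3 +
              (S * 3 + (1 + (2 + (m * 3 + (5 + (n * 3 + (S * 3 + (p * 3 + r)))))))))))
            ≡ 15 + m * 6 + n * 6 + S * 6 + r + p * 3
          arith′ = ℕRing.solve-∀
        split : ∀ a b y → (b ℤ.- a) ℤ.- (b ℤ.+ a ℤ.- y) ≡ y ℤ.- + 2 ℤ.* a
        split = ℤRing.solve-∀
        finish : ∀ (A B : Edge → ℤ) {Ps Qs τ ψ} → (∀ e → A e ℤ.- B e ≡ x e ℤ.- + 2 ℤ.* K₁ e) →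
            (∀ e → A e ≡ pathSum Ps e) → (∀ e → B e ≡ pathSum Qs e) → length Ps + length Qs ≤ k →
          Out ((D ++ map (c ,_) Ps) ++ map (ℤ.- c ,_) Qs) τ → τ .vars 14 ≡ ℤ.- c → rest ≤ ψ → Staged x K₁ c D rest τ ψ
        finish A B {Ps} {Qs} A-B A≡ B≡ len O c≡ cr = record
          { weights = λ e → begin
              weight ((D ++ map (c ,_) Ps) ++ map (ℤ.- c ,_) Qs) e
                ≡⟨ weight-++ (D ++ map (c ,_) Ps) (map (ℤ.- c ,_) Qs) e ⟩
              weight (D ++ map (c ,_) Ps) e ℤ.+ weight (map (ℤ.- c ,_) Qs) e
                ≡⟨ cong₂ ℤ._+_ (weight-++ D (map (c ,_) Ps) e) (weight-uniform (ℤ.- c) Qs e) ⟩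
              weight D e ℤ.+ weight (map (c ,_) Ps) e ℤ.+ ℤ.- c ℤ.* pathSum Qs e
                ≡⟨ cong₂ (λ a b → weight D e ℤ.+ a ℤ.+ ℤ.- c ℤ.* b)
                    (trans (weight-uniform c Ps e) (cong (c ℤ.*_) (sym (A≡ e)))) (sym (B≡ e)) ⟩
              weight D e ℤ.+ c ℤ.* A e ℤ.+ ℤ.- c ℤ.* B e
                ≡⟨ collect (weight D e) c (A e) (B e) ⟩
              weight D e ℤ.+ c ℤ.* (A e ℤ.- B e)
                ≡⟨ cong (λ d → weight D e ℤ.+ c ℤ.* d) (A-B e) ⟩
              weight D e ℤ.+ c ℤ.* (x e ℤ.- + 2 ℤ.* K₁ e) ∎
          ; count = ℕ.≤-trans (ℕ.≤-reflexive lengths) (ℕ.+-monoʳ-≤ (length D) len)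
          ; output = O ; weight≡ = c≡ ; credit = cr }
          where
          open ≡-Reasoning
          collect : ∀ w c a b → w ℤ.+ c ℤ.* a ℤ.+ ℤ.- c ℤ.* b ≡ w ℤ.+ c ℤ.* (a ℤ.- b)
          collect = ℤRing.solve-∀
          lengths : length ((D ++ map (c ,_) Ps) ++ map (ℤ.- c ,_) Qs) ≡ length D + (length Ps + length Qs)
          lengths = trans (length-++ (D ++ map (c ,_) Ps))
              (trans (cong₂ _+_ (trans (length-++ D) (cong (length D ℕ.+_) (length-map (c ,_) Ps)))
              (length-map (ℤ.- c ,_) Qs))
            (ℕ.+-assoc (length D) (length Ps) (length Qs)))

-- The scaling loop.

module Main (G : STDAG) (X : Fin (STDAG.m G) → ℤ) where
  open Network G
  open Cuts G
  open Layout G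
  open Preflow G
  open Rounding G
  open RoundingProgram G
  open ExtractionProgram G
  open Stage G

  -- `logs` adds the rounds made and the rounds to come: the first summand controls the length of
  -- `D`, the second the credits still needed.
  record Scaling {Z : Edge → ℤ} (k L cost rest : ℕ) (σ : State) (ψ : ℕ) : Set where
    field
      {x}       : Edge → ℤ
      {M j}     : ℕ
      {c}       : ℤ
      {D}       : WeightedPaths G
      x≈        : σ .arrays 5 ≈ x
      M≡        : σ .vars 4 ≡ + M
      c≡        : σ .vars 14 ≡ c
      output    : Out D σ
      conserved : Conserved x
      bounded   : ∀ e → ∣ x e ∣ ≤ M
      supported : ∀ e → x e ≢ 0ℤ → 1ℤ ℤ.≤ Z e
      sums      : ∀ e → X e ≡ weight D e ℤ.+ c ℤ.* x e
      count     : length D ≤ j * k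
      logs      : j + ⌈log₂ M ⌉ ≤ L
      credit    : ⌈log₂ M ⌉ * cost + rest ≤ ψ

  log-step : ∀ M → 2 ≤ M → ⌈log₂ M ⌉ ≡ suc ⌈log₂ ℕ.⌈ M /2⌉ ⌉
  log-step M 2≤M with ⌈log₂ M ⌉ in q | ℕ.≤-trans (ℕ.≤-reflexive (sym (⌈log₂2^n⌉≡n 1))) (⌈log₂⌉-mono-≤ 2≤M)
  ... | suc l | _ = cong suc (sym (trans (⌈log₂⌈n/2⌉⌉≡⌈log₂n⌉∸1 M) (cong (_∸ 1) q)))
  ... | zero  | ()

  module _ {Z : Edge → ℤ} (cZ : Conserved Z) (Z≥0 : ∀ e → 0ℤ ℤ.≤ Z e) {k : ℕ} (value : ∂ Z s ≡ ℤ.- (+ k))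
      (s≢t : s ≢ t) (adj : Adjacency) where
    open Represented adj

    scaleBudget : ℕ → ℕ
    scaleBudget rest = 2 + (m * 3 + roundBudget adj {Z} cZ
        (2 + (m * 3 + stageBudget cZ Z≥0 {k} value s≢t adj (2 + (m * 3 + (1 + rest))))))

    -- The nested budgets, which follow the order of the program, multiplied out. As `sizeOf inc` is
    -- `m * 2`, only the last summand is more than linear in `m + n`.
    stageCost scaleCost : ℕ
    stageCost = 31 + m * 15 + n * 14 + sizeOf inc * 9 + n * k * 3
    scaleCost = 52 + m * 30 + n * 22 + sizeOf inc * 12 + n * k * 3

    stageBudget≡ : ∀ rest → stageBudget cZ Z≥0 {k} value s≢t adj rest ≡ stageCost + rest
    stageBudget≡ rest = arith m n (sizeOf inc) (n * k) rest
      where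
      arith : ∀ m n S p r → 2 + (m * 3 + (2 + (n * 3 + (2 + (m * 3 + (2 + (m * 3 + (3 + (S * 3 + (3 + (2 + (n * 5 +
        (2 + (m * 3 + (5 + (n * 3 + (S * 3 + (1 + (2 +
            (m * 3 + (5 + (n * 3 + (S * 3 + (p * 3 + r))))))))))))))))))))))))
        ≡ 31 + m * 15 + n * 14 + S * 9 + p * 3 + r
      arith = ℕRing.solve-∀

    scaleBudget≡ : ∀ rest → scaleBudget rest ≡ scaleCost + rest
    scaleBudget≡ rest = trans (cong (λ b → 2 + (m * 3 + roundBudget adj {Z} cZ (2 + (m * 3 + b))))
        (stageBudget≡ (2 + (m * 3 + (1 + rest)))))
      (arith m n (sizeOf inc) (n * k) rest)
      where
      arith : ∀ m n S p r → 2 + (m * 3 + (2 + (n * 3 + (2 + (m * 3 + (2 + (m * 3 + (3 + (S * 3 + (3 + (2 + (n * 5 +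
        (2 + (m * 3 + (31 + m * 15 + n * 14 + S * 9 + p * 3 + (2 + (m * 3 + (1 + r))))))))))))))))))
        ≡ 52 + m * 30 + n * 22 + S * 12 + p * 3 + r
      arith = ℕRing.solve-∀

    Scaling′ : (L rest : ℕ) → State → ℕ → Set
    Scaling′ L rest = Scaling {Z} k L (suc scaleCost) rest

    run-scale : ∀ {σ ψ L rest} → Static σ → σ .arrays 10 ≈ Z → Scaling′ L rest σ ψ → ⟦ op leq (const (+ 2)) (var 4) ⟧
        σ ≢ 0ℤ →
      ∃[ χ ] ψ ≡ suc χ × Run scale σ χ (Scaling′ L rest)
    run-scale {σ} {ψ} {L} {rest} st Z≈ I ≢0 = let χ , ψ≡ , enough = spend 1 paid in
      χ , ψ≡ , run-more (ℕ.≤-trans (ℕ.≤-reflexive (scaleBudget≡ (l * suc scaleCost + rest))) enough)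
      (run-seq (run-fill {N = m} x (st .m≡) λ {τ} sm e 5≡ → trans (cong (τ .arrays 5) 5≡)
          (trans (sm .sameArr 5 _) (x≈ e)))
      λ { σ₁ _ sm₁ (W≈ , refl) →
      let st₁ = static-same sm₁ st in
      run-seq (run-round adj conserved st₁ W≈) λ { σ₂ _ sm₂ Rd →
      let module R = Rounded Rd
          st₂ = static-same sm₂ st₁ in
      run-more (ℕ.≤-reflexive (sym R.credit))
      (run-seq (run-fill {N = m} R.K (st₂ .m≡) λ {τ} sm e 5≡ → trans (cong (τ .arrays 15) 5≡)
          (trans (sm .sameArr 15 _) (R.K≈ e)))
      λ { σ₃ _ sm₃ (K≈ , refl) →
      let st₃ = static-same sm₃ st₂ in
      run-seq (run-stage cZ Z≥0 value s≢t adj st₃ (λ e → trans (sm₃ .sameArr 10 _)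
          (trans (sm₂ .sameArr 10 _) (trans (sm₁ .sameArr 10 _) (Z≈ e))))
        (λ e → trans (sm₃ .sameArr 5 _) (trans (sm₂ .sameArr 5 _) (trans (sm₁ .sameArr 5 _) (x≈ e)))) K≈
        (trans (sm₃ .sameVar 14) (trans (sm₂ .sameVar 14) (trans (sm₁ .sameVar 14) c≡)))
        (out-same (λ j → trans (sm₃ .sameArr 1 j) (trans (sm₂ .sameArr 1 j) (sm₁ .sameArr 1 j)))
          (trans (sm₃ .sameVar 11) (trans (sm₂ .sameVar 11) (sm₁ .sameVar 11)))
              (trans (sm₃ .sameVar 13) (trans (sm₂ .sameVar 13) (sm₁ .sameVar 13))) output)
        conserved supported R.rounds)
      λ { σ₄ φ₄ sm₄ Sg →
      let module Sg = Staged Sg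
          st₄ = static-same sm₄ st₃ in
      run-more Sg.credit
      (run-seq (run-fill {N = m} R.K (st₄ .m≡) λ {τ} sm e 5≡ → trans (cong (τ .arrays 14) 5≡)
          (trans (sm .sameArr 14 _) (trans (sm₄ .sameArr 14 _) (K≈ e))))
      λ { σ₅ _ sm₅ (x′≈ , refl) →
      run-straight (assign 14 (op mul (const (ℤ.- + 2)) (var 14)) ⨾ assign 4
          (op div (op add (const 1ℤ) (var 4)) (const (+ 2))))
        (finish {R.K} {c} {D} {Sg.D′} x′≈ (trans (sm₅ .sameVar 14) Sg.weight≡)
          (trans (cong (λ z → divℤ (1ℤ ℤ.+ z) (+ 2))
              (trans (sm₅ .sameVar 4) (trans (sm₄ .sameVar 4)
              (trans (sm₃ .sameVar 4) (trans (sm₂ .sameVar 4) (trans (sm₁ .sameVar 4) M≡)))))) (div-2 (suc M)))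
          (out-same (sm₅ .sameArr 1) (sm₅ .sameVar 11) (sm₅ .sameVar 13) Sg.output) R.rounds Sg.weights Sg.count sums
              count) }) } }) } })
      where
      open Scaling I
      2≤M : 2 ≤ M
      2≤M = ℤ.drop‿+≤+ (subst (+ 2 ℤ.≤_) M≡ (boolℤ≢0 (_ ℤ.≤? _) ≢0))
      l : ℕ
      l = ⌈log₂ ℕ.⌈ M /2⌉ ⌉
      paid : 1 + (scaleCost + (l * suc scaleCost + rest)) ≤ ψ
      paid = ℕ.≤-trans (ℕ.≤-reflexive (trans (sym (ℕ.+-assoc (suc scaleCost) (l * suc scaleCost) rest))
          (cong (λ z → z * suc scaleCost + rest) (sym (log-step M 2≤M))))) credit
      out-same : ∀ {σ τ D} → (∀ j → τ .arrays 1 j ≡ σ .arrays 1 j) → τ .vars 11 ≡ σ .vars 11 → τ .vars 13 ≡ σ .vars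
          13 → Out D σ → Out D τ
      out-same a p q O = record { pos≡ = trans p (Out.pos≡ O) ; cnt≡ = trans q (Out.cnt≡ O) ; seg = λ i i< → trans
          (a _) (Out.seg O i i<) }
      finish : ∀ {K c D D′ τ} → τ .arrays 5 ≈ K → τ .vars 14 ≡ ℤ.- c → divℤ (1ℤ ℤ.+ τ .vars 4) (+ 2) ≡ + ℕ.⌈ M /2⌉ →
          Out D′ τ → Rounds x K →
        (∀ e → weight D′ e ≡ weight D e ℤ.+ c ℤ.* (x e ℤ.- + 2 ℤ.* K e)) → length D′ ≤ length D + k →
            (∀ e → X e ≡ weight D e ℤ.+ c ℤ.* x e) → length D ≤ j * k →
        Scaling′ L rest (setVar 4 (divℤ (1ℤ ℤ.+ τ .vars 4) (+ 2)) (setVar 14 ((ℤ.- + 2) ℤ.* τ .vars 14) τ))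
            (l * suc scaleCost + rest)
      finish {K} {c} {D} {D′} {τ} K≈ c≡ M′≡ O R weights len sums count = record
        { x = K ; M = ℕ.⌈ M /2⌉ ; j = suc j ; c = (ℤ.- + 2) ℤ.* ℤ.- c
        ; x≈ = K≈ ; M≡ = M′≡ ; c≡ = cong ((ℤ.- + 2) ℤ.*_) c≡ ; output = record { Out O }
        ; conserved = R .Rounds.conserved
        ; bounded = λ e → half-bound (K e) (x e) (bounded e) (R .Rounds.lower e) (R .Rounds.upper e)
        -- The rounding vanishes wherever `x` does, so supports only shrink and the same `Z` serves
        -- every round.
        ; supported = λ e K≢0 → supported e (λ x≡0 → K≢0 (vanish e x≡0))
        ; sums = λ e → trans (sums e) (trans (telescope (weight D e) c (x e) (K e))
            (cong (ℤ._+ (ℤ.- + 2) ℤ.* ℤ.- c ℤ.* K e) (sym (weights e))))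
        ; count = ℕ.≤-trans len (ℕ.≤-trans (ℕ.+-monoˡ-≤ k count) (ℕ.≤-reflexive (ℕ.+-comm (j * k) k)))
        ; logs = ℕ.≤-trans (ℕ.≤-reflexive (trans (sym (ℕ.+-suc j l)) (cong (j ℕ.+_) (sym (log-step M 2≤M))))) logs
        ; credit = ℕ.≤-refl }
        where
        telescope : ∀ w c x k → w ℤ.+ c ℤ.* x ≡ w ℤ.+ c ℤ.* (x ℤ.- + 2 ℤ.* k) ℤ.+ (ℤ.- + 2) ℤ.* ℤ.- c ℤ.* k
        telescope = ℤRing.solve-∀
        vanish : ∀ e → x e ≡ 0ℤ → K e ≡ 0ℤ
        vanish e x≡0 = small⇒0 (K e) (subst (ℤ.-1ℤ ℤ.≤_) drop (R .Rounds.lower e))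
            (subst (ℤ._≤ 1ℤ) drop (R .Rounds.upper e))
          where
          drop : + 2 ℤ.* K e ℤ.- x e ≡ + 2 ℤ.* K e
          drop = trans (cong (λ z → + 2 ℤ.* K e ℤ.- z) x≡0) (ℤ.+-identityʳ (+ 2 ℤ.* K e))

    record Finished (L rest : ℕ) (σ : State) (ψ : ℕ) : Set where
      field
        {D}     : WeightedPaths G
        sums    : ∀ e → X e ≡ weight D e
        count   : length D ≤ suc L * k
        outputs : Outputs σ (encodeOutput G D)

    run-mainLoop : ∀ {σ M L} → Static σ → σ .arrays 10 ≈ Z → σ .arrays 5 ≈ X → σ .vars 4 ≡ + M → σ .vars 14 ≡ 1ℤ →
        Out [] σ →
      Conserved X → (∀ e → ∣ X e ∣ ≤ M) → (∀ e → X e ≢ 0ℤ → 1ℤ ℤ.≤ Z e) → ⌈log₂ M ⌉ ≤ L →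
      Run mainLoop σ (1 + (L * suc scaleCost + (2 + (m * 3 + (stageCost + 1))))) (Finished L 0)
    run-mainLoop {σ} {M} {L} st Z≈ X≈ M≡ c≡ O cX X≤M supp log≤ =
      run-seq (run-while {b = op leq (const (+ 2)) (var 4)} (Scaling′ L (2 + (m * 3 + (stageCost + 1)))) (record
          { x≈ = X≈ ; M≡ = M≡ ; j = 0 ; c≡ = c≡ ; output = O ; conserved = cX ; bounded = X≤M ; supported = supp
          ; sums = λ e → sym (trans (cong₂ ℤ._+_ (weight-[] e) (ℤ.*-identityˡ (X e))) (ℤ.+-identityˡ (X e)))
          ; count = z≤n ; logs = log≤ ; credit = ℕ.+-monoˡ-≤ _ (ℕ.*-monoˡ-≤ (suc scaleCost) log≤) })
        λ {τ} sm I ≢0 → run-scale (static-same sm st) (λ e → trans (sm .sameArr 10 _) (Z≈ e)) I ≢0)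
      λ { σ₁ φ₁ _ (sm₁ , I , ≡0) →
      let module I = Scaling I
          st₁ = static-same sm₁ st
          M≤1 = ℕ.≤-pred (ℕ.≰⇒> λ 2≤M → boolℤ≡0 (_ ℤ.≤? _) ≡0 (subst (+ 2 ℤ.≤_) (sym I.M≡) (+≤+ 2≤M))) in
      run-more (ℕ.≤-trans (ℕ.m≤n+m _ (⌈log₂ I.M ⌉ * suc scaleCost)) I.credit)
      (run-seq (run-fill {N = m} (λ _ → 0ℤ) (st₁ .m≡) (λ _ _ _ → refl))
      λ { σ₂ _ sm₂ (K≈ , refl) →
      let st₂ = static-same sm₂ st₁ in
      run-seq (run-more (ℕ.≤-reflexive (stageBudget≡ 1))
          (run-stage cZ Z≥0 value s≢t adj {K₁ = λ _ → 0ℤ} st₂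
          (λ e → trans (sm₂ .sameArr 10 _) (trans (sm₁ .sameArr 10 _) (Z≈ e)))
          (λ e → trans (sm₂ .sameArr 5 _) (I.x≈ e)) K≈ (trans (sm₂ .sameVar 14) I.c≡)
          (record { pos≡ = trans (sm₂ .sameVar 11) (Out.pos≡ I.output) ; cnt≡ = trans (sm₂ .sameVar 13)
              (Out.cnt≡ I.output)
                  ; seg = λ i i< → trans (sm₂ .sameArr 1 _) (Out.seg I.output i i<) })
          I.conserved I.supported (to-zero I.x λ e → ℕ.≤-trans (I.bounded e) M≤1)))
      λ { σ₃ φ₃ sm₃ Sg → run-more (Staged.credit Sg) (run-straight (store 1 (const 0ℤ) (var 13)) (finish I Sg)) } }) }
      where
      to-zero : ∀ x → (∀ e → ∣ x e ∣ ≤ 1) → Rounds x (λ _ → 0ℤ)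
      to-zero x x≤1 = record { lower = λ e → low (x e) (x≤1 e) ; upper = λ e → high (x e) (x≤1 e) ; conserved = λ {v}
          _ → ∂-0 v }
        where
        low : ∀ z → ∣ z ∣ ≤ 1 → ℤ.-1ℤ ℤ.≤ + 2 ℤ.* 0ℤ ℤ.- z
        low (+ 0) _ = ℤ.-≤+
        low (+ 1) _ = ℤ.≤-refl
        low (+ suc (suc _)) (s≤s ())
        low -[1+ 0 ] _ = ℤ.-≤+
        low -[1+ suc _ ] (s≤s ())
        high : ∀ z → ∣ z ∣ ≤ 1 → + 2 ℤ.* 0ℤ ℤ.- z ℤ.≤ 1ℤ
        high (+ 0) _ = +≤+ z≤n
        high (+ 1) _ = ℤ.-≤+
        high (+ suc (suc _)) (s≤s ())
        high -[1+ 0 ] _ = ℤ.≤-refl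
        high -[1+ suc _ ] (s≤s ())
      finish : ∀ {σ₁ φ₁ σ₃ φ₃ ψ r r′} (I : Scaling′ L r σ₁ φ₁) → Staged cZ Z≥0 {k} value s≢t adj (I .Scaling.x)
          (λ _ → 0ℤ) (I .Scaling.c) (I .Scaling.D) r′ σ₃ φ₃ →
        Finished L 0 (setArr 1 0ℤ (σ₃ .vars 13) σ₃) ψ
      finish {σ₃ = σ₃} I Sg = record
        { D = Sg.D′
        ; sums = λ e → trans (I.sums e) (trans (cong (λ z → weight I.D e ℤ.+ I.c ℤ.* z)
            (sym (ℤ.+-identityʳ (I.x e)))) (sym (Sg.weights e)))
        -- `j * k` paths come from the loop and at most `k` from the last stage, with `j ≤ L` by
        -- `logs`.
        ; count = ℕ.≤-trans Sg.count (ℕ.≤-trans (ℕ.+-monoˡ-≤ k I.count)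
            (ℕ.≤-trans (ℕ.≤-reflexive (ℕ.+-comm (I.j * k) k))
            (ℕ.*-monoˡ-≤ k (s≤s (ℕ.≤-trans (ℕ.m≤m+n I.j _) I.logs)))))
        ; outputs = subst (Outputs (setArr 1 0ℤ (σ₃ .vars 13) σ₃)) (sym (encodeOutput-payload Sg.D′)) written }
        where
        module I = Scaling I
        module Sg = Staged Sg
        written : Outputs (setArr 1 0ℤ (σ₃ .vars 13) σ₃) (+ length Sg.D′ ∷ payload Sg.D′)
        written zero    _        = Out.cnt≡ Sg.output
        written (suc i) (s≤s i<) = Out.seg Sg.output i i<

-- Adding up the running time.

module Cost {m n : ℕ} (1≤m : 1 ≤ m) (1≤n : 1 ≤ n) (n≤2m : n ≤ m + m) where
  open ℕ.≤-Reasoning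

  private
    m≤mn : m ≤ m * n
    m≤mn = ℕ.m≤m*n m n {{ℕ.>-nonZero 1≤n}}

    n≤mn : n ≤ m * n
    n≤mn = ℕ.m≤n*m n m {{ℕ.>-nonZero 1≤m}}

    1≤mn : 1 ≤ m * n
    1≤mn = ℕ.≤-trans 1≤m m≤mn

  -- The `n * n` stems from the label potential, which gives every node a share independent of its
  -- degree; `n ≤ m + m` absorbs it.
  preparation-cost : 24 + m * 39 + n * 6 + m * n * 26 + n * n * 16 ≤ 127 * (m * n)
  preparation-cost = begin
    24 + m * 39 + n * 6 + m * n * 26 + n * n * 16
      ≤⟨ ℕ.+-mono-≤ (ℕ.+-monoˡ-≤ (m * n * 26) (ℕ.+-mono-≤ (ℕ.+-mono-≤ (ℕ.*-monoʳ-≤ 24 1≤mn) (ℕ.*-monoˡ-≤ 39 m≤mn))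
          (ℕ.*-monoˡ-≤ 6 n≤mn))) (ℕ.*-monoˡ-≤ 16 (ℕ.*-monoˡ-≤ n n≤2m)) ⟩
    24 * (m * n) + m * n * 39 + m * n * 6 + m * n * 26 + (m + m) * n * 16
      ≡⟨ arith m n ⟩
    127 * (m * n) ∎
    where
    arith : ∀ m n → 24 * (m * n) + m * n * 39 + m * n * 6 + m * n * 26 + (m + m) * n * 16 ≡ 127 * (m * n)
    arith = ℕRing.solve-∀

  -- The last stage takes place even if the logarithm is 0, so it is charged to `m * n`, and here
  -- `k` is compared with `m` instead of the width.
  final-cost : ∀ {k} → k ≤ m → 35 + m * 36 + n * 14 + n * k * 3 ≤ 88 * (m * n)
  final-cost {k} k≤m = begin
    35 + m * 36 + n * 14 + n * k * 3
      ≤⟨ ℕ.+-mono-≤ (ℕ.+-mono-≤ (ℕ.+-mono-≤ (ℕ.*-monoʳ-≤ 35 1≤mn) (ℕ.*-monoˡ-≤ 36 m≤mn)) (ℕ.*-monoˡ-≤ 14 n≤mn))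
          (ℕ.*-monoˡ-≤ 3 (ℕ.*-monoʳ-≤ n k≤m)) ⟩
    35 * (m * n) + m * n * 36 + m * n * 14 + n * m * 3
      ≡⟨ arith m n ⟩
    88 * (m * n) ∎
    where
    arith : ∀ m n → 35 * (m * n) + m * n * 36 + m * n * 14 + n * m * 3 ≡ 88 * (m * n)
    arith = ℕRing.solve-∀

  -- A round of the loop may be charged to `m * w`: the terms with `n` become terms with `m`, and
  -- `k` is at most the size `w` of a cover.
  scale-cost : ∀ {k w} → k ≤ w → 1 ≤ w → 53 + m * 54 + n * 22 + n * k * 3 ≤ 157 * (m * w)
  scale-cost {k} {w} k≤w 1≤w = begin
    53 + m * 54 + n * 22 + n * k * 3
      ≤⟨ ℕ.+-mono-≤ (ℕ.+-mono-≤ (ℕ.+-mono-≤ (ℕ.*-monoʳ-≤ 53 (ℕ.≤-trans 1≤m m≤mw)) (ℕ.*-monoˡ-≤ 54 m≤mw))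
          (ℕ.*-monoˡ-≤ 22 (ℕ.≤-trans n≤2m (ℕ.+-mono-≤ m≤mw m≤mw)))) (ℕ.*-monoˡ-≤ 3 (ℕ.*-mono-≤ n≤2m k≤w)) ⟩
    53 * (m * w) + m * w * 54 + (m * w + m * w) * 22 + (m + m) * w * 3
      ≡⟨ arith m w ⟩
    157 * (m * w) ∎
    where
    m≤mw : m ≤ m * w
    m≤mw = ℕ.m≤m*n m w {{ℕ.>-nonZero 1≤w}}
    arith : ∀ m w → 53 * (m * w) + m * w * 54 + (m * w + m * w) * 22 + (m + m) * w * 3 ≡ 157 * (m * w)
    arith = ℕRing.solve-∀

  total-cost : ∀ {k w} L → k ≤ m → k ≤ w → 1 ≤ w →
    (24 + m * 39 + n * 6 + m * n * 26 + n * n * 16) +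
        (35 + m * 36 + n * 14 + n * k * 3 + L * (53 + m * 54 + n * 22 + n * k * 3)) ≤ 215 * (m * (n + w * L))
  total-cost {k} {w} L k≤m k≤w 1≤w = begin
    (24 + m * 39 + n * 6 + m * n * 26 + n * n * 16) +
        (35 + m * 36 + n * 14 + n * k * 3 + L * (53 + m * 54 + n * 22 + n * k * 3))
      ≤⟨ ℕ.+-mono-≤ preparation-cost (ℕ.+-mono-≤ (final-cost k≤m) (ℕ.*-monoʳ-≤ L (scale-cost k≤w 1≤w))) ⟩
    127 * (m * n) + (88 * (m * n) + L * (157 * (m * w)))
      -- The padding `58 = 215 - 157` lets the constant `215 = 127 + 88` serve both summands.
      ≤⟨ ℕ.m≤m+n _ (58 * (m * w * L)) ⟩
    127 * (m * n) + (88 * (m * n) + L * (157 * (m * w))) + 58 * (m * w * L)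
      ≡⟨ arith m n w L ⟩
    215 * (m * (n + w * L)) ∎
    where
    arith : ∀ m n w L → 127 * (m * n) + (88 * (m * n) + L * (157 * (m * w))) + 58 * (m * w * L) ≡ 215 *
        (m * (n + w * L))
    arith = ℕRing.solve-∀

preparation-total : ∀ m n → 1 + (2 + (m * 3 + (2 + (m * 3 +
    (2 + (m * 3 + (2 + (m * 3 + (2 + (m * 3 + (2 + (m * 3 + (2 + (m * 3 +
  (2 + (m * (n * 2 + 5) + (2 + (n * 3 + (2 + (n * 3 +
      (2 + (((n + n) * (m * 2 + n * 2) + m * 2) * 4 + (m * ((n + n) * 4 + 5) + 1)))))))))))))))))))))))
  ≡ 24 + m * 39 + n * 6 + m * n * 26 + n * n * 16
preparation-total = ℕRing.solve-∀

mainLoop-total : ∀ m n L p → 1 + (L * suc (52 + m * 30 + n * 22 + m * 2 * 12 + p * 3) +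
    (2 + (m * 3 + (31 + m * 15 + n * 14 + m * 2 * 9 + p * 3 + 1))))
  ≡ 35 + m * 36 + n * 14 + p * 3 + L * (53 + m * 54 + n * 22 + p * 3)
mainLoop-total = ℕRing.solve-∀

-- Assembling the algorithm.

module Approximation (G : STDAG) (X : Fin (STDAG.m G) → ℤ) (flow : IsFlow G X) (e₀ : Fin (STDAG.m G)) where
  open Network G
  open Cuts G
  open Layout G
  open Preflow G
  open CoverProgram G
  open ExtractionProgram G
  open Stage G
  open Setup G X
  open Main G X

  private
    s≢t′ : s ≢ t
    s≢t′ = s≢t e₀

  record Prepared (σ : State) (ψ : ℕ) : Set where
    field
      adj     : Adjacency
      static  : Represented.Static adj σ
      {Z}     : Edge → ℤ
      {k}     : ℕ
      Z≈      : σ .arrays 10 ≈ Z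
      minimal : Push.MinimalCover support Z k
      X≈      : σ .arrays 5 ≈ X
      {M}     : ℕ
      M≡      : σ .vars 4 ≡ + M
      bounds  : ∀ e → ∣ X e ∣ ≤ M
      M≤‖X‖   : M ≤ ‖ X ‖
      weight≡ : σ .vars 14 ≡ 1ℤ
      output  : Out [] σ

  Φ-bound : ℕ
  Φ-bound = (n + n) * (m * 2 + n * 2) + m * 2

  preparationBudget : ℕ
  preparationBudget = setupBudget (2 + (m * (n * 2 + 5) +
      (2 + (n * 3 + (2 + (n * 3 + (2 + (Φ-bound * 4 + (m * ((n + n) * 4 + 5) + 1)))))))))

  Φ≤ : ∀ (adj : Adjacency) label → Push.potential support (Adjacency.inc adj) label (Adjacency.inc adj) ≤ Φ-bound
  Φ≤ adj label = ℕ.+-mono-≤ (begin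
    ∑ℕ (λ v → (n + n ∸ label v) * (length (inc v) + 2))  ≤⟨ ∑ℕ-mono
        (λ v → ℕ.*-monoˡ-≤ (length (inc v) + 2) (ℕ.m∸n≤m (n + n) (label v))) ⟩
    ∑ℕ (λ v → (n + n) * (length (inc v) + 2))            ≡⟨ ∑ℕ-* (n + n) (λ v → length (inc v) + 2) ⟩
    (n + n) * ∑ℕ (λ v → length (inc v) + 2)              ≡⟨ cong ((n + n) ℕ.*_)
        (trans (∑ℕ-+ (length ∘ inc) (λ _ → 2)) (cong₂ _+_ size (∑ℕ-const n 2))) ⟩
    (n + n) * (m * 2 + n * 2)                            ∎) (ℕ.≤-reflexive size)
    where
    open ℕ.≤-Reasoning
    open Adjacency adj

  run-preparation : Run preparation (initial (encodeInput G X)) preparationBudget Prepared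
  run-preparation =
    run-seq run-setup λ { σ₁ φ₁ _ Rd →
    let module R = Ready Rd
        open Represented R.adj
        module P = Push support in
    run-more (ℕ.≤-reflexive (sym R.credit))
    (run-seq (run-pull R.adj support support≥0 support≤1
        {rest = 2 + (n * 3 + (2 + (n * 3 + (2 + (Φ-bound * 4 + (m * ((n + n) * 4 + 5) + 1))))))} s≢t′ R.static
        R.parents R.ℓ≈ (λ e → R.Z≈ (+ toℕ e)))
    λ { σ₂ φ₂ sm₂ Pd →
    let module Pd = Pulled Pd
        st₂ = static-same sm₂ R.static in
    run-more (ℕ.≤-trans (ℕ.+-monoʳ-≤ 2 (ℕ.+-monoʳ-≤ (n * 3)
        (ℕ.+-monoʳ-≤ 2 (ℕ.+-monoʳ-≤ (n * 3) (ℕ.+-monoʳ-≤ 2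
        (ℕ.+-monoˡ-≤ (m * ((n + n) * 4 + 5) + 1) (ℕ.*-monoˡ-≤ 4 (Φ≤ R.adj (Pull.sinkLabel support support≥0)))))))))
      (ℕ.≤-trans (ℕ.m≤n+m _ (Pd.left * (n * 2 + 5))) Pd.credit))
    (run-seq (run-push R.adj support support≥0 support≤1 {rest = 1} st₂ (λ e → trans (sm₂ .sameArr 6 _) (R.ℓ≈ e))
        Pd.Z≈ Pd.pulls)
    λ { σ₃ φ₃ sm₃ Cv →
    let module Cv = Covered Cv in
    run-more Cv.credit
    (run-straight (assign 11 (const 1ℤ) ⨾ assign 13 (const 0ℤ) ⨾ assign 14 (const 1ℤ)) (record
      { adj = R.adj
      ; static = let st = static-same {push} sm₃ st₂ in record { Static st }
      ; Z≈ = Cv.Z≈ ; minimal = Cv.minimal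
      ; X≈ = λ e → trans (sm₃ .sameArr 5 _) (trans (sm₂ .sameArr 5 _) (R.X≈ e))
      ; M≡ = trans (sm₃ .sameVar 4) (trans (sm₂ .sameVar 4) R.M≡)
      ; bounds = R.bounds ; M≤‖X‖ = R.M≤‖X‖
      ; weight≡ = refl
      ; output = record { pos≡ = cong (+_ ∘ suc ∘ length) (sym payload-[]) ; cnt≡ = refl
                        ; seg = subst (Segment (σ₃ .arrays 1) 1) (sym payload-[]) (segment-[] {σ₃ .arrays 1} {1}) }
                            })) }) }) }

  private
    L : ℕ
    L = ⌈log₂ ‖ X ‖ ⌉

    loopBudget : ∀ {σ ψ} → Prepared σ ψ → ℕ
    loopBudget Pr = 1 + (L * suc (52 + m * 30 + n * 22 + entries * 12 + n * k * 3) +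
        (2 + (m * 3 + (31 + m * 15 + n * 14 + entries * 9 + n * k * 3 + 1))))
      where
      open Prepared Pr
      entries : ℕ
      entries = sizeOf (Adjacency.inc adj)

    Z≥0 : ∀ {σ ψ} (Pr : Prepared σ ψ) e → 0ℤ ℤ.≤ Prepared.Z Pr e
    Z≥0 Pr e = ℤ.≤-trans (support≥0 e) (Push.MinimalCover.covers (Prepared.minimal Pr) e)

    run-rest : ∀ {σ ψ} (Pr : Prepared σ ψ) →
      Run mainLoop σ (loopBudget Pr) (Finished (Push.MinimalCover.conserved (Prepared.minimal Pr)) (Z≥0 Pr)
        {Prepared.k Pr} (Push.MinimalCover.value (Prepared.minimal Pr)) s≢t′ (Prepared.adj Pr) L 0)
    run-rest Pr = run-mainLoop conserved (Z≥0 Pr) value s≢t′ adj static Z≈ X≈ M≡ weight≡ output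
      (flow-conserved flow) bounds supported (⌈log₂⌉-mono-≤ M≤‖X‖)
      where
      open Prepared Pr
      open Push.MinimalCover minimal
      supported : ∀ e → X e ≢ 0ℤ → 1ℤ ℤ.≤ Z e
      supported e X≢0 = subst (ℤ._≤ Z e) (support-1 X≢0) (covers e)

    -- The sum of the paths is a conserved flow above `support` whose value is their number, so
    -- minimality of `Z` applies. The result is used twice: with the paths of a decomposition for
    -- the approximation factor, and with a cover of all edges for the running time.
    k≤cover : ∀ {σ ψ} (Pr : Prepared σ ψ) Ps → (∀ e → X e ≢ 0ℤ → Any (λ P → e ∈ edges P) Ps) → Prepared.k Pr ≤ length
        Ps
    k≤cover Pr Ps covering = ℤ.drop‿+≤+ (ℤ.neg-cancel-≤
        (subst (ℤ._≤ ℤ.- (+ k)) (∂-pathSum-s e₀ Ps) (cover-minimal (pathSum-conserved Ps) covered)))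
      where
      open Prepared Pr
      open Push.MinimalCover minimal using () renaming (minimal to cover-minimal)
      covered : ∀ e → support e ℤ.≤ pathSum Ps e
      covered e = go (X e ℤ.≟ 0ℤ)
        where
        go : Dec (X e ≡ 0ℤ) → support e ℤ.≤ pathSum Ps e
        go (yes q) = subst (ℤ._≤ pathSum Ps e) (sym (support-0 q)) (pathSum≥0 Ps e)
        go (no q)  = subst (ℤ._≤ pathSum Ps e) (sym (support-1 q)) (pathSum-covers Ps (covering e q))

    positive : ∀ {k} → Fin k → 1 ≤ k
    positive {suc k} _ = s≤s z≤n

    nonempty : ∀ (Ps : List STPath) → Any (λ P → e₀ ∈ edges P) Ps → 1 ≤ length Ps
    nonempty (_ ∷ _) _ = s≤s z≤n

    n≤2m : n ≤ m + m
    n≤2m = ℕ.≤-trans n≤1+m (ℕ.+-monoˡ-≤ m (positive e₀))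

    credits : ∀ {σ ψ} (Pr : Prepared σ ψ) Ps → Covers G Ps → preparationBudget + loopBudget Pr ≤ 215 *
        (m * (n + length Ps * L))
    credits Pr Ps covering = ℕ.≤-trans (ℕ.≤-reflexive (cong₂ _+_ (preparation-total m n) loop≡))
      (Cost.total-cost (positive e₀) (positive s) n≤2m {k} {length Ps} L k≤m (k≤cover Pr Ps λ e _ → covering e)
          (nonempty Ps (covering e₀)))
      where
      open Prepared Pr
      open Push.MinimalCover minimal using (k≤m)
      loop≡ : loopBudget Pr ≡ 35 + m * 36 + n * 14 + n * k * 3 + L * (53 + m * 54 + n * 22 + n * k * 3)
      loop≡ = trans (cong form {sizeOf (Adjacency.inc adj)} {m * 2} (Adjacency.size adj))
          (mainLoop-total m n L (n * k))
        where
        form : ℕ → ℕ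
        form z = 1 + (L * suc (52 + m * 30 + n * 22 + z * 12 + n * k * 3) +
            (2 + (m * 3 + (31 + m * 15 + n * 14 + z * 9 + n * k * 3 + 1))))

  Solution : ℕ → Set
  Solution c = ∃[ σ ] ∃[ T ] ∃[ D ]
    ⟨ main , initial (encodeInput G X) ⟩⇓⟨ σ , T ⟩
    × Outputs σ (encodeOutput G D)
    × IsDecomposition G X D
    × (∀ k → IsMfdℤ G X k → length D ≤ (⌈log₂ ‖ X ‖ ⌉ + 1) * k)
    × (∀ w → IsWidth G w → T ≤ c * (m * (n + w * ⌈log₂ ‖ X ‖ ⌉)))

  private
    combine : ∀ {σ ψ} (Pr : Prepared σ ψ) {T₁} → ⟨ preparation , initial (encodeInput G X) ⟩⇓⟨ σ , T₁ ⟩ → T₁ ≤ unit *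
        preparationBudget →
      ∀ {Q} → Run mainLoop σ (loopBudget Pr) Q →
      (∀ {τ χ} → Q τ χ → ∃[ D ] (∀ e → X e ≡ weight D e) × length D ≤ suc L * Prepared.k Pr × Outputs τ
          (encodeOutput G D)) → Solution (unit * 215)
    combine Pr {T₁} exec₁ T₁≤ (run {τ} {T₂} ψ₂ exec₂ within₂ q) result =
      τ , T₁ + T₂ , D , seq exec₁ exec₂ , outputs , decomposes , approximates , fast
      where
      D = proj₁ (result q)
      sums = proj₁ (proj₂ (result q))
      count = proj₁ (proj₂ (proj₂ (result q)))
      outputs = proj₂ (proj₂ (proj₂ (result q)))
      decomposes : IsDecomposition G X D
      decomposes e = trans (sums e) (sym (weight-superposition D e))
      approximates : ∀ j → IsMfdℤ G X j → length D ≤ (L + 1) * j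
      approximates _ ((E , E-sums , refl) , _) = ℕ.≤-trans count (ℕ.≤-trans (ℕ.*-monoʳ-≤ (suc L)
        (ℕ.≤-trans (k≤cover Pr (map proj₂ E) λ e X≢0 → decomposition-covers E λ z → X≢0 (trans (E-sums e) z))
            (ℕ.≤-reflexive (length-map proj₂ E))))
        (ℕ.≤-reflexive (cong (_* length E) (ℕ.+-comm 1 L))))
      fast : ∀ w → IsWidth G w → T₁ + T₂ ≤ unit * 215 * (m * (n + w * L))
      fast _ ((Ps , covering , refl) , _) = begin
        T₁ + T₂                                    ≤⟨ ℕ.+-mono-≤ T₁≤ (ℕ.m+n≤o⇒m≤o T₂ within₂) ⟩
        unit * preparationBudget + unit * loopBudget Pr ≡⟨ ℕ.*-distribˡ-+ unit preparationBudget (loopBudget Pr) ⟨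
        unit * (preparationBudget + loopBudget Pr) ≤⟨ ℕ.*-monoʳ-≤ unit (credits Pr Ps covering) ⟩
        unit * (215 * (m * (n + length Ps * L)))   ≡⟨ ℕ.*-assoc unit 215 (m * (n + length Ps * L)) ⟨
        unit * 215 * (m * (n + length Ps * L))     ∎
        where open ℕ.≤-Reasoning

  solve : Solution (unit * 215)
  solve = assemble run-preparation
    where
    assemble : Run preparation (initial (encodeInput G X)) preparationBudget Prepared → Solution (unit * 215)
    assemble (run {time = T₁} ψ exec within Pr) = combine Pr exec (ℕ.m+n≤o⇒m≤o T₁ within) (run-rest Pr)
      λ F → let module F = Finished F in F.D , F.sums , F.count , F.outputs

corollary26 : ∃[ prog ] ∃[ c ]
    ∀ (G : STDAG) (let open STDAG G) (X : Edge → ℤ) →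
    IsFlow G X → (∃[ e ] X e ≢ 0ℤ) →
    ∃[ σ ] ∃[ T ] ∃[ D ]
    ⟨ prog , initial (encodeInput G X) ⟩⇓⟨ σ , T ⟩
    × Outputs σ (encodeOutput G D)
    × IsDecomposition G X D
    × (∀ k → IsMfdℤ G X k → length D ≤ (⌈log₂ ‖ X ‖ ⌉ + 1) * k)
    × (∀ w → IsWidth G w → T ≤ c * (m * (n + w * ⌈log₂ ‖ X ‖ ⌉)))
corollary26 = main , unit * 215 , λ G X flow (e₀ , _) → Approximation.solve G X flow e₀
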